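{- Up to isomorphism there are exactly 18 finite minimal involution-free graphs, and these are exactly the 18 finite minimal asymmetric graphs. That is, a finite graph is minimal involution-free if and only if it is minimal asymmetric.
   Context: All graphs are finite, simple (loopless) and undirected. A graph is asymmetric if its only automorphism is the identity. A graph is involution-free if it has no automorphism of order $2$. A graph $G$ on at least two vertices is minimal asymmetric if $G$ is asymmetric and no proper induced subgraph of $G$ on at least two vertices is asymmetric. A graph $G$ on at least two vertices is minimal involution-free if $G$ is involution-free and no proper induced subgraph of $G$ on at least two vertices is involution-free. -}

module Defs where

open import Data.Nat using (ℕ; _≤_; _<_)
open import Data.Fin using (Fin)
open import Data.Fin.Permutation using (Permutation; Permutation′; _⟨$⟩ʳ_)
open import Data.Bool using (Bool)
open import Data.Product using (Σ; ∃; _×_)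
open import Data.Vec using (Vec; lookup)
open import Function.Definitions using (Injective)
open import Function.Bundles using (_⇔_)
open import Relation.Binary.PropositionalEquality using (_≡_; _≢_)
open import Relation.Nullary using (¬_)

record Graph (n : ℕ) : Set where
  field
    adj   : Fin n → Fin n → Bool
    sym   : ∀ i j → adj i j ≡ adj j i
    irref : ∀ i → adj i i ≡ Bool.false
open Graph public

IsIso : ∀ {m n} → Graph m → Graph n → Permutation m n → Set
IsIso G H σ = ∀ i j → adj H (σ ⟨$⟩ʳ i) (σ ⟨$⟩ʳ j) ≡ adj G i j

_≅_ : ∀ {m n} → Graph m → Graph n → Set
G ≅ H = Σ (Permutation _ _) (IsIso G H)

IsAut : ∀ {n} → Graph n → Permutation′ n → Set
IsAut G σ = IsIso G G σ

IsIdentity : ∀ {n} → Permutation′ n → Set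
IsIdentity σ = ∀ i → σ ⟨$⟩ʳ i ≡ i

HasOrder2 : ∀ {n} → Permutation′ n → Set
HasOrder2 σ = ¬ IsIdentity σ × (∀ i → σ ⟨$⟩ʳ (σ ⟨$⟩ʳ i) ≡ i)

Asymmetric : ∀ {n} → Graph n → Set
Asymmetric G = ∀ σ → IsAut G σ → IsIdentity σ

InvolutionFree : ∀ {n} → Graph n → Set
InvolutionFree G = ∀ σ → IsAut G σ → ¬ HasOrder2 σ

-- Induced subgraph on the image of an injective map f : Fin k → Fin n
induced : ∀ {k n} → Graph n → (f : Fin k → Fin n) → Graph k
induced G f = record
  { adj   = λ i j → adj G (f i) (f j)
  ; sym   = λ i j → sym G (f i) (f j)
  ; irref = λ i → irref G (f i) }

Minimal : (∀ {k} → Graph k → Set) → ∀ {n} → Graph n → Set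
Minimal P {n} G =
  2 ≤ n × P G ×
  (∀ k → 2 ≤ k → k < n → (f : Fin k → Fin n) → Injective _≡_ _≡_ f →
     ¬ P (induced G f))

MinimalAsymmetric : ∀ {n} → Graph n → Set
MinimalAsymmetric = Minimal Asymmetric

MinimalInvolutionFree : ∀ {n} → Graph n → Set
MinimalInvolutionFree = Minimal InvolutionFree

AnyGraph : Set
AnyGraph = Σ ℕ Graph

-- Call a graph good if it contains none of the 18 graphs, has no module other than the trivial ones, and has no
-- involution. A minimal involution-free graph without any of the 18 graphs would be good, because an involution of
-- a module extends by the identity; so it is enough that no graph with at least two vertices is good. A good graph
-- contains an induced P₄, since a P₄-free graph can be cut into two parts joined completely or not at all. From there
-- one excludes induced subgraphs H one at a time, going from large H to P₄. Take an involution π of H. As π does not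
-- extend by the identity, some outer vertex v has a neighbourhood in H that π does not preserve. For each such
-- neighbourhood either H + v contains a graph that is already excluded, or v is a twin of some h in H relative to H - h;
-- in the latter case the set of all such twins is not a module, so a vertex z outside it separates h from another
-- twin m, and H + m + z contains an excluded graph for all possible adjacencies. Goodness is preserved by complementation,
-- so graphs are excluded together with their complements. Only two infinite families escape this scheme: paths, where a
-- longest one is reflected, and half graphs, where a largest one is reflected.
module Submission where

open import Defs renaming (sym to adj-sym)
open import Data.Bool using (Bool; true; false; T; not; _∧_; if_then_else_) renaming (_≟_ to _≟ᵇ_)
open import Data.Bool.Properties using (∧-comm; ∧-conicalˡ; ∧-conicalʳ; ∧-identityʳ; ¬-not; not-¬; not-injective; not-involutive)
open import Data.Empty using (⊥; ⊥-elim)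
open import Data.Fin using (Fin; zero; suc; toℕ; fromℕ<; punchOut)
open import Data.Fin.Permutation using (permutation; _⟨$⟩ʳ_; _⟨$⟩ˡ_; inverseˡ; inverseʳ; ↔⇒≡; _∘ₚ_) renaming (flip to inverse)
import Data.Fin.Properties as Fin
open import Data.List using (List; []; _∷_; _++_; map; length; filter; filterᵇ; upTo; allFin)
import Data.List as List
open import Data.List.Membership.Propositional using (_∈_; find)
open import Data.List.Membership.Propositional.Properties using (∈-filter⁺; ∈-filter⁻; ∈-allFin; ∈-lookup; ∈-++⁺ˡ; ∈-++⁺ʳ; ∈-map⁺)
import Data.List.Properties as List
open import Data.List.Relation.Unary.All using (All; []; _∷_)
import Data.List.Relation.Unary.All as All
import Data.List.Relation.Unary.All.Properties as All
open import Data.List.Relation.Unary.AllPairs using (_∷_)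
open import Data.List.Relation.Unary.Any using (Any; here; there; index)
import Data.List.Relation.Unary.Any as Any
import Data.List.Relation.Unary.Any.Properties as Any
open import Data.List.Relation.Unary.Unique.Propositional using (Unique)
open import Data.List.Relation.Unary.Unique.Propositional.Properties using (allFin⁺; filter⁺)
open import Data.Maybe using (Maybe; just; nothing)
open import Data.Nat using (ℕ; zero; suc; _+_; _∸_; _^_; _/_; _%_; _≡ᵇ_; _<ᵇ_; _≤_; _<_; z≤n; s≤s)
open import Data.Nat.Induction using (<-rec)
open import Data.Nat.Properties
open import Data.Product using (Σ; ∃; ∃₂; _×_; _,_; proj₁; proj₂)
open import Data.Sum using (_⊎_; inj₁; inj₂)
open import Data.Unit using (tt)
open import Data.Vec using (Vec; []; _∷_; lookup)
import Data.Vec as Vec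
import Data.Vec.Properties as Vec
open import Function using (_∘_; id; case_of_)
open import Function.Bundles using (_⇔_; mk⇔)
open import Function.Definitions using (Injective)
open import Relation.Binary.Definitions using (tri<; tri≈; tri>)
open import Relation.Binary.PropositionalEquality using (_≡_; _≢_; refl; sym; trans; cong; cong₂; subst; ≢-sym)
open import Relation.Nullary using (¬_; Dec; yes; no; contradiction)
open import Relation.Nullary.Decidable using (_×-dec_; map′)

-- Both claims follow from one: every involution-free graph on at least two vertices contains one of
-- the 18 graphs. These are asymmetric, asymmetric graphs are involution-free, and none of the 18
-- embeds in another; so either kind of minimality forces a graph to be one of them. The obstacle is
-- that the exclusions concern graphs of every size, while each should be a finite computation. An
-- exclusion of `H` looks only at `H` and at most two outer vertices. Their adjacencies become
-- Boolean variables, an occurrence of an excluded graph becomes a conjunction of literals, and the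
-- claim that some occurrence is unavoidable becomes a tautology check decided by `refl`. The hints
-- merely name occurrences; each is verified and a useless one is dropped, so nothing depends on how
-- they were found. For paths and half graphs the finite checks only describe neighbourhoods in
-- windows of six vertices; a downward induction on the size, bounded by the number of vertices of
-- the graph, puts these together.

infix 4 _==_
_==_ : Bool → Bool → Bool
true  == b = b
false == b = not b

==-sound : ∀ a b → (a == b) ≡ true → a ≡ b
==-sound true  true  _ = refl
==-sound false false _ = refl

==-refl : ∀ a → (a == a) ≡ true
==-refl true  = refl
==-refl false = refl

==-≢ : ∀ {a b} → not (a == b) ≡ true → a ≢ b
==-≢ {true}  () refl
==-≢ {false} () refl

≡ᵇ-sound : ∀ i j → (i ≡ᵇ j) ≡ true → i ≡ j
≡ᵇ-sound i j eq = ≡ᵇ⇒≡ i j (subst T (sym eq) tt)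

≡ᵇ-≢ : ∀ i j → not (i ≡ᵇ j) ≡ true → i ≢ j
≡ᵇ-≢ zero    zero    () _
≡ᵇ-≢ (suc i) (suc .i) eq refl = ≡ᵇ-≢ i i eq refl

<ᵇ-sound : ∀ i j → (i <ᵇ j) ≡ true → i < j
<ᵇ-sound i j eq = <ᵇ⇒< i j (subst T (sym eq) tt)

<ᵇ-true : ∀ {i j} → i < j → (i <ᵇ j) ≡ true
<ᵇ-true {zero}  {suc j} _         = refl
<ᵇ-true {suc i} {suc j} (s≤s i<j) = <ᵇ-true i<j

<ᵇ-false : ∀ {i j} → j ≤ i → (i <ᵇ j) ≡ false
<ᵇ-false {j = zero}          _         = refl
<ᵇ-false {suc i} {suc j} (s≤s j≤i) = <ᵇ-false j≤i

allBelow anyBelow : ℕ → (ℕ → Bool) → Bool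
allBelow zero    p = true
allBelow (suc k) p = p k ∧ allBelow k p
anyBelow zero    p = false
anyBelow (suc k) p = if p k then true else anyBelow k p

allBelow-sound : ∀ k {p} → allBelow k p ≡ true → ∀ {i} → i < k → p i ≡ true
allBelow-sound (suc k) {p} eq {i} (s≤s i≤k) with m≤n⇒m<n∨m≡n i≤k
... | inj₁ i<k  = allBelow-sound k (∧-conicalʳ (p k) _ eq) i<k
... | inj₂ refl = ∧-conicalˡ (p k) _ eq

anyBelow-sound : ∀ k {p} → anyBelow k p ≡ true → ∃ λ i → i < k × p i ≡ true
anyBelow-sound (suc k) {p} eq with p k in pk
... | true  = k , n<1+n k , pk
... | false with anyBelow-sound k eq
...   | i , i<k , pi = i , m<n⇒m<1+n i<k , pi

allOf anyOf : {X : Set} → (X → Bool) → List X → Bool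
allOf p []       = true
allOf p (x ∷ xs) = p x ∧ allOf p xs
anyOf p []       = false
anyOf p (x ∷ xs) = if p x then true else anyOf p xs

allOf-sound : ∀ {X : Set} {p : X → Bool} xs → allOf p xs ≡ true → All (λ x → p x ≡ true) xs
allOf-sound         []       _  = []
allOf-sound {p = p} (x ∷ xs) eq = ∧-conicalˡ (p x) _ eq ∷ allOf-sound xs (∧-conicalʳ (p x) _ eq)

allOf-complete : ∀ {X : Set} {p : X → Bool} {xs} → All (λ x → p x ≡ true) xs → allOf p xs ≡ true
allOf-complete []         = refl
allOf-complete (px ∷ pxs) rewrite px = allOf-complete pxs

anyOf-sound : ∀ {X : Set} {p : X → Bool} xs → anyOf p xs ≡ true → ∃ λ x → x ∈ xs × p x ≡ true
anyOf-sound {p = p} (x ∷ xs) eq with p x in px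
... | true  = x , here refl , px
... | false with anyOf-sound xs eq
...   | y , y∈ , py = y , there y∈ , py

-- Finite graphs as shapes

nth : {X : Set} → X → List X → ℕ → X
nth d []       _       = d
nth d (x ∷ xs) zero    = x
nth d (x ∷ xs) (suc i) = nth d xs i

-- Only the values of edge at i < j < order matter.
record Shape : Set where
  constructor shape
  field
    order : ℕ
    edge  : ℕ → ℕ → Bool
open Shape public

-- Off the diagonal this is the symmetric closure of `edge`; the value on the diagonal carries no
-- meaning.
edge′ : Shape → ℕ → ℕ → Bool
edge′ Q i j = if i <ᵇ j then edge Q i j else edge Q j i

edge′-< : ∀ Q {i j} → i < j → edge′ Q i j ≡ edge Q i j
edge′-< Q i<j rewrite <ᵇ-true i<j = refl

edge′-> : ∀ Q {i j} → j < i → edge′ Q i j ≡ edge Q j i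
edge′-> Q {i} {j} j<i rewrite <ᵇ-false {i} {j} (<⇒≤ j<i) = refl

co : Shape → Shape
co Q = shape (order Q) λ i j → not (edge Q i j)

bit : ℕ → ℕ → Bool
bit m i = _/_ m (2 ^ i) {{m^n≢0 2 i}} % 2 ≡ᵇ 1

-- Row j of a table is the bit mask of the neighbours i < j of j.
table : List ℕ → Shape
table rows = shape (length rows) λ i j → bit (nth 0 rows j) i

Adjacency : ℕ → Set
Adjacency n = Fin n → Fin n → Bool

-- Injectivity is not required: the shapes in use have no twins, so that it is automatic.
Realises : ∀ {n} → Adjacency n → Shape → (ℕ → Fin n) → Set
Realises A Q e = ∀ {i j} → i < j → j < order Q → A (e i) (e j) ≡ edge Q i j

complement : ∀ {n} → Adjacency n → Adjacency n
complement A x y = not (A x y)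

-- `vv i` and `zz i` stand for the adjacency of an outer vertex v or z to vertex `i` of a shape, and
-- `vz` for the adjacency of v and z.
data Var : Set where
  vv zz : ℕ → Var
  vz    : Var

_=ᵛ_ : Var → Var → Bool
vv i =ᵛ vv j = i ≡ᵇ j
zz i =ᵛ zz j = i ≡ᵇ j
vz   =ᵛ vz   = true
_    =ᵛ _    = false

=ᵛ-sound : ∀ x y → (x =ᵛ y) ≡ true → x ≡ y
=ᵛ-sound (vv i) (vv j) eq = cong vv (≡ᵇ-sound i j eq)
=ᵛ-sound (zz i) (zz j) eq = cong zz (≡ᵇ-sound i j eq)
=ᵛ-sound vz     vz     _  = refl

-- Tautology checks

Literal Clause : Set
Literal = Var × Bool
Clause  = List Literal

Sat : (Var → Bool) → Clause → Set
Sat β = All λ l → β (proj₁ l) ≡ proj₂ l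

_∷?_ : Literal → Maybe Clause → Maybe Clause
l ∷? just c  = just (l ∷ c)
l ∷? nothing = nothing

_∷??_ : Maybe Clause → List Clause → List Clause
just c  ∷?? cs = c ∷ cs
nothing ∷?? cs = cs

assign : Var → Bool → Clause → Maybe Clause
assign x b []             = just []
assign x b ((y , c) ∷ ls) =
  if x =ᵛ y then (if b == c then assign x b ls else nothing)
            else (y , c) ∷? assign x b ls

restrict : Var → Bool → List Clause → List Clause
restrict x b []       = []
restrict x b (c ∷ cs) = assign x b c ∷?? restrict x b cs

-- Clauses are conjunctions; their disjunction is tested for being a tautology.
covers : ℕ → List Clause → Bool
covers zero    _                      = false
covers (suc m) []                     = false
covers (suc m) ([] ∷ _)               = true
-- The first variable of the first clause is fixed both ways. The fuel bounds the number of
-- variables; shapes have at most nine vertices, which gives at most 19 variables, so the fuel 64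
-- used below suffices.
covers (suc m) cs@(((x , _) ∷ _) ∷ _) =
  covers m (restrict x true cs) ∧ covers m (restrict x false cs)

assign-sound : ∀ {β x b} c {c′} → assign x b c ≡ just c′ → β x ≡ b → Sat β c′ → Sat β c
assign-sound [] refl _ _ = []
assign-sound {x = x} {b} ((y , c) ∷ ls) eq βx s with x =ᵛ y in xy
... | true with b == c in bc
...   | true  = trans (cong _ (sym (=ᵛ-sound x y xy))) (trans βx (==-sound b c bc))
                ∷ assign-sound ls eq βx s
assign-sound {x = x} {b} ((y , c) ∷ ls) eq βx s | false with assign x b ls in eq′
assign-sound {x = x} {b} ((y , c) ∷ ls) refl βx (l ∷ s) | false | just c″ =
  l ∷ assign-sound ls eq′ βx s

restrict-sound : ∀ {β x b} cs → β x ≡ b → Any (Sat β) (restrict x b cs) → Any (Sat β) cs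
restrict-sound {x = x} {b} (c ∷ cs) βx p with assign x b c in eq
restrict-sound (c ∷ cs) βx (here s)  | just c′ = here (assign-sound c eq βx s)
restrict-sound (c ∷ cs) βx (there p) | just c′ = there (restrict-sound cs βx p)
restrict-sound (c ∷ cs) βx p         | nothing = there (restrict-sound cs βx p)

covers-sound : ∀ m cs → covers m cs ≡ true → ∀ β → Any (Sat β) cs
covers-sound (suc m) ([] ∷ _) _ β = here []
covers-sound (suc m) cs@(((x , _) ∷ _) ∷ _) eq β with β x in βx
... | true  = restrict-sound cs βx (covers-sound m _ (∧-conicalˡ _ _ eq) β)
... | false = restrict-sound cs βx (covers-sound m _ (∧-conicalʳ _ _ eq) β)

Any-++-refute : ∀ {X : Set} {P : X → Set} xs {ys} → All (λ y → ¬ P y) ys → Any P (xs ++ ys) → Any P xs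
Any-++-refute xs ¬ys p with Any.++⁻ xs p
... | inj₁ q = q
... | inj₂ q = ⊥-elim (All.All¬⇒¬Any ¬ys q)

-- Occurrences of excluded shapes

-- The vertices of a realised shape together with two further vertices v and z.
data Pos : Set where
  hh    : ℕ → Pos
  pv pz : Pos

-- `none` stands for a repeated position or an index out of range; a hint that meets it is
-- discarded.
data Entry : Set where
  known : Bool → Entry
  var   : Var → Entry
  none  : Entry

entry : Shape → Pos → Pos → Entry
entry H (hh i) (hh j) =
  if (i <ᵇ j) ∧ (j <ᵇ order H) then known (edge H i j)
  else if (j <ᵇ i) ∧ (i <ᵇ order H) then known (edge H j i)
  else none
entry H (hh i) pv     = var (vv i)
entry H pv     (hh i) = var (vv i)
entry H (hh i) pz     = var (zz i)
entry H pz     (hh i) = var (zz i)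
entry H pv     pz     = var vz
entry H pz     pv     = var vz
entry H _      _      = none

require : Entry → Bool → Maybe Clause → Maybe Clause
require (known a) b m = if a == b then m else nothing
require (var x)   b m = (x , b) ∷? m
require none      b m = nothing

-- The condition on v and z under which φ realises Q.
column : Shape → Shape → (ℕ → Pos) → ℕ → ℕ → Maybe Clause → Maybe Clause
column H Q φ j zero    m = m
column H Q φ j (suc i) m = require (entry H (φ i) (φ j)) (edge Q i j) (column H Q φ j i m)

embedding : Shape → Shape → (ℕ → Pos) → ℕ → Maybe Clause
embedding H Q φ zero    = just []
embedding H Q φ (suc j) = column H Q φ j j (embedding H Q φ j)

digits : ℕ → ℕ → List ℕ
digits zero    m = []
digits (suc k) m = m % 16 ∷ digits k (m / 16)

toPos : ℕ → ℕ → Pos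
toPos k d = if d <ᵇ k then hh d else if d ≡ᵇ k then pv else pz

toggle : Bool → Shape → Shape
toggle true  Q = co Q
toggle false Q = Q

known? : List Shape → ℕ → Shape
known? D h = toggle (h % 2 ≡ᵇ 1) (nth (shape 0 λ _ _ → false) D ((h % 256) / 2))

-- A hint names an embedding of a shape of D or of its complement: the last two hexadecimal digits are
-- twice the index of the shape, plus one for the complement; the digits before them are, from right to
-- left, the images of the vertices, where order H and order H + 1 stand for v and z.
refutation : List Shape → Shape → (Pos → Pos) → ℕ → Maybe Clause
refutation D H f h =
  -- An index out of range yields the shape of order 0, which every map realises and which therefore
  -- refutes nothing.
  if 0 <ᵇ order Q then embedding H Q φ (order Q) else nothing
  where
  Q = known? D h
  ds = map (toPos (order H)) (digits (order Q) (h / 256))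
  φ : ℕ → Pos
  φ i = f (nth pv ds i)

refutations : List Shape → Shape → (Pos → Pos) → List ℕ → List Clause
refutations D H f []       = []
refutations D H f (h ∷ hs) = refutation D H f h ∷?? refutations D H f hs

-- Certificates of exclusion

-- A vertex twin of the shape, and hints for the vertices v (a twin of it) and z separating the two.
record Split : Set where
  constructor split
  field
    twin  : ℕ
    hints : List ℕ
open Split public

-- A shape with an involution swap, and hints excluding the neighbourhoods of v that are not preserved by swap.
record Node : Set where
  constructor node
  field
    rows   : List ℕ
    swap   : List ℕ
    hintsᵛ : List ℕ
    splits : List Split
open Node public

-- This map and the next recycle the hints of a node: z can play the role of v, both for the shape
-- itself and for its copy in which v has replaced the twin.
v↦z : Pos → Pos
v↦z pv = pz
v↦z p  = p

twin↦v : ℕ → Pos → Pos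
twin↦v h (hh i) = if i ≡ᵇ h then pv else hh i
twin↦v h pv     = pz
twin↦v h pz     = pz

others : Shape → ℕ → List ℕ
others H h = filterᵇ (λ j → not (j ≡ᵇ h)) (upTo (order H))

-- The assignments that need no refutation: v differs from the twin somewhere on the rest of `H`, z
-- agrees with the twin on all of it, or z does not separate v from the twin.
splitCases : Shape → Split → List Clause
splitCases H s =
  map (λ j → (vv j , not (edge′ H (twin s) j)) ∷ []) (others H (twin s))
  ++ map (λ j → zz j , edge′ H (twin s) j) (others H (twin s))
   ∷ ((vz , true) ∷ (zz (twin s) , true) ∷ [])
   ∷ ((vz , false) ∷ (zz (twin s) , false) ∷ [])
   ∷ []

splitOK : List Shape → Shape → List ℕ → Split → Bool
splitOK D H hs s =
  (h <ᵇ order H)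
  ∧ allOf (λ j → (j <ᵇ order H) ∧ not (j ≡ᵇ h)) (others H (twin s))
  -- Some vertex of `H` is not a twin of `h`, so the set of all twins is proper and primality
  -- applies to it.
  ∧ anyBelow (order H) (λ i → anyOf (λ j → not (i ≡ᵇ j) ∧ not (edge′ H i j == edge′ H h j)) (others H (twin s)))
  ∧ covers 64 (splitCases H s
              ++ refutations D H id (hints s) ++ refutations D H id hs
              ++ refutations D H v↦z hs ++ refutations D H (twin↦v h) hs)
  where h = twin s

twinClause : Shape → Split → Clause
twinClause H s = map (λ j → vv j , edge′ H (twin s) j) (others H (twin s))

typesOK : List Shape → Shape → List ℕ → List Split → List Clause → Bool
typesOK D H hs ss cs = covers 64 (cs ++ map (twinClause H) ss ++ refutations D H id hs)

distinguishes : Shape → ℕ → ℕ → ℕ → Bool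
distinguishes H i j w = not (w ≡ᵇ i) ∧ not (w ≡ᵇ j) ∧ not (edge′ H i w == edge′ H j w)

twinFree : Shape → Bool
twinFree H = allBelow (order H) λ j → allBelow j λ i → anyBelow (order H) (distinguishes H i j)

nodeOK : List Shape → Node → Bool
nodeOK D N =
  allBelow k (λ i → (π i <ᵇ k) ∧ (π (π i) ≡ᵇ i))
  ∧ allBelow k (λ j → allBelow j λ i → edge′ H (π i) (π j) == edge H i j)
  ∧ anyBelow k (λ i → not (π i ≡ᵇ i))
  ∧ twinFree H
  ∧ allOf (splitOK D H (hintsᵛ N)) (splits N)
  ∧ allBelow k (λ i → if i <ᵇ π i then typesOK D H (hintsᵛ N) (splits N) (unswapped i) else true)
  where
  H = table (rows N)
  k = order H
  π : ℕ → ℕ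
  π = nth 0 (swap N)
  -- The disjunction of the two clauses says that adjacency to `i` implies adjacency to `π i`. Only
  -- this direction is tested; the other follows from the symmetry of `H` under `π`.
  unswapped : ℕ → List Clause
  unswapped i = ((vv i , false) ∷ []) ∷ ((vv (π i) , true) ∷ []) ∷ []

-- A checked shape joins `D`, so that later nodes can cite it; its position in this growing list is
-- its number in the hints.
nodesOK : List Shape → List Node → Bool
nodesOK D []       = true
nodesOK D (N ∷ Ns) = nodeOK D N ∧ nodesOK (D ++ table (rows N) ∷ []) Ns

-- Good graphs

-- The diagonal is only required to be constant, so that the complement is the negation.
record Good (Qs : List Shape) {n} (A : Adjacency n) : Set where
  field
    symmetric : ∀ x y → A x y ≡ A y x
    diagonal  : ∀ x y → A x x ≡ A y y
    excluded  : ∀ {Q} → Q ∈ Qs → ∀ e → ¬ Realises A Q e × ¬ Realises A (co Q) e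
    prime     : ∀ (M : Fin n → Bool) {x y o} → x ≢ y → M x ≡ true → M y ≡ true → M o ≡ false →
                ∃₂ λ p q → ∃ λ z → M p ≡ true × M q ≡ true × M z ≡ false × A z p ≡ true × A z q ≡ false
    rigid     : ∀ (τ : Fin n → Fin n) → (∀ x → τ (τ x) ≡ x) → (∀ x y → A (τ x) (τ y) ≡ A x y) → ∀ x → τ x ≡ x
open Good public

Good-complement : ∀ {Qs n} {A : Adjacency n} → Good Qs A → Good Qs (complement A)
Good-complement {A = A} g = record
  { symmetric = λ x y → cong not (symmetric g x y)
  ; diagonal  = λ x y → cong not (diagonal g x y)
  ; excluded  = λ Q∈ e →
      (λ r → proj₂ (excluded g Q∈ e) λ i<j j<k → trans (sym (not-involutive _)) (cong not (r i<j j<k))) ,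
      (λ r → proj₁ (excluded g Q∈ e) λ i<j j<k → not-injective (r i<j j<k))
  ; prime     = λ M x≢y Mx My Mo → let p , q , z , Mp , Mq , Mz , zp , zq = prime g M x≢y Mx My Mo in
      q , p , z , Mq , Mp , Mz , cong not zq , cong not zp
  ; rigid     = λ τ inv aut → rigid g τ inv λ x y → not-injective (aut x y) }

-- All good `A` are quantified over at once, because passing from a shape to its complement replaces
-- `A` by its complement.
Bad : List Shape → ℕ → Shape → Set
Bad Qs n Q = ∀ (A : Adjacency n) → Good Qs A → ∀ e → ¬ Realises A Q e

Bad-co : ∀ {Qs n Q} → Bad Qs n Q → Bad Qs n (co Q)
Bad-co bad A g e r = bad (complement A) (Good-complement g) e λ i<j j<k →
  trans (cong not (r i<j j<k)) (not-involutive _)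

Bad-toggle : ∀ {Qs n Q} b → Bad Qs n Q → Bad Qs n (toggle b Q)
Bad-toggle true  bad = Bad-co bad
Bad-toggle false bad = bad

Bad-nth : ∀ {Qs n d} D → All (Bad Qs n) D → ∀ i → nth d D i ≡ d ⊎ Bad Qs n (nth d D i)
Bad-nth []      _          i       = inj₁ refl
Bad-nth (Q ∷ D) (b ∷ _)    zero    = inj₂ b
Bad-nth (Q ∷ D) (_ ∷ bs)   (suc i) = Bad-nth D bs i

Realises′ : ∀ {n} (A : Adjacency n) (Q : Shape) (e : ℕ → Fin n) → Set
Realises′ A Q e = ∀ {i j} → i < order Q → j < order Q → i ≢ j → A (e i) (e j) ≡ edge′ Q i j

realises′ : ∀ {n} {A : Adjacency n} {Q e} → (∀ x y → A x y ≡ A y x) → Realises A Q e → Realises′ A Q e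
realises′ {Q = Q} {e} A-sym r {i} {j} i<k j<k i≢j with <-cmp i j
... | tri< i<j _ _ = trans (r i<j j<k) (sym (edge′-< Q i<j))
... | tri≈ _ i≡j _ = contradiction i≡j i≢j
... | tri> _ _ j<i = trans (A-sym _ _) (trans (r j<i i<k) (sym (edge′-> Q j<i)))

-- Soundness of the certificates

module Context {Qs : List Shape} {n} {A : Adjacency n} (g : Good Qs A)
               (H : Shape) (e : ℕ → Fin n) (r : Realises A H e) where

  at : Fin n → Fin n → Pos → Fin n
  at v z (hh i) = e i
  at v z pv     = v
  at v z pz     = z

  val : Fin n → Fin n → Var → Bool
  val v z (vv i) = A v (e i)
  val v z (zz i) = A z (e i)
  val v z vz     = A v z

  module _ (v z : Fin n) where

    require-sound : ∀ p q b {m c} → require (entry H p q) b m ≡ just c → Sat (val v z) c →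
                    A (at v z p) (at v z q) ≡ b × (∃ λ c′ → m ≡ just c′ × Sat (val v z) c′)
    require-sound (hh i) (hh j) b {m} eq s with (i <ᵇ j) ∧ (j <ᵇ order H) in c₁
    require-sound (hh i) (hh j) b {m} eq s | true with edge H i j == b in c₂
    require-sound (hh i) (hh j) b {m} eq s | true | true =
      trans (r (<ᵇ-sound i j (∧-conicalˡ _ _ c₁)) (<ᵇ-sound j _ (∧-conicalʳ (i <ᵇ j) _ c₁)))
          (==-sound _ b c₂) , _ , eq , s
    require-sound (hh i) (hh j) b {m} eq s | false with (j <ᵇ i) ∧ (i <ᵇ order H) in c₁
    require-sound (hh i) (hh j) b {m} eq s | false | true with edge H j i == b in c₂
    require-sound (hh i) (hh j) b {m} eq s | false | true | true =
      trans (symmetric g _ _)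
        (trans (r (<ᵇ-sound j i (∧-conicalˡ _ _ c₁)) (<ᵇ-sound i _ (∧-conicalʳ (j <ᵇ i) _ c₁)))
            (==-sound _ b c₂)) , _ , eq , s
    require-sound (hh i) pv b {just _} refl (l ∷ s) = trans (symmetric g _ _) l , _ , refl , s
    require-sound (hh i) pz b {just _} refl (l ∷ s) = trans (symmetric g _ _) l , _ , refl , s
    require-sound pv (hh i) b {just _} refl (l ∷ s) = l , _ , refl , s
    require-sound pz (hh i) b {just _} refl (l ∷ s) = l , _ , refl , s
    require-sound pv pz b {just _} refl (l ∷ s) = l , _ , refl , s
    require-sound pz pv b {just _} refl (l ∷ s) = trans (symmetric g _ _) l , _ , refl , s

    column-sound : ∀ Q φ j i {m c} → column H Q φ j i m ≡ just c → Sat (val v z) c →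
                   (∀ {i′} → i′ < i → A (at v z (φ i′)) (at v z (φ j)) ≡ edge Q i′ j)
                   × (∃ λ c′ → m ≡ just c′ × Sat (val v z) c′)
    column-sound Q φ j zero    eq s = (λ ()) , _ , eq , s
    column-sound Q φ j (suc i) eq s with require-sound (φ i) (φ j) (edge Q i j) eq s
    ... | a , c₁ , eq₁ , s₁ with column-sound Q φ j i eq₁ s₁
    ...   | as , rest = below , rest
      where
      below : ∀ {i′} → i′ < suc i → A (at v z (φ i′)) (at v z (φ j)) ≡ edge Q i′ j
      below (s≤s i′≤i) with m≤n⇒m<n∨m≡n i′≤i
      ... | inj₁ i′<i = as i′<i
      ... | inj₂ refl = a

    embedding-sound : ∀ Q φ k {c} → embedding H Q φ k ≡ just c → Sat (val v z) c →
                      ∀ {i j} → i < j → j < k → A (at v z (φ i)) (at v z (φ j)) ≡ edge Q i j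
    embedding-sound Q φ (suc k) eq s i<j (s≤s j≤k) with column-sound Q φ k k eq s
    ... | as , c₁ , eq₁ , s₁ with m≤n⇒m<n∨m≡n j≤k
    ...   | inj₁ j<k  = embedding-sound Q φ k eq₁ s₁ i<j j<k
    ...   | inj₂ refl = as i<j

    refutations-sound : ∀ {D} → All (Bad Qs n) D → ∀ f hs → All (λ c → ¬ Sat (val v z) c) (refutations D H f hs)
    refutations-sound bs f [] = []
    refutations-sound {D} bs f (h ∷ hs) with refutation D H f h in eq
    ... | nothing = refutations-sound bs f hs
    ... | just c  = refute eq ∷ refutations-sound bs f hs
      where
      refute : refutation D H f h ≡ just c → ¬ Sat (val v z) c
      refute eq s with 0 <ᵇ order (known? D h) in pos
      ... | true with Bad-nth {d = shape 0 λ _ _ → false} D bs ((h % 256) / 2)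
      ...   | inj₂ bad = Bad-toggle (h % 2 ≡ᵇ 1) bad A g _ (embedding-sound (known? D h) _ _ eq s)
      ...   | inj₁ dflt with h % 2 ≡ᵇ 1
      ...     | true  rewrite dflt = case pos of λ ()
      ...     | false rewrite dflt = case pos of λ ()

  module _ {D : List Shape} (bs : All (Bad Qs n) D) where

    split-sound : ∀ hs s → splitOK D H hs s ≡ true → ∀ v → v ≢ e (twin s) → ¬ Sat (val v v) (twinClause H s)
    split-sound hs s ok v v≢ sat =
      let p , q , z , Mp , Mq , Mz , zp , zq = prime g M v≢ (member sat) Mh (proj₂ outsider) in
      -- Primality yields z outside `M` that separates two members p and q of `M`, neither of which
      -- need be `e h`. Whatever the adjacency of z to `e h`, one of p and q disagrees with it and
      -- takes the role of v.
      case A z (e h) ≟ᵇ true of λ where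
        (yes zh) → absurd q z Mq Mz λ qz≡zh → contradiction (trans (sym zh) (trans (sym qz≡zh) (trans
            (symmetric g q z) zq))) λ ()
        (no ¬zh) → absurd p z Mp Mz λ pz≡zh → ¬zh (trans (sym pz≡zh) (trans (symmetric g p z) zp))
      where
      h = twin s
      M : Fin n → Bool
      M x = allOf (λ j → A x (e j) == edge′ H h j) (others H (twin s))
      ok₁ = ∧-conicalʳ (h <ᵇ order H) _ ok
      ok₂ = ∧-conicalʳ (allOf (λ j → (j <ᵇ order H) ∧ not (j ≡ᵇ h)) (others H (twin s))) _ ok₁
      h<k : h < order H
      h<k = <ᵇ-sound h _ (∧-conicalˡ _ _ ok)
      inside : All (λ j → (j <ᵇ order H) ∧ not (j ≡ᵇ h) ≡ true) (others H (twin s))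
      inside = allOf-sound (others H (twin s)) (∧-conicalˡ _ _ ok₁)
      member : ∀ {x} → Sat (val x x) (twinClause H s) → M x ≡ true
      member sat = allOf-complete (All.map (λ {j} a → subst (λ b → (b == edge′ H h j) ≡ true) (sym a) (==-refl (edge′ H h j))) (All.map⁻ sat))
      Mh : M (e h) ≡ true
      Mh = allOf-complete (All.map (λ {j} j-ok →
        subst (λ b → (b == edge′ H h j) ≡ true)
              (sym (realises′ (symmetric g) r h<k (<ᵇ-sound j _ (∧-conicalˡ _ _ j-ok))
                  (≢-sym (≡ᵇ-≢ j h (∧-conicalʳ (j <ᵇ order H) _ j-ok)))))
              (==-refl (edge′ H h j))) inside)
      outsider : ∃ λ o → M o ≡ false
      outsider with anyBelow-sound (order H) (∧-conicalˡ _ _ ok₂)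
      ... | i , i<k , w with anyOf-sound (others H (twin s)) w
      ...   | j , j∈ , ne = e i , ¬-not λ Mi →
        ==-≢ (∧-conicalʳ (not (i ≡ᵇ j)) _ ne)
          (trans (sym (realises′ (symmetric g) r i<k (<ᵇ-sound j _ (∧-conicalˡ _ _ (All.lookup inside j∈)))
              (≡ᵇ-≢ i j (∧-conicalˡ _ _ ne))))
                 (==-sound (A (e i) (e j)) _ (All.lookup (allOf-sound (others H (twin s)) Mi) j∈)))
      absurd : ∀ v z → M v ≡ true → M z ≡ false → ¬ (A v z ≢ A z (e h))
      absurd v z Mv Mz ne with Any.++⁻ (map (λ j → (vv j , not (edge′ H h j)) ∷ []) (others H (twin s)))
        (Any-++-refute (splitCases H s)
          (All.++⁺ (refutations-sound v z bs id (hints s)) (All.++⁺ (refutations-sound v z bs id hs)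
            (All.++⁺ (refutations-sound v z bs v↦z hs) (refutations-sound v z bs (twin↦v h) hs))))
          (covers-sound 64 _ (∧-conicalʳ (anyBelow (order H) _) _ ok₂) (val v z)))
      ... | inj₁ disagrees =
        case All.lookupAny (allOf-sound (others H (twin s)) Mv) (Any.map⁻ disagrees) of λ where
          (Mj , (a ∷ [])) → not-¬ (==-sound _ _ Mj) (sym (trans (sym a) refl))
      ... | inj₂ (here sat) = contradiction (trans (sym Mz) (allOf-complete (All.map (λ {j} a → subst (λ b → (b == edge′ H h j) ≡ true) (sym a) (==-refl (edge′ H h j))) (All.map⁻ sat)))) λ ()
      ... | inj₂ (there (here (a ∷ b ∷ []))) = ne (trans a (sym b))
      ... | inj₂ (there (there (here (a ∷ b ∷ [])))) = ne (trans a (sym b))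

    -- The vertex `v` only has to avoid the twins of the listed splits. With no splits it may even
    -- be a vertex of the realised shape; the half graphs rely on this.
    types-sound : ∀ hs ss cs → allOf (splitOK D H hs) ss ≡ true → typesOK D H hs ss cs ≡ true →
                  ∀ v → All (λ s → v ≢ e (twin s)) ss → Any (Sat (val v v)) cs
    types-sound hs ss cs ok types v v≢ = Any-++-refute cs
      (All.++⁺ (All.map⁺ (All.zipWith (λ {s} (s-ok , v≢h) → split-sound hs s s-ok v v≢h) (allOf-sound ss ok , v≢)))
               (refutations-sound v v bs id hs))
      (covers-sound 64 _ types (val v v))

    outer-types-sound : ∀ hs ss cs → allOf (splitOK D H hs) ss ≡ true → typesOK D H hs ss cs ≡ true →
                        ∀ v → (∀ {i} → i < order H → v ≢ e i) → Any (Sat (val v v)) cs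
    outer-types-sound hs ss cs ok types v v∉ = types-sound hs ss cs ok types v
      (All.map (λ {s} s-ok → v∉ (<ᵇ-sound (twin s) _ (∧-conicalˡ (twin s <ᵇ order H) _ s-ok))) (allOf-sound ss ok))

-- Equal images would have the same adjacency to the image of a vertex `w` that distinguishes `i`
-- from `j`.
twinFree-apart : ∀ {n} {A : Adjacency n} {H e} → (∀ x y → A x y ≡ A y x) → Realises A H e → twinFree H ≡ true →
                 ∀ {i j} → i < j → j < order H → e i ≢ e j
twinFree-apart {A = A} {H} {e} A-sym r tf {i} {j} i<j j<k eq
  with anyBelow-sound (order H) (allBelow-sound j (allBelow-sound (order H) tf j<k) i<j)
... | w , w<k , d = ==-≢ (∧-conicalʳ (not (w ≡ᵇ j)) _ (∧-conicalʳ (not (w ≡ᵇ i)) _ d))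
  (trans (sym (realises′ A-sym r (<-trans i<j j<k) w<k (≢-sym (≡ᵇ-≢ w i (∧-conicalˡ _ _ d)))))
    (trans (cong (λ x → A x (e w)) eq)
           (realises′ A-sym r j<k w<k (≢-sym (≡ᵇ-≢ w j (∧-conicalˡ _ _ (∧-conicalʳ (not (w ≡ᵇ i)) _ d)))))))

twinFree-injective : ∀ {n} {A : Adjacency n} {H e} → (∀ x y → A x y ≡ A y x) → Realises A H e → twinFree H ≡ true →
                     ∀ {i j} → i < order H → j < order H → e i ≡ e j → i ≡ j
twinFree-injective A-sym r tf {i} {j} i<k j<k eq with <-cmp i j
... | tri< i<j _ _ = contradiction eq (twinFree-apart A-sym r tf i<j j<k)
... | tri≈ _ i≡j _ = i≡j
... | tri> _ _ j<i = contradiction (sym eq) (twinFree-apart A-sym r tf j<i i<k)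

-- Extension of involutions

-- An involution of an induced subgraph extends by the identity as soon as it respects the
-- neighbourhoods of all outer vertices.
module Extension {n} {A : Adjacency n} (A-sym : ∀ x y → A x y ≡ A y x)
  (k : ℕ) (e : ℕ → Fin n) (π : ℕ → ℕ)
  (inj : ∀ {i j} → i < k → j < k → e i ≡ e j → i ≡ j)
  (π< : ∀ {i} → i < k → π i < k) (ππ : ∀ {i} → i < k → π (π i) ≡ i)
  (aut : ∀ {i j} → i < k → j < k → A (e (π i)) (e (π j)) ≡ A (e i) (e j))
  (outer : ∀ v → (∀ {i} → i < k → v ≢ e i) → ∀ {i} → i < k → A v (e (π i)) ≡ A v (e i))
  where

  locate : ∀ v → Dec (∃ λ i → i < k × v ≡ e i)
  locate v = anyUpTo? (λ i → v Fin.≟ e i) k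

  extend : Fin n → Fin n
  extend v with locate v
  ... | yes (i , _) = e (π i)
  ... | no _        = v

  data View : Fin n → Fin n → Set where
    inside  : ∀ {i} → i < k → View (e i) (e (π i))
    outside : ∀ {v} → (∀ {i} → i < k → v ≢ e i) → View v v

  view : ∀ v → View v (extend v)
  view v with locate v
  ... | yes (i , i<k , refl) = inside i<k
  ... | no ∄                 = outside λ i<k v≡ → ∄ (_ , i<k , v≡)

  extend-inside : ∀ {i} → i < k → extend (e i) ≡ e (π i)
  extend-inside {i} i<k with locate (e i)
  ... | yes (j , j<k , eq) = cong (e ∘ π) (sym (inj i<k j<k eq))
  ... | no ∄               = contradiction (i , i<k , refl) ∄

  extend-outside : ∀ {v} → (∀ {i} → i < k → v ≢ e i) → extend v ≡ v
  extend-outside {v} v∉ with locate v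
  ... | yes (i , i<k , v≡) = contradiction v≡ (v∉ i<k)
  ... | no _               = refl

  extend-involutive : ∀ v → extend (extend v) ≡ v
  extend-involutive v with extend v | view v
  ... | _ | inside i<k = trans (extend-inside (π< i<k)) (cong e (ππ i<k))
  ... | _ | outside v∉ = extend-outside v∉

  extend-aut : ∀ x y → A (extend x) (extend y) ≡ A x y
  extend-aut x y with extend x | view x | extend y | view y
  ... | _ | inside i<k | _ | inside j<k = aut i<k j<k
  ... | _ | inside i<k | _ | outside y∉ = trans (A-sym _ _) (trans (outer y y∉ i<k) (A-sym _ _))
  ... | _ | outside x∉ | _ | inside j<k = outer x x∉ j<k
  ... | _ | outside _  | _ | outside _  = refl

  fixed : (∀ x → extend x ≡ x) → ∀ {i} → i < k → π i ≡ i
  fixed fix i<k = inj (π< i<k) i<k (trans (sym (extend-inside i<k)) (fix _))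

rigid-extension : ∀ {Qs n} {A : Adjacency n} → Good Qs A → ∀ k e π →
  (∀ {i j} → i < k → j < k → e i ≡ e j → i ≡ j) →
  (∀ {i} → i < k → π i < k) → (∀ {i} → i < k → π (π i) ≡ i) →
  (∀ {i j} → i < k → j < k → i ≢ j → A (e (π i)) (e (π j)) ≡ A (e i) (e j)) →
  (∀ v → (∀ {i} → i < k → v ≢ e i) → ∀ {i} → i < k → A v (e (π i)) ≡ A v (e i)) →
  ∀ {i} → i < k → π i ≡ i
rigid-extension {A = A} g k e π inj π< ππ aut outer = fixed (rigid g extend extend-involutive extend-aut)
  where
  aut′ : ∀ {i j} → i < k → j < k → A (e (π i)) (e (π j)) ≡ A (e i) (e j)
  aut′ {i} {j} i<k j<k with i ≟ j
  ... | yes refl = diagonal g _ _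
  ... | no i≢j   = aut i<k j<k i≢j
  open Extension (symmetric g) k e π inj π< ππ aut′ outer

if-true : ∀ {b} {x : Bool} → b ≡ true → (if b then x else true) ≡ true → x ≡ true
if-true refl x = x

node-sound : ∀ {Qs n D} → All (Bad Qs n) D → ∀ N → nodeOK D N ≡ true → Bad Qs n (table (rows N))
node-sound {Qs} {n} {D} bs N ok A g e r =
  let i , i<k , moved = anyBelow-sound k ok-moved in
  ≡ᵇ-≢ (π i) i moved (rigid-extension g k e π (twinFree-injective (symmetric g) r ok-tf) π< ππ aut outer i<k)
  where
  H = table (rows N)
  k = order H
  π : ℕ → ℕ
  π = nth 0 (swap N)
  rest₁ = ∧-conicalʳ (allBelow k (λ i → (π i <ᵇ k) ∧ (π (π i) ≡ᵇ i))) _ ok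
  rest₂ = ∧-conicalʳ (allBelow k (λ j → allBelow j λ i → edge′ H (π i) (π j) == edge H i j)) _ rest₁
  rest₃ = ∧-conicalʳ (anyBelow k (λ i → not (π i ≡ᵇ i))) _ rest₂
  rest₄ = ∧-conicalʳ (twinFree H) _ rest₃
  ok-moved = ∧-conicalˡ (anyBelow k (λ i → not (π i ≡ᵇ i))) _ rest₂
  ok-tf = ∧-conicalˡ (twinFree H) _ rest₃
  ok-splits = ∧-conicalˡ (allOf (splitOK D H (hintsᵛ N)) (splits N)) _ rest₄
  ok-types = ∧-conicalʳ (allOf (splitOK D H (hintsᵛ N)) (splits N)) _ rest₄
  ok-perm : ∀ {i} → i < k → ((π i <ᵇ k) ∧ (π (π i) ≡ᵇ i)) ≡ true
  ok-perm = allBelow-sound k (∧-conicalˡ _ _ ok)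
  π< : ∀ {i} → i < k → π i < k
  π< {i} i<k = <ᵇ-sound _ _ (∧-conicalˡ _ _ (ok-perm i<k))
  ππ : ∀ {i} → i < k → π (π i) ≡ i
  ππ {i} i<k = ≡ᵇ-sound _ _ (∧-conicalʳ (π i <ᵇ k) _ (ok-perm i<k))
  π-inj : ∀ {i j} → i < k → j < k → π i ≡ π j → i ≡ j
  π-inj i<k j<k eq = trans (sym (ππ i<k)) (trans (cong π eq) (ππ j<k))
  edge-π : ∀ {i j} → i < j → j < k → edge′ H (π i) (π j) ≡ edge H i j
  edge-π {i} {j} i<j j<k = ==-sound _ _ (allBelow-sound j (allBelow-sound k (∧-conicalˡ _ _ rest₁) j<k) i<j)
  r∘π : Realises A H (e ∘ π)
  r∘π i<j j<k = trans (realises′ (symmetric g) r (π< (<-trans i<j j<k)) (π< j<k) λ eq → <⇒≢ i<j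
      (π-inj (<-trans i<j j<k) j<k eq)) (edge-π i<j j<k)
  aut : ∀ {i j} → i < k → j < k → i ≢ j → A (e (π i)) (e (π j)) ≡ A (e i) (e j)
  aut i<k j<k i≢j = trans (realises′ (symmetric g) r∘π i<k j<k i≢j) (sym (realises′ (symmetric g) r i<k j<k i≢j))
  -- Stated for every realisation, so that it also applies to `e ∘ π`, where `i` and `π i` have
  -- changed places; this gives the converse implication.
  one-sided : ∀ {e} → Realises A H e → ∀ {v} → (∀ {i} → i < k → v ≢ e i) → ∀ {i} → i < k → i < π i →
              A v (e i) ≡ true → A v (e (π i)) ≡ true
  one-sided {e} r {v} v∉ {i} i<k i<πi vi with
    Context.outer-types-sound g H e r bs (hintsᵛ N) (splits N)
        (((vv i , false) ∷ []) ∷ ((vv (π i) , true) ∷ []) ∷ []) ok-splits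
      (if-true (<ᵇ-true i<πi) (allBelow-sound k ok-types i<k)) v v∉
  ... | here (l ∷ [])         = contradiction (trans (sym vi) l) λ ()
  ... | there (here (l ∷ [])) = l
  outer< : ∀ {v} → (∀ {i} → i < k → v ≢ e i) → ∀ {i} → i < k → i < π i → A v (e (π i)) ≡ A v (e i)
  outer< {v} v∉ {i} i<k i<πi with A v (e i) in vi | A v (e (π i)) in vπi
  ... | true  | true  = refl
  ... | false | false = refl
  ... | true  | false = contradiction (trans (sym vπi) (one-sided r v∉ i<k i<πi vi)) λ ()
  ... | false | true  = contradiction (trans (sym vi) (trans (cong (A v ∘ e) (sym (ππ i<k))) (one-sided r∘π
      (λ j<k → v∉ (π< j<k)) i<k i<πi vπi))) λ ()
  outer : ∀ v → (∀ {i} → i < k → v ≢ e i) → ∀ {i} → i < k → A v (e (π i)) ≡ A v (e i)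
  outer v v∉ {i} i<k with <-cmp i (π i)
  ... | tri< i<πi _ _ = outer< v∉ i<k i<πi
  ... | tri≈ _ eq _   = cong (A v ∘ e) (sym eq)
  ... | tri> _ _ πi<i = trans (sym (outer< v∉ (π< i<k) (subst (π i <_) (sym (ππ i<k)) πi<i)))
      (cong (A v ∘ e) (ππ i<k))

nodes-sound : ∀ {Qs n D} → All (Bad Qs n) D → ∀ Ns → nodesOK D Ns ≡ true → All (Bad Qs n) (D ++ map (table ∘ rows) Ns)
nodes-sound {D = D} bs [] _ = All.++⁺ bs []
nodes-sound {Qs} {n} {D} bs (N ∷ Ns) ok = subst (All (Bad Qs n)) (List.++-assoc D _ _)
  (nodes-sound (All.++⁺ bs (node-sound bs N (∧-conicalˡ _ _ ok) ∷ [])) Ns (∧-conicalʳ (nodeOK D N) _ ok))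

-- The excluded graphs and their certificates

-- One graph of each of the nine complementary pairs among the 18 graphs.
base : List Shape
base = map table (
  (0 ∷ 0 ∷ 0 ∷ 1 ∷ 12 ∷ 30 ∷ []) ∷
  (0 ∷ 0 ∷ 0 ∷ 3 ∷ 6 ∷ 28 ∷ []) ∷
  (0 ∷ 0 ∷ 1 ∷ 0 ∷ 10 ∷ 28 ∷ []) ∷
  (0 ∷ 0 ∷ 1 ∷ 2 ∷ 12 ∷ 30 ∷ []) ∷
  (0 ∷ 0 ∷ 0 ∷ 1 ∷ 2 ∷ 8 ∷ 52 ∷ []) ∷
  (0 ∷ 0 ∷ 1 ∷ 0 ∷ 8 ∷ 10 ∷ 52 ∷ []) ∷
  (0 ∷ 0 ∷ 2 ∷ 0 ∷ 9 ∷ 10 ∷ 52 ∷ []) ∷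
  (0 ∷ 0 ∷ 0 ∷ 0 ∷ 10 ∷ 6 ∷ 20 ∷ 105 ∷ []) ∷
  (0 ∷ 0 ∷ 0 ∷ 4 ∷ 0 ∷ 1 ∷ 52 ∷ 58 ∷ []) ∷ [])

-- The nodes and their hints were found by a computer search.
nodes₁ : List Node
nodes₁ =
  node (0 ∷ 0 ∷ 2 ∷ 0 ∷ 8 ∷ 11 ∷ 21 ∷ 74 ∷ 180 ∷ []) (0 ∷ 3 ∷ 4 ∷ 1 ∷ 2 ∷ 5 ∷ 6 ∷ 7 ∷ 8 ∷ [])
  (0x19520302 ∷ 0x30219501 ∷ 0x27509107 ∷ 0x59103200 ∷ 0x4128907 ∷ 0x12598002 ∷ 0x1349507 ∷ 0x31069507 ∷
   0x17593002 ∷ 0x19254004 ∷ 0x21697002 ∷ 0x3217907 ∷ 0x18609207 ∷ 0x69204100 ∷ 0x31062907 ∷ 0x40129601 ∷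
   0x3129507 ∷ 0x37591002 ∷ 0x3219501 ∷ 0x19523002 ∷ 0x96520302 ∷ 0x89524000 ∷ 0x624103908 ∷ 0x51093240a ∷
   0x17289300a ∷ 0x58123490c ∷ 0x62094130a ∷ 0x28179400a ∷ 0x513204908 ∷ 0x51379240c ∷ 0x1357942010 ∷ 0x3157924010 ∷
   [])
  (split 2
    (0x486a2002 ∷ 0x345a8002 ∷ 0x3a452004 ∷ 0x30126a07 ∷ 0x5a014204 ∷ 0x6a402300 ∷ 0x40215a07 ∷ 0x3a540102 ∷
     0x712a603 ∷ 0x1482a07 ∷ 0x7162a540c ∷ 0x531402a08 ∷ 0x17532a00c ∷ 0x157320a0a ∷ 0x640a2310a ∷ 0x62710a30c ∷
     0x1925a004 ∷ 0xa219607 ∷ 0x1952a002 ∷ 0x1259a002 ∷ 0x21a97002 ∷ 0x5a193420c ∷ 0x51a23940a ∷ 0x5a123490c ∷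
     0xa24103908 ∷ []) ∷
   split 1
    (0x486a2002 ∷ 0x345a8002 ∷ 0x421a607 ∷ 0x5a130200 ∷ 0xa6203100 ∷ 0x3a540102 ∷ 0x5a014204 ∷ 0x5a301400 ∷
     0x821a503 ∷ 0x2371a07 ∷ 0x716235a0c ∷ 0x530a1420a ∷ 0x17a32800c ∷ 0x9152a000 ∷ 0x429a607 ∷ 0xa219501 ∷
     0xa129507 ∷ 0x1952a000 ∷ 0x12a98002 ∷ 0x921a503 ∷ 0x593a1240c ∷ 0x51923a40a ∷ 0x513a9240c ∷ []) ∷ []) ∷
  node (0 ∷ 0 ∷ 0 ∷ 1 ∷ 1 ∷ 10 ∷ 18 ∷ 76 ∷ 52 ∷ []) (2 ∷ 1 ∷ 0 ∷ 7 ∷ 8 ∷ 6 ∷ 5 ∷ 3 ∷ 4 ∷ [])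
  (0x39071204 ∷ 0x93701200 ∷ 0x49081204 ∷ 0x94801200 ∷ 0x95810200 ∷ 0x30954104 ∷ 0x40963104 ∷ 0x17049601 ∷
   0x17409607 ∷ 0x18309507 ∷ 0x39507100 ∷ 0x18039501 ∷ 0x94063106 ∷ 0x49607102 ∷ 0x39508102 ∷ 0x95312000 ∷
   0x96412000 ∷ 0x10273907 ∷ 0x18304907 ∷ 0x95136006 ∷ 0x91365002 ∷ 0x35901404 ∷ 0x25403907 ∷ 0x39052104 ∷
   0x64910504 ∷ 0x98325002 ∷ 0x53980204 ∷ 0x59381000 ∷ 0x84950104 ∷ 0x97321000 ∷ 0x51936004 ∷ 0x96145006 ∷
   0x20164907 ∷ 0x10284907 ∷ 0x94602100 ∷ 0x46901304 ∷ 0x48902304 ∷ 0x79325002 ∷ 0x39701404 ∷ 0x1285907 ∷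
   0x12048907 ∷ 0x93502100 ∷ 0x538012908 ∷ 0x49831208 ∷ 0x35097120a ∷ 0x736021908 ∷ 0x37095210a ∷ 0x53198020a ∷
   0x359102608 ∷ 0x406381908 ∷ 0x359806208 ∷ 0x49610230a ∷ 0x357102908 ∷ 0x305471908 ∷ 0x64791050a ∷ 0x614570908 ∷
   0x35790140a ∷ 0x49632108 ∷ 0x895041320e ∷ 0x397152600e ∷ 0x8359402110 ∷ 0x5489301210 ∷ [])
  (split 0
    (0x6a142004 ∷ 0x21046a07 ∷ 0x12037a07 ∷ 0x468a0130a ∷ 0x64a012308 ∷ 0x15a362008 ∷ 0x5a8032410e ∷ 0x3095a104 ∷
     0x39a7104 ∷ 0x30945a10a ∷ 0xa01326908 ∷ []) ∷
   split 3
    (0x12037a07 ∷ 0x20153a07 ∷ 0x64a012308 ∷ 0x21095a07 ∷ 0x3950a100 ∷ 0x3509a120a ∷ []) ∷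
   split 4
    (0x73a021408 ∷ 0x73a021908 ∷ []) ∷
   split 7
    (0x6a142004 ∷ 0x12037a07 ∷ 0x375201a08 ∷ 0x15a362008 ∷ 0x7923a006 ∷ 0x723a9002 ∷ 0x9732a000 ∷ 0x7932a000 ∷
     0x12039a07 ∷ 0x39720a40a ∷ 0x37920a40a ∷ []) ∷
   split 8
    (0x72a38004 ∷ 0x6a418002 ∷ 0x53a012408 ∷ 0x375201a08 ∷ 0x15a362008 ∷ 0x3a542108 ∷ 0x72a39004 ∷ 0x9842a000 ∷
     0x8942a000 ∷ 0x6a419002 ∷ 0x49820a30a ∷ 0x48920a30a ∷ []) ∷
   split 6
    (0x6a142004 ∷ 0x21046a07 ∷ 0x73a021408 ∷ 0x15a362008 ∷ 0x468a0130a ∷ 0x513680a08 ∷ 0x9641a000 ∷ 0x21049a07 ∷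
     0x49610a30a ∷ []) ∷
   split 5
    (0x61a45004 ∷ 0x5a317002 ∷ 0x5a132004 ∷ 0x2158a07 ∷ 0x21035a07 ∷ 0x468a0130a ∷ 0x513680a08 ∷ 0x3a542108 ∷
     0x5a8032410e ∷ 0x5931a000 ∷ 0x20193a07 ∷ 0x35910a40a ∷ []) ∷ []) ∷
  node (0 ∷ 0 ∷ 0 ∷ 0 ∷ 6 ∷ 10 ∷ 12 ∷ 14 ∷ 241 ∷ []) (0 ∷ 1 ∷ 3 ∷ 2 ∷ 5 ∷ 4 ∷ 6 ∷ 7 ∷ 8 ∷ [])
  (0x94120500 ∷ 0x91540300 ∷ 0x5241907 ∷ 0x49210504 ∷ 0x2514907 ∷ 0x79210504 ∷ 0x2517907 ∷ 0x59182004 ∷ 0x95812000 ∷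
   0x42897002 ∷ 0x9415807 ∷ 0x79821000 ∷ 0x49825002 ∷ 0x49821000 ∷ 0x96821000 ∷ 0x79813000 ∷ 0x3417907 ∷
   0x49120604 ∷ 0x1624907 ∷ 0x9514807 ∷ 0x49283004 ∷ 0x49812000 ∷ 0x41895002 ∷ 0x94813000 ∷ 0x48152090a ∷
   0x27419300a ∷ 0x19425030a ∷ 0x518930208 ∷ 0x71243590c ∷ 0x419520308 ∷ 0x37519200a ∷ 0x17425390c ∷ 0x71359460c ∷
   0x5481923010 ∷ 0x4581932010 ∷ [])
  (split 2
    (0x5a382004 ∷ 0x20158a07 ∷ 0xa7120500 ∷ 0x5a310404 ∷ 0x713524a0c ∷ 0x721436a0c ∷ 0x418a20308 ∷ 0x41852a00c ∷
     0x1a534020a ∷ 0x178a5342012 ∷ 0x5a389004 ∷ 0x6a829000 ∷ 0x4982a002 ∷ 0x4289a002 ∷ 0x2649a310c ∷ 0x1a495320c ∷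
     0x14a25930a ∷ 0x1a425390c ∷ []) ∷
   split 4
    (0x518a4002 ∷ 0x5a834002 ∷ 0x5a310404 ∷ 0x7214a650c ∷ 0x51a430208 ∷ 0x41a52700c ∷ 0x4918a006 ∷ 0x418a9002 ∷
     0x9481a000 ∷ 0x5a839002 ∷ 0x4981a000 ∷ 0x195a4230c ∷ 0x14925a30a ∷ 0x145a9230c ∷ 0x51a930208 ∷ []) ∷ []) ∷
  node (0 ∷ 0 ∷ 0 ∷ 0 ∷ 0 ∷ 6 ∷ 10 ∷ 112 ∷ 29 ∷ []) (0 ∷ 1 ∷ 3 ∷ 2 ∷ 4 ∷ 6 ∷ 5 ∷ 7 ∷ 8 ∷ [])
  (0x91650300 ∷ 0x6251907 ∷ 0x59210604 ∷ 0x2615907 ∷ 0x89203500 ∷ 0x29854002 ∷ 0x98210604 ∷ 0x96813002 ∷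
   0x96712400 ∷ 0x25981004 ∷ 0x98260104 ∷ 0x28950104 ∷ 0x98450104 ∷ 0x95781004 ∷ 0x98502102 ∷ 0x19560304 ∷
   0x5361907 ∷ 0x98350104 ∷ 0x29761507 ∷ 0x59712400 ∷ 0x49781004 ∷ 0x95812002 ∷ 0x29853002 ∷ 0x832609108 ∷
   0x28905310a ∷ 0x19526030a ∷ 0x824907108 ∷ 0x29845100c ∷ 0x631895008 ∷ 0x519620308 ∷ 0x38906210a ∷ 0x521896008 ∷
   [])
  (split 5
    (0xa8310504 ∷ 0xa2581006 ∷ 0x16a53204 ∷ 0x36a87004 ∷ 0x36a81004 ∷ 0x1a650204 ∷ 0x6a310504 ∷ 0x3516a07 ∷
     0xa1560200 ∷ 0x61a530208 ∷ 0x16a93204 ∷ 0x2985a002 ∷ 0x2589a002 ∷ 0x298a5100c ∷ 0x258a9100c ∷ 0x61a930208 ∷ []) ∷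
   split 2
    (0xa8310504 ∷ 0x8a302600 ∷ 0xa1560200 ∷ 0x6a310504 ∷ 0x1528a03 ∷ 0x4157a07 ∷ 0x82350a108 ∷ 0x28a35010a ∷
     0x1a635020a ∷ 0x2a805140c ∷ 0x15a26700c ∷ 0x982a0104 ∷ 0x289a0104 ∷ 0x259a1004 ∷ 0x952a803 ∷ 0xa1560900 ∷
     0x9582a100c ∷ 0x2589a100c ∷ []) ∷ []) ∷
  node (0 ∷ 0 ∷ 0 ∷ 0 ∷ 7 ∷ 8 ∷ 33 ∷ 34 ∷ 204 ∷ []) (1 ∷ 0 ∷ 2 ∷ 3 ∷ 4 ∷ 5 ∷ 7 ∷ 6 ∷ 8 ∷ [])
  (0x49021600 ∷ 0x12609401 ∷ 0x29480102 ∷ 0x49013704 ∷ 0x20179407 ∷ 0x4961504 ∷ 0x94051304 ∷ 0x27609807 ∷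
   0x6945104 ∷ 0x95670106 ∷ 0x10289407 ∷ 0x9461202 ∷ 0x10286907 ∷ 0x2178907 ∷ 0x21609401 ∷ 0x49120700 ∷ 0x21069407 ∷
   0x98631000 ∷ 0x68903404 ∷ 0x12069407 ∷ 0x56970104 ∷ 0x86970104 ∷ 0x420819308 ∷ 0x24908130a ∷ 0x29408310c ∷
   0x401927308 ∷ 0x823469108 ∷ 0x410729508 ∷ 0x421809308 ∷ 0x24918030a ∷ 0x29418300c ∷ 0x823479008 ∷ 0x412709508 ∷
   0x96403510c ∷ 0x401627908 ∷ [])
  (split 0
    (0xa4150304 ∷ 0x4a103604 ∷ 0x1a743004 ∷ 0x271a401 ∷ 0x1a472002 ∷ 0x4a012600 ∷ 0xa6501300 ∷ 0x6a051304 ∷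
     0x12068a07 ∷ 0x1287a07 ∷ 0x40162a508 ∷ 0xa416520c ∷ 0x4a16250a ∷ 0x940a1504 ∷ 0x49a1504 ∷ 0x201a9407 ∷
     0x960a5104 ∷ 0x1069a403 ∷ 0x9640a510c ∷ 0x649a510c ∷ 0x1a497500c ∷ []) ∷
   split 6
    (0x12068a07 ∷ 0x57a61004 ∷ 0x65a03404 ∷ 0xa6450102 ∷ 0x8a632000 ∷ 0x1a743004 ∷ 0x271a401 ∷ 0x410726a08 ∷
     0x40261a508 ∷ 0x6054a3108 ∷ 0x12098a07 ∷ 0x946a102 ∷ 0x649a102 ∷ 0x94a6510c ∷ 0x64a9510c ∷ 0x420a19308 ∷ []) ∷ []) ∷
  node (0 ∷ 0 ∷ 0 ∷ 0 ∷ 3 ∷ 5 ∷ 42 ∷ 28 ∷ []) (2 ∷ 3 ∷ 0 ∷ 1 ∷ 7 ∷ 5 ∷ 6 ∷ 4 ∷ [])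
  (0x48017500 ∷ 0x4851204 ∷ 0x80453100 ∷ 0x5842104 ∷ 0x13508607 ∷ 0x78430102 ∷ 0x48701200 ∷ 0x68510202 ∷
   0x20168501 ∷ 0x7163807 ∷ 0x20618507 ∷ 0x1728407 ∷ 0x1278401 ∷ 0x2618507 ∷ 0x78421002 ∷ 0x84510202 ∷ 0x16843004 ∷
   0x26041807 ∷ 0x84102600 ∷ 0x85201700 ∷ 0x81460306 ∷ 0x48103504 ∷ 0x48012604 ∷ 0x20614807 ∷ 0x85420102 ∷
   0x86431002 ∷ 0x26048507 ∷ 0x653017808 ∷ 0x41087620a ∷ 0x638710208 ∷ 0x738620108 ∷ 0x562107808 ∷ 0x728531008 ∷
   0x18406230a ∷ 0x418602308 ∷ 0x408513208 ∷ 0x506423808 ∷ 0x6058143210 ∷ 0x5168042310 ∷ 0x685412030e ∷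
   0x586403120e ∷ 0x30576482114 ∷ 0x21675483014 ∷ [])
  (split 7
    (0x59620100 ∷ 0x69532002 ∷ 0x73946004 ∷ 0x27953004 ∷ 0x17059407 ∷ 0x7169407 ∷ 0x79431002 ∷ 0x79420102 ∷
     0x619432008 ∷ 0x471206908 ∷ 0x417602908 ∷ 0x509423108 ∷ 0x407513908 ∷ 0x526701908 ∷ 0x18059407 ∷ 0x8169407 ∷
     0x89431002 ∷ 0x89420102 ∷ 0x526801908 ∷ 0x418602908 ∷ 0x408513908 ∷ []) ∷
   split 1
    (0x73946004 ∷ 0x509423108 ∷ 0x471206908 ∷ 0x9524310a ∷ 0x84190304 ∷ 0x86491002 ∷ 0x16498002 ∷ 0x14890304 ∷
     0x14980202 ∷ 0x16489300c ∷ 0x9415280c ∷ []) ∷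
   split 0
    (0x27953004 ∷ 0x471206908 ∷ 0x619432008 ∷ 0x19634200a ∷ 0x84091204 ∷ 0x85490102 ∷ 0x4891204 ∷ 0x5498102 ∷
     0x4981202 ∷ 0x5489210c ∷ 0x4915830c ∷ []) ∷
   split 4
    (0x73946004 ∷ 0x471206908 ∷ 0x407513908 ∷ 0x417602908 ∷ 0x17059807 ∷ 0x7169807 ∷ 0x19508403 ∷ 0x48019500 ∷
     0x41089620a ∷ 0x4598120c ∷ 0x4815920a ∷ []) ∷ []) ∷
  node (0 ∷ 0 ∷ 0 ∷ 0 ∷ 1 ∷ 2 ∷ 56 ∷ 60 ∷ []) (1 ∷ 0 ∷ 2 ∷ 3 ∷ 5 ∷ 4 ∷ 6 ∷ 7 ∷ [])
  (0x84506102 ∷ 0x68350104 ∷ 0x78250104 ∷ 0x25046807 ∷ 0x87520100 ∷ 0x86450106 ∷ 0x48703202 ∷ 0x78350104 ∷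
   0x58670204 ∷ 0x25408707 ∷ 0x7368403 ∷ 0x48706200 ∷ 0x6728407 ∷ 0x87421000 ∷ 0x87431000 ∷ 0x8736407 ∷ 0x48760200 ∷
   0x8637407 ∷ 0x84701200 ∷ 0x2157807 ∷ 0x10274807 ∷ 0x64850104 ∷ 0x745021808 ∷ 0x725831008 ∷ 0x37826500c ∷
   0x57826300c ∷ 0x47630280a ∷ 0x645031808 ∷ 0x47638210a ∷ 0x47826310c ∷ 0x468502108 ∷ 0x64385010a ∷ 0x8653042110 ∷
   0x7853402110 ∷ 0x8643152010 ∷ 0x7843512010 ∷ [])
  (split 0
    (0x59713202 ∷ 0x79341004 ∷ 0x21365907 ∷ 0x79241004 ∷ 0x13047907 ∷ 0x13046907 ∷ 0x654130908 ∷ 0x754120908 ∷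
     0x74903610c ∷ 0x407962108 ∷ 0x64903710c ∷ 0x7546932101a ∷ 0x48709202 ∷ 0x40789202 ∷ 0x84906102 ∷ 0x64985010a ∷
     0x64905810a ∷ 0x69485100c ∷ 0x69405180c ∷ []) ∷
   split 4
    (0x12047907 ∷ 0x49061304 ∷ 0x59713202 ∷ 0x65941004 ∷ 0x21365907 ∷ 0x65394100a ∷ 0x569412008 ∷ 0x84709200 ∷
     0x75981004 ∷ 0x9278403 ∷ 0x48709200 ∷ 0x68594010c ∷ 0x68405910a ∷ 0x64805910a ∷ 0x64598010c ∷ 0x945031808 ∷ []) ∷ []) ∷
  node (0 ∷ 0 ∷ 2 ∷ 0 ∷ 0 ∷ 25 ∷ 10 ∷ 84 ∷ []) (0 ∷ 2 ∷ 1 ∷ 4 ∷ 3 ∷ 5 ∷ 7 ∷ 6 ∷ [])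
  (0x1635803 ∷ 0x86130200 ∷ 0x85013204 ∷ 0x4127807 ∷ 0x85310204 ∷ 0x38564002 ∷ 0x85410204 ∷ 0x81652004 ∷
   0x61832504 ∷ 0x48751004 ∷ 0x58304600 ∷ 0x68310204 ∷ 0x3216807 ∷ 0x28170404 ∷ 0x85320104 ∷ 0x36851004 ∷
   0x82731504 ∷ 0x35860104 ∷ 0x86751004 ∷ 0x82157004 ∷ 0x82713400 ∷ 0x85023104 ∷ 0x1472807 ∷ 0x81624300 ∷
   0x85460104 ∷ 0x631578008 ∷ 0x16278300a ∷ 0x83160520c ∷ 0x534807108 ∷ 0x38546100c ∷ 0x87541200c ∷ 0x35806410a ∷
   0x365180208 ∷ 0x742568008 ∷ 0x84270510c ∷ 0x67128400a ∷ 0x67841200c ∷ 0x86532100c ∷ 0x631582008 ∷ 0x716824301e ∷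
   0x627813401e ∷ 0x56173842018 ∷ [])
  (split 1
    (0x72941504 ∷ 0x69713400 ∷ 0x92751004 ∷ 0x91256004 ∷ 0x92701504 ∷ 0x19260304 ∷ 0x742591008 ∷ 0x18269306 ∷
     0x18629300 ∷ 0x631589008 ∷ []) ∷
   split 2
    (0x45970204 ∷ 0x95420104 ∷ 0x72691302 ∷ 0x79420104 ∷ 0x96701504 ∷ 0x95302600 ∷ 0x742591008 ∷ 0x534609108 ∷
     0x530649108 ∷ 0x57264931018 ∷ 0x98751004 ∷ 0x18269304 ∷ 0x95308600 ∷ 0x718624931e ∷ []) ∷
   split 7
    (0x95420104 ∷ 0x92751004 ∷ 0x72941504 ∷ 0x45970204 ∷ 0x69713400 ∷ 0x95302600 ∷ 0x79420104 ∷ 0x534609108 ∷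
     0x742591008 ∷ 0x530649108 ∷ 0x76219300a ∷ 0x57264931018 ∷ 0x82941504 ∷ 0x48579002 ∷ 0x45980204 ∷ 0x47589002 ∷
     0x48759004 ∷ 0x17489203 ∷ 0x89420104 ∷ 0x95083204 ∷ 0x842591008 ∷ 0x48597200c ∷ 0x47598200c ∷ []) ∷
   split 3
    (0x91256004 ∷ 0x19260304 ∷ 0x79420104 ∷ 0x59403700 ∷ 0x2361907 ∷ 0x534609108 ∷ 0x35946010a ∷ 0x45907320a ∷
     0x85390104 ∷ 0x35890104 ∷ 0x36891004 ∷ 0x86539100c ∷ 0x36589100c ∷ 0x631982008 ∷ []) ∷
   split 6
    (0x91256004 ∷ 0x93651006 ∷ 0x69713400 ∷ 0x72941504 ∷ 0x2361907 ∷ 0x19260304 ∷ 0x92701504 ∷ 0x95603102 ∷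
     0x96701504 ∷ 0x10536903 ∷ 0x534609108 ∷ 0x76219300a ∷ 0x38659004 ∷ 0x26389103 ∷ 0x38569002 ∷ 0x36589002 ∷
     0x38596100c ∷ 0x534809108 ∷ 0x36598100c ∷ []) ∷ []) ∷
  node (0 ∷ 0 ∷ 0 ∷ 2 ∷ 4 ∷ 24 ∷ 25 ∷ 102 ∷ []) (0 ∷ 2 ∷ 1 ∷ 4 ∷ 3 ∷ 5 ∷ 6 ∷ 7 ∷ [])
  (0x18370204 ∷ 0x4135807 ∷ 0x1427807 ∷ 0x78120404 ∷ 0x31687002 ∷ 0x38615000 ∷ 0x48561004 ∷ 0x4318607 ∷ 0x4138601 ∷
   0x38614002 ∷ 0x35684002 ∷ 0x78612000 ∷ 0x15608307 ∷ 0x2317807 ∷ 0x68304100 ∷ 0x21063807 ∷ 0x10246807 ∷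
   0x8713607 ∷ 0x78621000 ∷ 0x68730200 ∷ 0x83612000 ∷ 0x38162004 ∷ 0x634102808 ∷ 0x178230408 ∷ 0x17358200a ∷
   0x63458120c ∷ 0x358410208 ∷ 0x27458100a ∷ 0x57314280c ∷ 0x4365812010 ∷ 0x3465821010 ∷ [])
  (split 1
    (0x71693002 ∷ 0x79210304 ∷ 0x29470104 ∷ 0x20136907 ∷ 0x12064907 ∷ 0x97120300 ∷ 0x3271907 ∷ 0x64359210c ∷
     0x643201908 ∷ 0x71632900c ∷ 0x59423010a ∷ 0x654390211e ∷ 0x67439521016 ∷ 0x57694231012 ∷ 0x38619002 ∷
     0x49268004 ∷ 0x31689002 ∷ 0x53914820a ∷ 0x59384210c ∷ 0x59314280c ∷ []) ∷
   split 3
    (0x45693002 ∷ 0x49623002 ∷ 0x20136907 ∷ 0x59430104 ∷ 0x1453907 ∷ 0x29470104 ∷ 0x7139603 ∷ 0x459320108 ∷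
     0x63710920c ∷ 0x49628002 ∷ 0x83619000 ∷ 0x35698002 ∷ 0x38619000 ∷ 0x31987002 ∷ 0x8139603 ∷ 0x58314920a ∷
     0x58493120c ∷ 0x53814920a ∷ 0x53498120c ∷ []) ∷ []) ∷
  node (0 ∷ 0 ∷ 2 ∷ 0 ∷ 8 ∷ 1 ∷ 42 ∷ 52 ∷ []) (0 ∷ 3 ∷ 4 ∷ 1 ∷ 2 ∷ 5 ∷ 6 ∷ 7 ∷ [])
  (0x18260304 ∷ 0x81620300 ∷ 0x85106202 ∷ 0x18620704 ∷ 0x4127807 ∷ 0x6721807 ∷ 0x12867304 ∷ 0x68513000 ∷ 0x7618507 ∷
   0x68154004 ∷ 0x78451004 ∷ 0x68517002 ∷ 0x85207102 ∷ 0x3216807 ∷ 0x28710604 ∷ 0x7612807 ∷ 0x28170404 ∷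
   0x82710400 ∷ 0x87523000 ∷ 0x72851004 ∷ 0x81326402 ∷ 0x68352004 ∷ 0x6728507 ∷ 0x58670100 ∷ 0x725140808 ∷
   0x168320408 ∷ 0x168524008 ∷ 0x278410308 ∷ 0x278513008 ∷ 0x568302408 ∷ 0x615230808 ∷ 0x175826401c ∷ 0x5168720310 ∷
   0x265817301c ∷ 0x586273100e ∷ [])
  (split 1
    (0x65910204 ∷ 0x65391020a ∷ 0x369140208 ∷ 0x19632070a ∷ 0x795120640e ∷ 0x68159004 ∷ 0x61589002 ∷ 0x69158006 ∷
     0x61859004 ∷ 0x68125900a ∷ 0x915230808 ∷ 0x61825900a ∷ []) ∷
   split 2
    (0x93546002 ∷ 0x569104208 ∷ 0x479230108 ∷ 0x219670308 ∷ 0x695210730e ∷ 0x78259004 ∷ 0x75980104 ∷ 0x72589002 ∷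
     0x72859004 ∷ 0x61985200a ∷ 0x925140808 ∷ 0x61925800a ∷ []) ∷ []) ∷
  node (0 ∷ 0 ∷ 0 ∷ 2 ∷ 12 ∷ 9 ∷ 17 ∷ 102 ∷ []) (0 ∷ 2 ∷ 1 ∷ 4 ∷ 3 ∷ 6 ∷ 5 ∷ 7 ∷ [])
  (0x83410200 ∷ 0x58701202 ∷ 0x1427807 ∷ 0x86401200 ∷ 0x78120404 ∷ 0x68041204 ∷ 0x31587002 ∷ 0x78612000 ∷
   0x78154004 ∷ 0x14506807 ∷ 0x78512000 ∷ 0x2317807 ∷ 0x7138503 ∷ 0x1243807 ∷ 0x86304102 ∷ 0x38152004 ∷ 0x8713507 ∷
   0x78621000 ∷ 0x53801604 ∷ 0x35840204 ∷ 0x20135807 ∷ 0x12064807 ∷ 0x50836104 ∷ 0x14058301 ∷ 0x8317507 ∷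
   0x84523002 ∷ 0x83512000 ∷ 0x436120808 ∷ 0x68451208 ∷ 0x35184020a ∷ 0x34185200a ∷ 0x53710820c ∷ 0x43286100a ∷
   0x716320808 ∷ 0x76502480c ∷ 0x58310260a ∷ 0x483061520e ∷ 0x3641850224 ∷ 0x384052610e ∷ 0x3648501210 ∷
   0x4538602110 ∷ 0x4532860124 ∷ [])
  (split 4
    (0x43961004 ∷ 0x46930104 ∷ 0x10246907 ∷ 0x79210304 ∷ 0x69702102 ∷ 0x14509307 ∷ 0x2134907 ∷ 0x345210908 ∷
     0x71532900c ∷ 0x354012908 ∷ 0x59362108 ∷ 0x7351249010 ∷ 0x48269006 ∷ 0x42698002 ∷ 0x83961004 ∷ 0x86930104 ∷
     0x48629000 ∷ 0x59308102 ∷ 0x18509307 ∷ 0x43891004 ∷ 0x725810908 ∷ 0x34825900a ∷ 0x43289100a ∷ []) ∷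
   split 3
    (0x46930104 ∷ 0x34952004 ∷ 0x2134907 ∷ 0x21053907 ∷ 0x14509307 ∷ 0x345210908 ∷ 0x354012908 ∷ 0x7351249010 ∷
     0x48961004 ∷ 0x38519000 ∷ 0x14509807 ∷ 0x19058303 ∷ 0x35189020a ∷ 0x43816900a ∷ 0x34189200a ∷ []) ∷
   split 1
    (0x46930104 ∷ 0x42697002 ∷ 0x71593002 ∷ 0x79210304 ∷ 0x69702102 ∷ 0x2134907 ∷ 0x10246907 ∷ 0x21053907 ∷
     0x46293010a ∷ 0x345210908 ∷ 0x71532900c ∷ 0x59362108 ∷ 0x43965211c ∷ 0x31589002 ∷ 0x916320808 ∷ []) ∷
   split 5
    (0x69704100 ∷ 0x60795102 ∷ 0x21053907 ∷ 0x71593002 ∷ 0x69740100 ∷ 0x71532900c ∷ 0x75601390c ∷ 0x89304102 ∷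
     0x58039106 ∷ 0x50398102 ∷ 0x21083907 ∷ 0x9138503 ∷ 0x58309100 ∷ 0x53910820c ∷ 0x50389610c ∷ []) ∷ []) ∷
  node (0 ∷ 0 ∷ 0 ∷ 2 ∷ 4 ∷ 0 ∷ 38 ∷ 57 ∷ []) (0 ∷ 2 ∷ 1 ∷ 4 ∷ 3 ∷ 5 ∷ 6 ∷ 7 ∷ [])
  (0x18360204 ∷ 0x1426807 ∷ 0x87401200 ∷ 0x68120404 ∷ 0x31876004 ∷ 0x16832704 ∷ 0x86172004 ∷ 0x4318707 ∷ 0x5318707 ∷
   0x38714002 ∷ 0x4138701 ∷ 0x38715002 ∷ 0x5138701 ∷ 0x2316807 ∷ 0x78304100 ∷ 0x3261807 ∷ 0x86210400 ∷ 0x52138607 ∷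
   0x56871004 ∷ 0x37810604 ∷ 0x38172004 ∷ 0x83712000 ∷ 0x78350100 ∷ 0x87360204 ∷ 0x168230408 ∷ 0x47802360a ∷
   0x136782008 ∷ 0x73084120a ∷ 0x37801460a ∷ 0x246781008 ∷ 0x317680208 ∷ [])
  (split 1
    (0x62914304 ∷ 0x49271004 ∷ 0x69125300 ∷ 0x69210304 ∷ 0x29460104 ∷ 0x96120300 ∷ 0x4162907 ∷ 0x269140308 ∷
     0x31789002 ∷ 0x38719002 ∷ 0x49278004 ∷ 0x16982002 ∷ 0x31798600c ∷ 0x38791600c ∷ 0x912304808 ∷ []) ∷
   split 3
    (0x42976004 ∷ 0x96120300 ∷ 0x79403200 ∷ 0x29460104 ∷ 0x5316907 ∷ 0x79305100 ∷ 0x69241030a ∷ 0x93610720c ∷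
     0x83719000 ∷ 0x38719000 ∷ 0x31896004 ∷ 0x8139703 ∷ 0x96120800 ∷ 0x81739600c ∷ 0x31789600c ∷ []) ∷ []) ∷
  node (0 ∷ 0 ∷ 0 ∷ 1 ∷ 10 ∷ 12 ∷ 48 ∷ 71 ∷ []) (0 ∷ 2 ∷ 1 ∷ 3 ∷ 5 ∷ 4 ∷ 6 ∷ 7 ∷ [])
  (0x18740202 ∷ 0x78012300 ∷ 0x38051204 ∷ 0x83501200 ∷ 0x16035807 ∷ 0x14786002 ∷ 0x46385002 ∷ 0x48315002 ∷
   0x58631004 ∷ 0x5418307 ∷ 0x5148301 ∷ 0x21038707 ∷ 0x16308407 ∷ 0x38405100 ∷ 0x21034807 ∷ 0x10253807 ∷ 0x4528307 ∷
   0x8564307 ∷ 0x48361000 ∷ 0x48132004 ∷ 0x345102808 ∷ 0x71082450a ∷ 0x34568120c ∷ 0x34085120a ∷ 0x712405808 ∷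
   0x538460120e ∷ 0x5436812010 ∷ 0x438560210e ∷ 0x4536821010 ∷ [])
  (split 1
    (0x12039707 ∷ 0x25796002 ∷ 0x93402100 ∷ 0x39042104 ∷ 0x29750102 ∷ 0x79021300 ∷ 0x61039401 ∷ 0x20143907 ∷
     0x12035907 ∷ 0x64719320c ∷ 0x354201908 ∷ 0x46351900c ∷ 0x413960208 ∷ 0x72091540a ∷ 0x41389002 ∷ 0x1298707 ∷
     0x48139004 ∷ 0x9148707 ∷ 0x6814901 ∷ 0x81039401 ∷ 0x79108306 ∷ 0x71089302 ∷ 0x34915820a ∷ 0x39485210c ∷
     0x39415280c ∷ 0x912405808 ∷ []) ∷
   split 4
    (0x56394002 ∷ 0x25796002 ∷ 0x9465307 ∷ 0x39450100 ∷ 0x2149707 ∷ 0x64791002 ∷ 0x20143907 ∷ 0x39042104 ∷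
     0x39504200 ∷ 0x93402100 ∷ 0x79021300 ∷ 0x29750102 ∷ 0x64715390c ∷ 0x35094210a ∷ 0x84319000 ∷ 0x2189707 ∷
     0x48319000 ∷ 0x20183907 ∷ 0x39508200 ∷ 0x38594120c ∷ 0x34815920a ∷ 0x34598120c ∷ 0x35098210a ∷ []) ∷ []) ∷
  node (0 ∷ 0 ∷ 1 ∷ 1 ∷ 2 ∷ 2 ∷ 20 ∷ 104 ∷ []) (1 ∷ 0 ∷ 4 ∷ 5 ∷ 2 ∷ 3 ∷ 6 ∷ 7 ∷ [])
  (0x20863404 ∷ 0x80342104 ∷ 0x80632402 ∷ 0x85701204 ∷ 0x68740104 ∷ 0x80253104 ∷ 0x82406102 ∷ 0x86240106 ∷
   0x82056104 ∷ 0x82063406 ∷ 0x83072506 ∷ 0x17203807 ∷ 0x81524004 ∷ 0x28601304 ∷ 0x80231600 ∷ 0x80213404 ∷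
   0x62840104 ∷ 0x73850104 ∷ 0x81435004 ∷ 0x38701204 ∷ 0x80321700 ∷ 0x80312504 ∷ 0x84631004 ∷ 0x624071808 ∷
   0x83427108 ∷ 0x80734210a ∷ 0x80625310a ∷ 0x280163508 ∷ 0x83201740a ∷ 0x260483108 ∷ 0x82305610a ∷ 0x380172408 ∷
   0x370582108 ∷ 0x82463010c ∷ [])
  (split 0
    (0x94216002 ∷ 0x10264903 ∷ 0x94106304 ∷ 0x95107204 ∷ 0x624091308 ∷ 0x735091208 ∷ 0x90731240a ∷ 0x93127408 ∷
     0x39628003 ∷ 0x8239600 ∷ 0x82096104 ∷ 0x82906102 ∷ 0x95187204 ∷ 0x62904810a ∷ 0x260489108 ∷ 0x82309610a ∷
     0x82963010c ∷ []) ∷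
   split 3
    (0x92061300 ∷ 0x91504204 ∷ 0x10264903 ∷ 0x94106304 ∷ 0x9321604 ∷ 0x69425004 ∷ 0x75931004 ∷ 0x94136004 ∷
     0x93740104 ∷ 0x73960404 ∷ 0x624091308 ∷ 0x390472108 ∷ 0x672540908 ∷ 0x92061800 ∷ 0x94186004 ∷ 0x890472108 ∷
     0x624091808 ∷ []) ∷
   split 2
    (0x10264903 ∷ 0x94106304 ∷ 0x12730907 ∷ 0x9231704 ∷ 0x64921004 ∷ 0x95317002 ∷ 0x94216002 ∷ 0x13680907 ∷
     0x80293404 ∷ 0x94816002 ∷ 0x20893404 ∷ 0x64981004 ∷ 0x68492010c ∷ 0x62498010c ∷ []) ∷ []) ∷
  node (0 ∷ 0 ∷ 1 ∷ 1 ∷ 6 ∷ 10 ∷ 36 ∷ 88 ∷ []) (1 ∷ 0 ∷ 4 ∷ 5 ∷ 2 ∷ 3 ∷ 7 ∷ 6 ∷ [])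
  (0x20843104 ∷ 0x80432102 ∷ 0x16308507 ∷ 0x30852104 ∷ 0x16038501 ∷ 0x28406100 ∷ 0x17028401 ∷ 0x83052106 ∷
   0x38506102 ∷ 0x28407102 ∷ 0x8231704 ∷ 0x31420803 ∷ 0x12730807 ∷ 0x16302807 ∷ 0x28601304 ∷ 0x81254002 ∷
   0x53810404 ∷ 0x41825004 ∷ 0x8321604 ∷ 0x13620807 ∷ 0x21530803 ∷ 0x13024803 ∷ 0x38701204 ∷ 0x42810504 ∷
   0x28460100 ∷ 0x65821004 ∷ 0x51834004 ∷ 0x48216002 ∷ 0x84012302 ∷ 0x85013202 ∷ 0x80321700 ∷ 0x421075808 ∷
   0x625071808 ∷ 0x30785210a ∷ 0x24670180a ∷ 0x743160808 ∷ 0x305271808 ∷ 0x42781050a ∷ 0x42761080a ∷ 0x204361808 ∷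
   0x53681040a ∷ 0x24680130a ∷ 0x350172808 ∷ 0x580423162a ∷ 0x281354062a ∷ 0x542318701c ∷ 0x453218601c ∷
   0x5261430824 ∷ 0x130458721c ∷ [])
  (split 3
    (0x24901304 ∷ 0x95134006 ∷ 0x64039207 ∷ 0x35901204 ∷ 0x80392104 ∷ 0x13089503 ∷ 0x85901204 ∷ []) ∷
   split 0
    (0x69721004 ∷ 0x17026907 ∷ 0x35790120a ∷ 0x240163908 ∷ 0x120549631c ∷ 0x20849104 ∷ 0x20834910a ∷ []) ∷
   split 2
    (0x94125006 ∷ 0x64039207 ∷ 0x24901304 ∷ 0x240163908 ∷ 0x35790120a ∷ 0x80293104 ∷ 0x12089403 ∷ 0x19028401 ∷
     0x19208407 ∷ 0x20893104 ∷ 0x28409100 ∷ 0x24089130c ∷ 0x62598010c ∷ []) ∷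
   split 7
    (0x35901204 ∷ 0x74931004 ∷ 0x64039207 ∷ 0x49217000 ∷ 0x59317002 ∷ 0x412570908 ∷ 0x35790120a ∷ 0x4371520924 ∷
     0x84931004 ∷ 0x59318002 ∷ 0x49218000 ∷ 0x4381520924 ∷ []) ∷
   split 5
    (0x94125006 ∷ 0x94128006 ∷ 0x85319000 ∷ 0x58319000 ∷ 0x38510920a ∷ 0x35810920a ∷ []) ∷
   split 4
    (0x24901304 ∷ 0x84219000 ∷ 0x28901304 ∷ 0x48219000 ∷ 0x28410930a ∷ 0x24810930a ∷ []) ∷
   split 6
    (0x69721004 ∷ 0x90231600 ∷ 0x17026907 ∷ 0x240163908 ∷ 0x120549631c ∷ 0x90231800 ∷ []) ∷ []) ∷
  node (0 ∷ 0 ∷ 0 ∷ 0 ∷ 7 ∷ 9 ∷ 10 ∷ 100 ∷ []) (1 ∷ 0 ∷ 2 ∷ 3 ∷ 4 ∷ 6 ∷ 5 ∷ 7 ∷ [])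
  (0x48021500 ∷ 0x12508401 ∷ 0x8452102 ∷ 0x40815604 ∷ 0x80543106 ∷ 0x20168407 ∷ 0x5843104 ∷ 0x10278407 ∷
   0x86730200 ∷ 0x48120600 ∷ 0x53806404 ∷ 0x21058407 ∷ 0x12058407 ∷ 0x85430102 ∷ 0x85470102 ∷ 0x8451202 ∷
   0x10275807 ∷ 0x2167807 ∷ 0x21508401 ∷ 0x410628308 ∷ 0x4825130a ∷ 0x8425310c ∷ 0x402817308 ∷ 0x613485208 ∷
   0x503486208 ∷ 0x14826030a ∷ 0x412608308 ∷ [])
  (split 0
    (0x91643006 ∷ 0x41906504 ∷ 0x2619401 ∷ 0x19462002 ∷ 0x90451306 ∷ 0x71405903 ∷ 0x12057907 ∷ 0x1276907 ∷
     0x49012500 ∷ 0x412907308 ∷ 0x401529308 ∷ 0x19426300c ∷ 0x9534170c ∷ 0x9415320c ∷ 0x4915230a ∷ 0x7542093120 ∷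
     0x4891304 ∷ 0x85093104 ∷ 0x10589403 ∷ 0x20198407 ∷ 0x31804901 ∷ 0x18059405 ∷ 0x5489310c ∷ 0x19486300c ∷ []) ∷
   split 5
    (0x12057907 ∷ 0x36951004 ∷ 0x93651006 ∷ 0x16943004 ∷ 0x2619401 ∷ 0x402519308 ∷ 0x12087907 ∷ 0x93681006 ∷
     0x8459102 ∷ 0x36981004 ∷ 0x5489102 ∷ 0x8495310c ∷ 0x402819308 ∷ 0x5498310c ∷ []) ∷ []) ∷
  node (0 ∷ 0 ∷ 0 ∷ 0 ∷ 4 ∷ 8 ∷ 13 ∷ 114 ∷ []) (0 ∷ 1 ∷ 3 ∷ 2 ∷ 5 ∷ 4 ∷ 6 ∷ 7 ∷ [])
  (0x14062807 ∷ 0x68031504 ∷ 0x10536807 ∷ 0x2718607 ∷ 0x2178601 ∷ 0x24687002 ∷ 0x48270104 ∷ 0x84720100 ∷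
   0x68705102 ∷ 0x68703100 ∷ 0x15608707 ∷ 0x2358607 ∷ 0x78652002 ∷ 0x68720100 ∷ 0x68704102 ∷ 0x68702100 ∷
   0x14608707 ∷ 0x86301500 ∷ 0x74682002 ∷ 0x3248607 ∷ 0x3428601 ∷ 0x28643002 ∷ 0x78641000 ∷ 0x745213808 ∷
   0x623805108 ∷ 0x75631800c ∷ 0x62740810c ∷ 0x62083450a ∷ 0x63750810c ∷ 0x745813008 ∷ 0x603825108 ∷ 0x74621800c ∷
   0x68243150a ∷ 0x623405808 ∷ 0x8620531410 ∷ 0x6573280110 ∷ 0x8630421510 ∷ 0x6472380110 ∷ [])
  (split 4
    (0x96201400 ∷ 0x69021404 ∷ 0x59370104 ∷ 0x10426907 ∷ 0x15063907 ∷ 0x97410200 ∷ 0x632504908 ∷ 0x74625900c ∷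
     0x602934108 ∷ 0x754912008 ∷ 0x74621930c ∷ 0x6795432122 ∷ 0x6472093110 ∷ 0x28649002 ∷ 0x24689002 ∷ 0x96201800 ∷
     0x69283540c ∷ 0x62983450a ∷ 0x62943850a ∷ 0x945213808 ∷ []) ∷
   split 2
    (0x35697002 ∷ 0x69230400 ∷ 0x69302500 ∷ 0x10426907 ∷ 0x69021404 ∷ 0x7429603 ∷ 0x96201400 ∷ 0x15063907 ∷
     0x62743910c ∷ 0x63092540a ∷ 0x7693254022 ∷ 0x627934100e ∷ 0x82649000 ∷ 0x28649000 ∷ 0x9428601 ∷ 0x9248607 ∷
     0x49068203 ∷ 0x10486907 ∷ 0x68243950a ∷ 0x62843950a ∷ 0x68392450c ∷ 0x923405808 ∷ []) ∷ []) ∷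
  node (0 ∷ 0 ∷ 0 ∷ 0 ∷ 9 ∷ 10 ∷ 52 ∷ []) (1 ∷ 0 ∷ 2 ∷ 3 ∷ 5 ∷ 4 ∷ 6 ∷ [])
  (0x74302500 ∷ 0x73450106 ∷ 0x25043707 ∷ 0x47032504 ∷ 0x74503102 ∷ 0x76520100 ∷ 0x6537403 ∷ 0x57360204 ∷
   0x25407607 ∷ 0x47603200 ∷ 0x76421000 ∷ 0x7653407 ∷ 0x47630200 ∷ 0x7356407 ∷ 0x47061204 ∷ 0x74601200 ∷
   0x34750104 ∷ 0x645021708 ∷ 0x65432170a ∷ 0x37405210a ∷ 0x64537010c ∷ 0x437502108 ∷ 0x567432010e ∷ 0x5463701210 ∷
   0x4563710210 ∷ 0x467532100e ∷ [])
  (split 0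
    (0x83541006 ∷ 0x85413002 ∷ 0x58132404 ∷ 0x12046807 ∷ 0x1265807 ∷ 0x65438100c ∷ 0x654120808 ∷ 0x64532080a ∷
     0x43650820c ∷ 0x406832108 ∷ 0x635482101e ∷ 0x835461022a ∷ 0x6548321030 ∷ 0x40678202 ∷ 0x74803102 ∷ 0x58167204 ∷
     0x34805710a ∷ 0x38475100c ∷ 0x68405170c ∷ []) ∷
   split 4
    (0x12046807 ∷ 0x1265807 ∷ 0x20534807 ∷ 0x65841004 ∷ 0x35486002 ∷ 0x83541006 ∷ 0x68452000 ∷ 0x85413002 ∷
     0x538412008 ∷ 0x74608200 ∷ 0x85713002 ∷ 0x35871004 ∷ 0x47608200 ∷ 0x37405810a ∷ 0x37584010c ∷ 0x34705810a ∷
     0x34587010c ∷ 0x538712008 ∷ []) ∷ []) ∷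
  node (0 ∷ 0 ∷ 0 ∷ 4 ∷ 0 ∷ 21 ∷ 26 ∷ []) (1 ∷ 0 ∷ 3 ∷ 2 ∷ 4 ∷ 6 ∷ 5 ∷ [])
  (0x37260104 ∷ 0x73620100 ∷ 0x76301504 ∷ 0x75062104 ∷ 0x67430204 ∷ 0x40237507 ∷ 0x57204300 ∷ 0x74560106 ∷
   0x75210604 ∷ 0x76153004 ∷ 0x41327607 ∷ 0x25730604 ∷ 0x75260104 ∷ 0x46751004 ∷ 0x75201300 ∷ 0x1236707 ∷
   0x45760304 ∷ 0x45760104 ∷ 0x2163707 ∷ 0x57021304 ∷ 0x10325707 ∷ 0x540627108 ∷ 0x643712008 ∷ 0x367421034 ∷
   0x72630510c ∷ 0x235670108 ∷ 0x641537008 ∷ 0x275431034 ∷ 0x47615030c ∷ 0x257034134 ∷ 0x73521600c ∷ 0x2563470120 ∷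
   0x6543720128 ∷ 0x5642731028 ∷ [])
  (split 5
    (0x13052807 ∷ 0x23856004 ∷ 0x36821504 ∷ 0x28351004 ∷ 0x68314200 ∷ 0x84651006 ∷ 0x86514002 ∷ 0x86351004 ∷
     0x326581008 ∷ 0x13072807 ∷ 0x75208300 ∷ 0x84671006 ∷ 0x57208300 ∷ 0x23876004 ∷ 0x47685010c ∷ 0x47506810a ∷
     0x45687010c ∷ 0x45706810a ∷ 0x326781008 ∷ []) ∷
   split 0
    (0x82531000 ∷ 0x28351004 ∷ 0x68314200 ∷ 0x86310200 ∷ 0x68130204 ∷ 0x13052807 ∷ 0x368124034 ∷ 0x48506120c ∷
     0x3652481020 ∷ 0x68137204 ∷ 0x48567002 ∷ 0x75082104 ∷ 0x12705801 ∷ 0x70328501 ∷ 0x48576100c ∷ []) ∷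
   split 3
    (0x36821504 ∷ 0x86351004 ∷ 0x86310200 ∷ 0x326581008 ∷ 0x542803108 ∷ 0x502843108 ∷ 0x368124034 ∷ 0x27538002 ∷
     0x18327607 ∷ 0x23578002 ∷ 0x27358004 ∷ 0x13278603 ∷ 0x23758004 ∷ 0x27583600c ∷ 0x726581008 ∷ 0x23587600c ∷
     0x235870108 ∷ []) ∷
   split 2
    (0x36821504 ∷ 0x84651006 ∷ 0x86514002 ∷ 0x86310200 ∷ 0x13052807 ∷ 0x326581008 ∷ 0x27358006 ∷ 0x23587002 ∷
     0x72538000 ∷ 0x27538000 ∷ 0x78351004 ∷ 0x73528600c ∷ 0x23578600c ∷ []) ∷ []) ∷
  node (0 ∷ 1 ∷ 0 ∷ 4 ∷ 4 ∷ 8 ∷ 50 ∷ []) (0 ∷ 1 ∷ 3 ∷ 2 ∷ 5 ∷ 4 ∷ 6 ∷ [])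
  (0x71026304 ∷ 0x71602500 ∷ 0x76150306 ∷ 0x72403104 ∷ 0x72413004 ∷ 0x42763104 ∷ 0x67512004 ∷ 0x54107607 ∷
   0x73205104 ∷ 0x71406202 ∷ 0x76140206 ∷ 0x17062504 ∷ 0x61750304 ∷ 0x71630204 ∷ 0x73215004 ∷ 0x64712004 ∷
   0x67413004 ∷ 0x641250708 ∷ 0x273045108 ∷ 0x72530410a ∷ 0x273145008 ∷ 0x72531400a ∷ 0x73420510a ∷ 0x641752034 ∷
   0x462173008 ∷ 0x462571302c ∷ [])
  (split 4
    (0x48625102 ∷ 0x53862104 ∷ 0x61840204 ∷ 0x82314004 ∷ 0x86412006 ∷ 0x84126002 ∷ 0x2461803 ∷ 0x82304104 ∷
     0x45108607 ∷ 0x20164803 ∷ 0x83502104 ∷ 0x20561807 ∷ 0x651340808 ∷ 0x61584020a ∷ 0x563481202c ∷ 0x67418004 ∷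
     0x72684102 ∷ 0x64718004 ∷ 0x61870204 ∷ 0x64178002 ∷ 0x42783004 ∷ 0x2761803 ∷ 0x64721800a ∷ 0x841250708 ∷
     0x840251708 ∷ []) ∷
   split 3
    (0x82634102 ∷ 0x53862104 ∷ 0x83512004 ∷ 0x83502104 ∷ 0x81603400 ∷ 0x81036204 ∷ 0x641280308 ∷ 0x563182008 ∷
     0x651340808 ∷ 0x382154008 ∷ 0x382054108 ∷ 0x82674102 ∷ 0x57368104 ∷ 0x87512004 ∷ 0x87502104 ∷ 0x81607400 ∷
     0x81076204 ∷ 0x567138008 ∷ 0x641280708 ∷ 0x782154008 ∷ 0x782054108 ∷ []) ∷
   split 2
    (0x48625102 ∷ 0x53862104 ∷ 0x83512004 ∷ 0x84126002 ∷ 0x82314004 ∷ 0x83502104 ∷ 0x81603400 ∷ 0x81036204 ∷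
     0x20164803 ∷ 0x82304104 ∷ 0x20561807 ∷ 0x563182008 ∷ 0x641280308 ∷ 0x47628102 ∷ 0x83762104 ∷ 0x42768104 ∷
     0x42678102 ∷ 0x462178008 ∷ 0x64821700a ∷ []) ∷ []) ∷
  node (0 ∷ 0 ∷ 0 ∷ 0 ∷ 7 ∷ 10 ∷ 44 ∷ []) (0 ∷ 2 ∷ 1 ∷ 3 ∷ 4 ∷ 6 ∷ 5 ∷ [])
  (0x56312704 ∷ 0x53167402 ∷ 0x74130604 ∷ 0x47102500 ∷ 0x20517401 ∷ 0x1267407 ∷ 0x15746004 ∷ 0x17450202 ∷
   0x63752000 ∷ 0x15743004 ∷ 0x23715607 ∷ 0x56372004 ∷ 0x53761000 ∷ 0x1265707 ∷ 0x13726507 ∷ 0x2517401 ∷ 0x2157407 ∷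
   0x53671200 ∷ 0x65327404 ∷ [])
  (split 5
    (0x18452002 ∷ 0x26845004 ∷ 0x53618404 ∷ 0x63582100 ∷ 0x56318404 ∷ 0x26843004 ∷ 0x2156807 ∷ 0x65381004 ∷
     0x10628401 ∷ 0x28460102 ∷ 0x56831000 ∷ 0x87461002 ∷ 0x17458002 ∷ 0x63752800 ∷ 0x53187402 ∷ 0x15748004 ∷
     0x28715607 ∷ 0x15478002 ∷ 0x63572800 ∷ 0x2176807 ∷ []) ∷
   split 6
    (0x26845004 ∷ 0x84230504 ∷ 0x53618404 ∷ 0x63582100 ∷ 0x56318404 ∷ 0x85461002 ∷ 0x48120500 ∷ 0x65321804 ∷
     0x35681004 ∷ 0x2156807 ∷ 0x65381004 ∷ 0x10628401 ∷ 0x28460102 ∷ 0x14825030a ∷ 0x410528308 ∷ 0x24870304 ∷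
     0x27648004 ∷ 0x27468002 ∷ 0x85471002 ∷ 0x53761800 ∷ 0x87432002 ∷ 0x26478002 ∷ 0x53671800 ∷ 0x2157807 ∷
     0x10278407 ∷ []) ∷
   split 1
    (0x63582100 ∷ 0x26845004 ∷ 0x48120500 ∷ 0x65321804 ∷ 0x28460102 ∷ 0x10628401 ∷ 0x48201600 ∷ 0x30415803 ∷
     0x1365801 ∷ 0x3514803 ∷ 0x2156807 ∷ 0x74180304 ∷ 0x14780304 ∷ 0x15487002 ∷ 0x63582700 ∷ 0x8517401 ∷ 0x8157407 ∷
     0x75481002 ∷ 0x30714801 ∷ 0x7158405 ∷ 0x65327804 ∷ []) ∷ []) ∷
  node (0 ∷ 0 ∷ 0 ∷ 3 ∷ 5 ∷ 18 ∷ 44 ∷ []) (0 ∷ 2 ∷ 1 ∷ 4 ∷ 3 ∷ 6 ∷ 5 ∷ [])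
  (0x37016400 ∷ 0x7651307 ∷ 0x15376002 ∷ 0x56472002 ∷ 0x37610200 ∷ 0x20157401 ∷ 0x20517407 ∷ 0x57410202 ∷
   0x71352000 ∷ 0x1267301 ∷ 0x7156307 ∷ 0x3741204 ∷ 0x37012504 ∷ 0x20513707 ∷ 0x12403703 ∷ 0x25031707 ∷ 0x74201600 ∷
   0x47502100 ∷ 0x47520100 ∷ 0x25037407 ∷ 0x145307236 ∷ 0x31650720c ∷ 0x316507234 ∷ 0x425607134 ∷ 0x340157236 ∷
   0x236407136 ∷ 0x653127034 ∷ 0x5460371226 ∷ [])
  (split 1
    (0x8562407 ∷ 0x65381002 ∷ 0x68321002 ∷ 0x68320102 ∷ 0x21304803 ∷ 0x42560810c ∷ 0x6350482126 ∷ 0x71358000 ∷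
     0x17538006 ∷ 0x17358000 ∷ 0x68327002 ∷ 0x31078402 ∷ 0x430872136 ∷ 0x340187236 ∷ 0x3814720a ∷ 0x8314270c ∷ []) ∷
   split 5
    (0x68321002 ∷ 0x65381002 ∷ 0x68320102 ∷ 0x48025300 ∷ 0x83102500 ∷ 0x16408507 ∷ 0x42560810c ∷ 0x6350482126 ∷
     0x67381002 ∷ 0x83102700 ∷ 0x18047503 ∷ 0x48027300 ∷ 0x185307236 ∷ []) ∷
   split 3
    (0x21304803 ∷ 0x83102500 ∷ 0x4832104 ∷ 0x8562407 ∷ 0x65381002 ∷ 0x430268136 ∷ 0x4872104 ∷ 0x18407303 ∷
     0x65781002 ∷ 0x3487120c ∷ []) ∷
   split 6
    (0x8562407 ∷ 0x16042807 ∷ 0x38601200 ∷ 0x4832104 ∷ 0x68320102 ∷ 0x430268136 ∷ 0x564218034 ∷ 0x36150280a ∷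
     0x562143802e ∷ 0x6350482126 ∷ 0x67238006 ∷ 0x62387002 ∷ 0x17042807 ∷ 0x38701200 ∷ 0x78320102 ∷ 0x574218034 ∷
     0x430278136 ∷ []) ∷
   split 4
    (0x68320102 ∷ 0x48025300 ∷ 0x4832104 ∷ 0x16042807 ∷ 0x26485002 ∷ 0x18532004 ∷ 0x2518407 ∷ 0x42560810c ∷
     0x36150280a ∷ 0x6350482126 ∷ 0x562143802e ∷ 0x7438104 ∷ 0x42087302 ∷ 0x4738104 ∷ 0x7423810a ∷ 0x4723810a ∷ []) ∷ []) ∷
  node (0 ∷ 1 ∷ 0 ∷ 4 ∷ 0 ∷ 21 ∷ 26 ∷ []) (2 ∷ 3 ∷ 0 ∷ 1 ∷ 4 ∷ 5 ∷ 6 ∷ [])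
  (0x1756204 ∷ 0x57042100 ∷ 0x76031502 ∷ 0x5712604 ∷ 0x43107607 ∷ 0x50721304 ∷ 0x13250703 ∷ 0x76130206 ∷
   0x24107501 ∷ 0x7514202 ∷ 0x70156206 ∷ 0x70215302 ∷ 0x75021306 ∷ 0x75120602 ∷ 0x76142000 ∷ 0x42017507 ∷
   0x16703504 ∷ 0x24017507 ∷ 0x61730204 ∷ 0x613042708 ∷ 0x47065313c ∷ 0x50472130a ∷ 0x47156203c ∷ 0x540712338 ∷
   0x502143708 ∷ 0x350627411c ∷ 0x261537401c ∷ [])
  (split 0
    (0x86312006 ∷ 0x8512402 ∷ 0x23856004 ∷ 0x58403104 ∷ 0x52803104 ∷ 0x82035102 ∷ 0x85203106 ∷ 0x58024100 ∷
     0x24016807 ∷ 0x654108236 ∷ 0x520843134 ∷ 0x71086204 ∷ 0x20178503 ∷ 0x18250703 ∷ 0x7518200 ∷ 0x1786204 ∷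
     0x57280130c ∷ 0x50712830a ∷ 0x802143708 ∷ []) ∷
   split 1
    (0x82035102 ∷ 0x85203106 ∷ 0x8512402 ∷ 0x23856004 ∷ 0x68134000 ∷ 0x564018336 ∷ 0x542830138 ∷ 0x520341808 ∷
     0x631842034 ∷ 0x35710801 ∷ 0x71258001 ∷ 0x76180206 ∷ 0x31078603 ∷ 0x7518202 ∷ 0x1578202 ∷ 0x1758204 ∷
     0x58072310c ∷ 0x50812730a ∷ 0x813042708 ∷ []) ∷ []) ∷
  node (0 ∷ 0 ∷ 0 ∷ 2 ∷ 4 ∷ 6 ∷ 57 ∷ []) (0 ∷ 2 ∷ 1 ∷ 4 ∷ 3 ∷ 5 ∷ 6 ∷ [])
  (0x17350204 ∷ 0x1425707 ∷ 0x76401200 ∷ 0x57120404 ∷ 0x31675002 ∷ 0x51673002 ∷ 0x57612000 ∷ 0x4317607 ∷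
   0x37614002 ∷ 0x4137601 ∷ 0x2315707 ∷ 0x67304100 ∷ 0x3251707 ∷ 0x75210400 ∷ 0x57623002 ∷ 0x57621000 ∷ 0x7513607 ∷
   0x73612000 ∷ 0x67530200 ∷ 0x157230408 ∷ 0x46572013c ∷ 0x516327034 ∷ 0x63074120a ∷ 0x36571023c ∷ 0x526417034 ∷
   0x635107234 ∷ [])
  (split 1
    (0x42685002 ∷ 0x58210304 ∷ 0x28450104 ∷ 0x85120300 ∷ 0x4152807 ∷ 0x258140308 ∷ 0x821504334 ∷ 0x37618002 ∷
     0x31678002 ∷ 0x57132840a ∷ 0x51732840a ∷ 0x683702134 ∷ 0x638107234 ∷ []) ∷
   split 3
    (0x42685002 ∷ 0x85120300 ∷ 0x68032104 ∷ 0x68403200 ∷ 0x5138603 ∷ 0x643802134 ∷ 0x64083210a ∷ 0x63510820c ∷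
     0x5621438032 ∷ 0x37618000 ∷ 0x85120700 ∷ 0x31875002 ∷ 0x647802134 ∷ 0x51832740a ∷ 0x834102708 ∷ []) ∷ []) ∷
  node (0 ∷ 0 ∷ 0 ∷ 3 ∷ 5 ∷ 6 ∷ 56 ∷ []) (2 ∷ 1 ∷ 0 ∷ 5 ∷ 4 ∷ 3 ∷ 6 ∷ [])
  (0x16407303 ∷ 0x70341206 ∷ 0x27136507 ∷ 0x73501202 ∷ 0x1567303 ∷ 0x70143502 ∷ 0x27630407 ∷ 0x2657405 ∷
   0x71350206 ∷ 0x71053402 ∷ 0x31705404 ∷ 0x7651307 ∷ 0x10647305 ∷ 0x74320102 ∷ 0x7156307 ∷ 0x30714504 ∷
   0x70432106 ∷ 0x2513703 ∷ 0x43672134 ∷ 0x3467120c ∷ 0x63517020c ∷ 0x361054740 ∷ [])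
  (split 0
    (0x25841004 ∷ 0x1658305 ∷ 0x18640307 ∷ 0x81532006 ∷ 0x82541006 ∷ 0x21304803 ∷ 0x12403803 ∷ 0x16048305 ∷
     0x64308210c ∷ 0x254681034 ∷ 0x63408120c ∷ 0x73081204 ∷ 0x74380102 ∷ 0x3781204 ∷ 0x4387102 ∷ 0x73801202 ∷
     0x4782104 ∷ 0x3871202 ∷ 0x4378210c ∷ 0x18375200c ∷ 0x3478120c ∷ 0x18305270c ∷ []) ∷
   split 3
    (0x21304803 ∷ 0x82054302 ∷ 0x1658305 ∷ 0x18640307 ∷ 0x25841004 ∷ 0x15832004 ∷ 0x81532006 ∷ 0x63514080c ∷
     0x21704803 ∷ 0x18403703 ∷ 0x81572006 ∷ 0x18407303 ∷ 0x37018400 ∷ 0x15872004 ∷ 0x7483120c ∷ 0x3487120c ∷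
     0x3714820a ∷ []) ∷ []) ∷
  node (0 ∷ 0 ∷ 2 ∷ 0 ∷ 1 ∷ 26 ∷ 28 ∷ []) (0 ∷ 2 ∷ 1 ∷ 3 ∷ 4 ∷ 6 ∷ 5 ∷ [])
  (0x74105202 ∷ 0x3126707 ∷ 0x17520604 ∷ 0x5621707 ∷ 0x57413000 ∷ 0x51742004 ∷ 0x76431000 ∷ 0x3215707 ∷ 0x57310204 ∷
   0x47506100 ∷ 0x71520300 ∷ 0x1362707 ∷ 0x53476002 ∷ 0x54710204 ∷ 0x5627407 ∷ 0x624130708 ∷ 0x125637038 ∷
   0x67321403e ∷ 0x672410340 ∷ 0x51374200a ∷ 0x514732034 ∷ 0x642031708 ∷ 0x571420340 ∷ 0x456307234 ∷ [])
  (split 2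
    (0x81425002 ∷ 0x64820104 ∷ 0x62841004 ∷ 0x48605200 ∷ 0x2154803 ∷ 0x84206102 ∷ 0x28610504 ∷ 0x624831034 ∷
     0x531824038 ∷ 0x514230808 ∷ 0x534801238 ∷ 0x541032808 ∷ 0x58312403e ∷ 0x81742004 ∷ 0x67428002 ∷ 0x67841004 ∷
     0x67248004 ∷ 0x64870104 ∷ 0x62478002 ∷ 0x7154803 ∷ 0x84706102 ∷ 0x145782036 ∷ 0x157428008 ∷ 0x824130708 ∷ []) ∷
   split 1
    (0x62841004 ∷ 0x81425002 ∷ 0x28610504 ∷ 0x2351807 ∷ 0x18250304 ∷ 0x514230808 ∷ 0x21486503a ∷ 0x531824038 ∷
     0x54381020a ∷ 0x465308134 ∷ 0x216538038 ∷ 0x62847004 ∷ 0x57418002 ∷ 0x82741004 ∷ 0x51478002 ∷ 0x51748004 ∷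
     0x814230708 ∷ 0x51724800a ∷ []) ∷
   split 5
    (0x63485002 ∷ 0x68423000 ∷ 0x48560100 ∷ 0x62841004 ∷ 0x2351807 ∷ 0x48605200 ∷ 0x86420106 ∷ 0x465308134 ∷
     0x514230808 ∷ 0x541032808 ∷ 0x75148006 ∷ 0x71485002 ∷ 0x57148006 ∷ 0x51487002 ∷ 0x78431000 ∷ 0x57418000 ∷
     0x51782004 ∷ 0x7158403 ∷ 0x2371807 ∷ 0x514782034 ∷ 0x714230808 ∷ 0x741032808 ∷ []) ∷ []) ∷
  node (0 ∷ 0 ∷ 2 ∷ 6 ∷ 9 ∷ 21 ∷ 3 ∷ []) (0 ∷ 1 ∷ 3 ∷ 2 ∷ 5 ∷ 4 ∷ 6 ∷ [])
  (0x32147004 ∷ 0x50247102 ∷ 0x35071203 ∷ 0x36072103 ∷ 0x76015306 ∷ 0x54203702 ∷ 0x32417002 ∷ 0x27153006 ∷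
   0x57024106 ∷ 0x42160703 ∷ 0x54027104 ∷ 0x37241006 ∷ 0x31427002 ∷ 0x37142006 ∷ 0x24061703 ∷ 0x71036502 ∷
   0x76103506 ∷ 0x73250403 ∷ 0x47035106 ∷ [])
  (split 3
    (0x31248004 ∷ 0x23518002 ∷ 0x23158004 ∷ 0x40836204 ∷ 0x82340503 ∷ 0x24081303 ∷ 0x84302606 ∷ 0x53160803 ∷
     0x50428104 ∷ 0x71248004 ∷ 0x27518002 ∷ 0x27158004 ∷ 0x84702606 ∷ 0x57160803 ∷ 0x40876204 ∷ 0x18047303 ∷
     0x58203702 ∷ []) ∷
   split 5
    (0x50428104 ∷ 0x42180503 ∷ 0x45302802 ∷ 0x50426804 ∷ 0x28351006 ∷ 0x45038104 ∷ 0x54802606 ∷ 0x35061803 ∷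
     0x31248004 ∷ 0x70428104 ∷ 0x42180703 ∷ 0x28371006 ∷ 0x47038104 ∷ 0x74802606 ∷ 0x37061803 ∷ 0x70426804 ∷
     0x47302802 ∷ []) ∷ []) ∷
  node (0 ∷ 0 ∷ 0 ∷ 4 ∷ 4 ∷ 9 ∷ 50 ∷ []) (1 ∷ 0 ∷ 2 ∷ 4 ∷ 3 ∷ 6 ∷ 5 ∷ [])
  (0x27340604 ∷ 0x47260104 ∷ 0x3642707 ∷ 0x14507607 ∷ 0x14057601 ∷ 0x57604102 ∷ 0x57306200 ∷ 0x3617507 ∷ 0x3167501 ∷
   0x67513002 ∷ 0x32754004 ∷ 0x35720404 ∷ 0x57630100 ∷ 0x67140204 ∷ 0x57031204 ∷ 0x10235707 ∷ 0x2164707 ∷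
   0x72543002 ∷ 0x3647507 ∷ 0x654012708 ∷ 0x247630108 ∷ 0x726403134 ∷ 0x45623703e ∷ 0x47236010a ∷ 0x647210308 ∷
   0x365247136 ∷ 0x36524713e ∷ 0x536702134 ∷ 0x537201408 ∷ 0x725314034 ∷ 0x645712034 ∷ [])
  (split 0
    (0x68152004 ∷ 0x64852004 ∷ 0x86410200 ∷ 0x21056807 ∷ 0x38245100a ∷ 0x238541008 ∷ 0x563102808 ∷ 0x830452140 ∷
     0x506813238 ∷ 0x58032613e ∷ []) ∷
   split 5
    (0x86410200 ∷ 0x12053807 ∷ 0x64852004 ∷ 0x6328507 ∷ 0x68541000 ∷ 0x563102808 ∷ 0x536201808 ∷ 0x12073807 ∷
     0x18507607 ∷ 0x18057601 ∷ 0x75608100 ∷ 0x57308200 ∷ 0x37502840a ∷ 0x53078210a ∷ 0x736201808 ∷ 0x35702840a ∷ []) ∷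
   split 3
    (0x21056807 ∷ 0x86410200 ∷ 0x456238036 ∷ 0x73258006 ∷ 0x72583002 ∷ 0x37258006 ∷ 0x32587002 ∷ 0x37528000 ∷
     0x32578400c ∷ []) ∷
   split 6
    (0x28431504 ∷ 0x6328507 ∷ 0x38526002 ∷ 0x64852004 ∷ 0x65840204 ∷ 0x1246807 ∷ 0x563102808 ∷ 0x238541008 ∷
     0x536201808 ∷ 0x456238036 ∷ 0x830452140 ∷ 0x58032613e ∷ 0x67158006 ∷ 0x38527002 ∷ 0x76518000 ∷ 0x8167501 ∷
     0x8617507 ∷ 0x67518000 ∷ 0x745682034 ∷ 0x537201808 ∷ 0x645782034 ∷ []) ∷ []) ∷
  node (0 ∷ 0 ∷ 2 ∷ 2 ∷ 4 ∷ 8 ∷ 49 ∷ []) (0 ∷ 1 ∷ 3 ∷ 2 ∷ 5 ∷ 4 ∷ 6 ∷ [])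
  (0x17230504 ∷ 0x2531707 ∷ 0x27410304 ∷ 0x42761004 ∷ 0x76520104 ∷ 0x21743604 ∷ 0x71263004 ∷ 0x47625002 ∷
   0x67405200 ∷ 0x4312707 ∷ 0x71320500 ∷ 0x46720104 ∷ 0x76430104 ∷ 0x71432602 ∷ 0x47263004 ∷ 0x74261006 ∷
   0x71362004 ∷ 0x76410304 ∷ 0x241673008 ∷ 0x217340508 ∷ 0x271534048 ∷ 0x46702510a ∷ 0x17243050a ∷ 0x426170308 ∷
   0x472316038 ∷ [])
  (split 4
    (0x81230400 ∷ 0x18320404 ∷ 0x68504300 ∷ 0x38510204 ∷ 0x3421807 ∷ 0x18352040a ∷ 0x56803410a ∷ 0x815432040 ∷
     0x76480104 ∷ 0x46780104 ∷ 0x42781004 ∷ 0x81230700 ∷ 0x72648100c ∷ 0x42678100c ∷ 0x241873008 ∷ []) ∷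
   split 2
    (0x13825404 ∷ 0x3421807 ∷ 0x18320404 ∷ 0x38510204 ∷ 0x5213807 ∷ 0x81230400 ∷ 0x351682008 ∷ 0x318250408 ∷
     0x832105434 ∷ 0x58367004 ∷ 0x37428103 ∷ 0x47628002 ∷ 0x42678002 ∷ 0x42768004 ∷ 0x3471807 ∷ 0x47682100c ∷
     0x42687100c ∷ 0x42716800a ∷ []) ∷ []) ∷
  node (0 ∷ 0 ∷ 1 ∷ 1 ∷ 6 ∷ 10 ∷ 60 ∷ []) (1 ∷ 0 ∷ 5 ∷ 4 ∷ 3 ∷ 2 ∷ 6 ∷ [])
  (0x24601704 ∷ 0x20743104 ∷ 0x16702407 ∷ 0x30752104 ∷ 0x54702607 ∷ 0x50426705 ∷ 0x70523102 ∷ 0x16072401 ∷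
   0x72043106 ∷ 0x73052106 ∷ 0x26740106 ∷ 0x6714207 ∷ 0x72104502 ∷ 0x72401306 ∷ 0x21530703 ∷ 0x6174201 ∷
   0x13024703 ∷ 0x40736205 ∷ 0x74036207 ∷ 0x26470100 ∷ 0x42710504 ∷ 0x31420703 ∷ 0x73501206 ∷ 0x73105402 ∷
   0x62340702 ∷ 0x63740104 ∷ 0x53710404 ∷ [])
  (split 0
    (0x46281000 ∷ 0x65821004 ∷ 0x41825004 ∷ 0x51834004 ∷ 0x42610804 ∷ 0x1642805 ∷ 0x84012302 ∷ 0x26043802 ∷
     0x85013202 ∷ 0x20478102 ∷ 0x68340702 ∷ 0x20748104 ∷ 0x74086207 ∷ 0x72086104 ∷ 0x48217002 ∷ 0x3782106 ∷
     0x48210702 ∷ []) ∷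
   split 2
    (0x85013202 ∷ 0x84302607 ∷ 0x46821006 ∷ 0x85013702 ∷ 0x18027401 ∷ 0x18207407 ∷ 0x18072401 ∷ 0x18702407 ∷
     0x17028403 ∷ 0x20783104 ∷ 0x80476205 ∷ []) ∷
   split 4
    (0x81254002 ∷ 0x84125006 ∷ 0x46821006 ∷ 0x84302607 ∷ 0x46281000 ∷ 0x26043802 ∷ 0x84012302 ∷ 0x74128006 ∷
     0x71284002 ∷ 0x47128006 ∷ 0x74218000 ∷ 0x26740800 ∷ 0x47218000 ∷ 0x26470800 ∷ []) ∷
   split 3
    (0x84012302 ∷ 0x24801304 ∷ 0x63540804 ∷ 0x84302607 ∷ 0x46281000 ∷ 0x35801204 ∷ 0x85026307 ∷ 0x85134006 ∷
     0x41825004 ∷ 0x84012702 ∷ 0x75801204 ∷ 0x70382104 ∷ 0x13078503 ∷ 0x24801704 ∷ 0x84702607 ∷ []) ∷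
   split 5
    (0x85134006 ∷ 0x46821006 ∷ 0x81254002 ∷ 0x84125006 ∷ 0x85026307 ∷ 0x63540804 ∷ 0x84302607 ∷ 0x35801204 ∷
     0x46281000 ∷ 0x62450804 ∷ 0x26043802 ∷ 0x84012302 ∷ 0x81274002 ∷ 0x84127006 ∷ 0x62470804 ∷ 0x63740804 ∷ []) ∷ []) ∷
  node (0 ∷ 1 ∷ 0 ∷ 2 ∷ 9 ∷ 6 ∷ 5 ∷ []) (1 ∷ 0 ∷ 2 ∷ 4 ∷ 3 ∷ 6 ∷ 5 ∷ [])
  (0x4173502 ∷ 0x70541202 ∷ 0x46157007 ∷ 0x7163502 ∷ 0x14627007 ∷ 0x23106703 ∷ 0x75021402 ∷ 0x57120302 ∷
   0x57043107 ∷ 0x3257101 ∷ 0x57123002 ∷ 0x62705404 ∷ 0x32601703 ∷ 0x41267001 ∷ 0x10754204 ∷ 0x70163206 ∷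
   0x43071602 ∷ 0x52716304 ∷ 0x15702404 ∷ 0x17054602 ∷ 0x30257101 ∷ 0x17503200 ∷ 0x71054206 ∷ 0x10345720a ∷
   0x10573420c ∷ 0x7216353c ∷ 0x13045720a ∷ 0x21573603e ∷ 0x13570420c ∷ 0x512067348 ∷ [])
  (split 1
    (0x18035600 ∷ 0x30528107 ∷ 0x68024102 ∷ 0x84350204 ∷ 0x34180502 ∷ 0x3528107 ∷ 0x86120302 ∷ 0x35068107 ∷
     0x81630202 ∷ 0x215608336 ∷ 0x4681320c ∷ 0x610258336 ∷ 0x18205463c ∷ 0x71058206 ∷ 0x70581202 ∷ 0x70183206 ∷
     0x17628007 ∷ 0x70184204 ∷ 0x21078503 ∷ 0x71508200 ∷ 0x10784204 ∷ 0x17508200 ∷ 0x7136820a ∷ 0x15078240c ∷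
     0x1687320c ∷ 0x1736820a ∷ []) ∷
   split 4
    (0x30528107 ∷ 0x86120302 ∷ 0x68024102 ∷ 0x1684320c ∷ 0x1436820a ∷ 0x18205463c ∷ 0x215608336 ∷ 0x4681320c ∷
     0x4136820a ∷ 0x70841202 ∷ 0x68027102 ∷ 0x18075240c ∷ 0x7681320c ∷ 0x7136820a ∷ 0x1687320c ∷ 0x1736820a ∷ []) ∷
   split 5
    (0x86120302 ∷ 0x35068107 ∷ 0x34180502 ∷ 0x68024102 ∷ 0x84350204 ∷ 0x42510803 ∷ 0x610258336 ∷ 0x8257101 ∷
     0x8527107 ∷ 0x28015703 ∷ 0x28017503 ∷ 0x42710803 ∷ 0x610278336 ∷ 0x17085240c ∷ 0x15087240c ∷ []) ∷
   split 6
    (0x1863204 ∷ 0x30528107 ∷ 0x3528107 ∷ 0x86120302 ∷ 0x68024102 ∷ 0x81630202 ∷ 0x215608336 ∷ 0x610258336 ∷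
     0x1873204 ∷ 0x87120302 ∷ 0x81730202 ∷ 0x28106703 ∷ 0x28107603 ∷ 0x710258336 ∷ 0x7186230c ∷ 0x6187230c ∷ []) ∷ []) ∷
  node (0 ∷ 1 ∷ 0 ∷ 6 ∷ 5 ∷ 3 ∷ []) (1 ∷ 0 ∷ 2 ∷ 4 ∷ 3 ∷ 5 ∷ [])
  (0x10536204 ∷ 0x10356202 ∷ 0x5164300 ∷ 0x45631007 ∷ 0x64203506 ∷ 0x43510605 ∷ 0x14265003 ∷ 0x5614306 ∷
   0x10534604 ∷ 0x1546204 ∷ 0x15306202 ∷ 0x15603406 ∷ 0x54261003 ∷ 0x63125406 ∷ 0x16035206 ∷ 0x415632046 ∷ [])
  (split 4
    (0x70254302 ∷ 0x53240703 ∷ 0x74025306 ∷ 0x15073400 ∷ 0x15037204 ∷ 0x1543704 ∷ 0x73214506 ∷ 0x35740107 ∷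
     0x305742146 ∷ 0x53260703 ∷ 0x7614306 ∷ 0x14267003 ∷ 0x7416306 ∷ 0x16247003 ∷ 0x64207506 ∷ 0x17036402 ∷
     0x35760107 ∷ 0x1563704 ∷ 0x64207106 ∷ 0x62074102 ∷ 0x15073600 ∷ []) ∷
   split 1
    (0x53270103 ∷ 0x15037204 ∷ 0x35042703 ∷ 0x1543704 ∷ 0x73214506 ∷ 0x35740107 ∷ 0x1457202 ∷ 0x1254373a ∷
     0x53270603 ∷ 0x27106307 ∷ 0x21067303 ∷ 0x63175406 ∷ 0x7231603 ∷ 0x56071206 ∷ 0x5164700 ∷ 0x7236103 ∷
     0x16307200 ∷ 0x73065105 ∷ []) ∷
   split 3
    (0x3275103 ∷ 0x35740107 ∷ 0x34501705 ∷ 0x73214506 ∷ 0x1457202 ∷ 0x1543704 ∷ 0x74025306 ∷ 0x53240703 ∷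
     0x305742146 ∷ 0x7236101 ∷ 0x7326107 ∷ 0x1546704 ∷ 0x36217006 ∷ 0x32176002 ∷ 0x56240703 ∷ 0x17603406 ∷
     0x3267103 ∷ 0x74025606 ∷ 0x17306406 ∷ 0x6237103 ∷ []) ∷ []) ∷
  node (0 ∷ 1 ∷ 2 ∷ 2 ∷ 9 ∷ 5 ∷ []) (1 ∷ 0 ∷ 5 ∷ 4 ∷ 3 ∷ 2 ∷ [])
  (0x4163202 ∷ 0x5162302 ∷ 0x6513251 ∷ 0x32504603 ∷ 0x41526005 ∷ 0x23405603 ∷ 0x4613251 ∷ 0x36052107 ∷ 0x20436103 ∷
   0x20346105 ∷ 0x36412051 ∷ 0x23406103 ∷ 0x23046105 ∷ 0x26513051 ∷ 0x26043107 ∷ 0x32506103 ∷ 0x32056105 ∷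
   0x14532640 ∷ 0x10253460c ∷ 0x123065442 ∷ 0x1245363c ∷ 0x10342560c ∷ 0x1354263c ∷ [])
  (split 5
    (0x37250107 ∷ 0x74530202 ∷ 0x1435270c ∷ 0x102354740 ∷ 0x45173242 ∷ 0x1524370c ∷ 0x37260107 ∷ 0x74630202 ∷
     0x6157302 ∷ 0x5167302 ∷ 0x1624370c ∷ 0x6475230c ∷ 0x5476230c ∷ 0x102364740 ∷ []) ∷
   split 4
    (0x27340107 ∷ 0x75420302 ∷ 0x102354740 ∷ 0x1524370c ∷ 0x45173242 ∷ 0x1435270c ∷ 0x27360107 ∷ 0x75620302 ∷
     0x6147202 ∷ 0x4167202 ∷ 0x6574320c ∷ 0x1635270c ∷ 0x4576320c ∷ 0x103265740 ∷ []) ∷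
   split 1
    (0x25170302 ∷ 0x34170202 ∷ 0x75420302 ∷ 0x74530202 ∷ 0x1524370c ∷ 0x45173242 ∷ 0x1435270c ∷ 0x102354740 ∷
     0x16207406 ∷ 0x12076402 ∷ 0x27406103 ∷ 0x13076502 ∷ 0x602354740 ∷ 0x6524370c ∷ 0x45673242 ∷ 0x6435270c ∷ []) ∷ []) ∷
  node (0 ∷ 0 ∷ 0 ∷ 1 ∷ 2 ∷ 28 ∷ []) (1 ∷ 0 ∷ 2 ∷ 4 ∷ 3 ∷ 5 ∷ [])
  (0x36502402 ∷ 0x63405102 ∷ 0x65420100 ∷ 0x56240104 ∷ 0x24306507 ∷ 0x65340106 ∷ 0x65321000 ∷ 0x23416507 ∷
   0x36051204 ∷ 0x2145607 ∷ 0x53640104 ∷ 0x534021608 ∷ 0x523604138 ∷ 0x564230144 ∷ 0x543602148 ∷ 0x534612048 ∷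
   0x563241044 ∷ 0x53264010a ∷ [])
  (split 0
    (0x75431006 ∷ 0x74315002 ∷ 0x57231004 ∷ 0x47512302 ∷ 0x73501200 ∷ 0x47150204 ∷ 0x34107552 ∷ 0x12035707 ∷
     0x1254707 ∷ 0x543120708 ∷ 0x524713038 ∷ 0x54310724a ∷ 0x57241303e ∷ 0x36507202 ∷ 0x30567202 ∷ 0x47156204 ∷
     0x43617552 ∷ 0x53764010a ∷ 0x53704610a ∷ []) ∷
   split 3
    (0x12035707 ∷ 0x10253707 ∷ 0x47512302 ∷ 0x54731004 ∷ 0x75431006 ∷ 0x74315002 ∷ 0x54273100a ∷ 0x543721034 ∷
     0x12065707 ∷ 0x75461006 ∷ 0x63507200 ∷ 0x34706552 ∷ 0x36507200 ∷ 0x54761004 ∷ 0x7256303 ∷ 0x70625352 ∷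
     0x56304710a ∷ 0x53604710a ∷ []) ∷ []) ∷
  node (0 ∷ 1 ∷ 3 ∷ 4 ∷ 10 ∷ 1 ∷ []) (0 ∷ 2 ∷ 1 ∷ 4 ∷ 3 ∷ 5 ∷ [])
  (0x60432107 ∷ 0x14603504 ∷ 0x10265351 ∷ 0x1265300 ∷ 0x1625306 ∷ 0x52461001 ∷ 0x53120605 ∷ 0x21304602 ∷
   0x23604504 ∷ 0x4632105 ∷ 0x20136451 ∷ 0x51362001 ∷ 0x2615406 ∷ 0x53410603 ∷ 0x16042534c ∷ 0x26031544c ∷ [])
  (split 2
    (0x10247351 ∷ 0x73410203 ∷ 0x54210705 ∷ 0x34217053 ∷ 0x12403702 ∷ 0x4372155 ∷ 0x70341207 ∷ 0x52143704d ∷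
     0x73410603 ∷ 0x10647351 ∷ 0x4376155 ∷ 0x70341607 ∷ 0x34617053 ∷ 0x16403702 ∷ []) ∷
   split 4
    (0x3741205 ∷ 0x70341207 ∷ 0x12403702 ∷ 0x10745304 ∷ 0x73410203 ∷ 0x71403506 ∷ 0x71045306 ∷ 0x10247351 ∷
     0x3761205 ∷ 0x12603702 ∷ 0x70361207 ∷ 0x4367155 ∷ 0x4637105 ∷ 0x71065306 ∷ 0x10267351 ∷ 0x10765304 ∷
     0x73610203 ∷ []) ∷ []) ∷
  node (0 ∷ 0 ∷ 2 ∷ 2 ∷ 4 ∷ 25 ∷ []) (0 ∷ 2 ∷ 1 ∷ 4 ∷ 3 ∷ 5 ∷ [])
  (0x12634054 ∷ 0x16320404 ∷ 0x3421607 ∷ 0x52106452 ∷ 0x65103202 ∷ 0x31652004 ∷ 0x2164556 ∷ 0x51206352 ∷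
   0x56304100 ∷ 0x61230400 ∷ 0x31562054 ∷ 0x35610204 ∷ 0x1263556 ∷ 0x63152006 ∷ 0x153246036 ∷ 0x14602534e ∷ [])
  (split 1
    (0x37514002 ∷ 0x42751004 ∷ 0x71523002 ∷ 0x42571054 ∷ 0x4312707 ∷ 0x27410304 ∷ 0x21743054 ∷ 0x71520357 ∷
     0x23057150 ∷ 0x254137036 ∷ 0x72651004 ∷ 0x36517002 ∷ 0x15726352 ∷ 0x31657004 ∷ 0x31567054 ∷ 0x31567002 ∷
     0x72653152 ∷ 0x4612701 ∷ 0x61057301 ∷ []) ∷
   split 3
    (0x42751004 ∷ 0x72140300 ∷ 0x27410304 ∷ 0x57403200 ∷ 0x4312707 ∷ 0x254137036 ∷ 0x23701544e ∷ 0x63157006 ∷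
     0x61573002 ∷ 0x36157006 ∷ 0x31576002 ∷ 0x36517000 ∷ 0x62753152 ∷ 0x72140600 ∷ 0x6137503 ∷ 0x31672004 ∷
     0x71605352 ∷ []) ∷
   split 2
    (0x71523002 ∷ 0x45720104 ∷ 0x42571054 ∷ 0x42751004 ∷ 0x57403200 ∷ 0x4312707 ∷ 0x27410304 ∷ 0x21743054 ∷
     0x254137036 ∷ 0x23701544e ∷ 0x71652004 ∷ 0x25716452 ∷ 0x46527002 ∷ 0x46257004 ∷ 0x46527054 ∷ 0x42567002 ∷
     0x71654252 ∷ 0x45760104 ∷ 0x61723002 ∷ 0x2164756 ∷ 0x61743054 ∷ []) ∷ []) ∷
  -- The cycle C₆, followed by C₅; the latter is cited in the analysis of paths and of half graphs.
  node (0 ∷ 1 ∷ 1 ∷ 2 ∷ 4 ∷ 24 ∷ []) (3 ∷ 1 ∷ 5 ∷ 0 ∷ 4 ∷ 2 ∷ [])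
  (0x2164354 ∷ 0x1623404 ∷ 0x2614304 ∷ 0x6153258 ∷ 0x21536050 ∷ 0x32460156 ∷ 0x60214306 ∷ 0x25310603 ∷ 0x24065154 ∷
   0x24605104 ∷ 0x41360256 ∷ 0x43102603 ∷ 0x61230402 ∷ 0x61032506 ∷ 0x62143057 ∷ 0x62140302 ∷ [])
  (split 2
    (0x71305206 ∷ 0x70123406 ∷ 0x54372154 ∷ 0x45723004 ∷ 0x27031458 ∷ 0x40317250 ∷ 0x16427055 ∷ 0x62317001 ∷
     0x6127302 ∷ 0x21746052 ∷ 0x21736050 ∷ 0x6173258 ∷ 0x2617304 ∷ 0x2167354 ∷ 0x2167302 ∷ 0x61742052 ∷ []) ∷
   split 0
    (0x30427150 ∷ 0x34201703 ∷ 0x45273054 ∷ 0x60127406 ∷ 0x30267103 ∷ 0x6127406 ∷ 0x36207103 ∷ 0x27310603 ∷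
     0x3726152 ∷ 0x6127300 ∷ 0x71642052 ∷ 0x27316003 ∷ 0x72631052 ∷ []) ∷ []) ∷
  node (0 ∷ 1 ∷ 1 ∷ 2 ∷ 12 ∷ []) (0 ∷ 2 ∷ 1 ∷ 4 ∷ 3 ∷ [])
  (0x13042558 ∷ 0x52341050 ∷ 0x50423150 ∷ 0x51043251 ∷ 0x21340559 ∷ 0x34120558 ∷ 0x53124051 ∷ 0x52034151 ∷
   0x40132559 ∷ [])
  (split 1
    (0x12430659 ∷ 0x61432050 ∷ 0x30241659 ∷ 0x61204350 ∷ 0x43210658 ∷ 0x60314250 ∷ 0x24031658 ∷ 0x3421659 ∷
     0x41063559 ∷ 0x21356003 ∷ 0x25316055 ∷ 0x25136005 ∷ 0x6125406 ∷ 0x25316003 ∷ 0x21360559 ∷ 0x56302151 ∷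
     0x15036200 ∷ 0x1264558 ∷ 0x15306206 ∷ 0x36205103 ∷ 0x52631052 ∷ []) ∷
   split 3
    (0x64213051 ∷ 0x3421659 ∷ 0x43210658 ∷ 0x60314250 ∷ 0x24031658 ∷ 0x61204350 ∷ 0x30241659 ∷ 0x2143658 ∷
     0x12430659 ∷ 0x64302151 ∷ 0x50623150 ∷ 0x13062558 ∷ 0x51603253 ∷ 0x6125302 ∷ 0x64502151 ∷ 0x1254658 ∷
     0x50241659 ∷ []) ∷
   split 4
    (0x24031658 ∷ 0x60314250 ∷ 0x43210658 ∷ 0x64213051 ∷ 0x61432050 ∷ 0x2143658 ∷ 0x30241659 ∷ 0x64302151 ∷
     0x53210658 ∷ 0x65213051 ∷ 0x65302151 ∷ 0x30251659 ∷ 0x61532050 ∷ 0x2153658 ∷ []) ∷ []) ∷ []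

-- The only shape is P₅, as the path 0 2 4 3 1. Its hints also cite P₆, so it can be excluded only
-- after the paths.
nodes₂ : List Node
nodes₂ =
  node (0 ∷ 0 ∷ 1 ∷ 2 ∷ 12 ∷ []) (1 ∷ 0 ∷ 3 ∷ 2 ∷ 4 ∷ [])
  (0x345205c ∷ 0x245315c ∷ 0x5024315e ∷ 0x12054356 ∷ 0x52304102 ∷ 0x54230106 ∷ 0x3154256 ∷ 0x1342503 ∷ 0x42530104 ∷
   [])
  (split 2
    (0x10243603 ∷ 0x43621004 ∷ 0x64321006 ∷ 0x63214002 ∷ 0x10543603 ∷ 0x54260106 ∷ 0x12054656 ∷ 0x63514002 ∷
     0x52406300 ∷ 0x45326154 ∷ 0x6342503 ∷ 0x2056315e ∷ 0x25406300 ∷ 0x42356154 ∷ 0x43651004 ∷ 0x6345203 ∷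
     0x5026315e ∷ []) ∷
   split 0
    (0x43261054 ∷ 0x64321006 ∷ 0x63214002 ∷ 0x6134205e ∷ 0x63210457 ∷ 0x10243603 ∷ 0x23106452 ∷ 0x3146205a ∷
     0x42365154 ∷ 0x46235002 ∷ 0x52604102 ∷ 0x3165205e ∷ 0x14502601 ∷ 0x50346201 ∷ []) ∷ []) ∷ []

-- P₄ with its reflection. The hints cite P₅ and the half graph on six vertices, which is why P₄
-- comes last.
node₃ : Node
node₃ =
  node (0 ∷ 1 ∷ 2 ∷ 4 ∷ []) (3 ∷ 2 ∷ 1 ∷ 0 ∷ [])
  (0x1024360 ∷ 0x234161 ∷ [])
  (split 0
    (0x2315060 ∷ 0x325105c ∷ 0x3105261 ∷ 0x5243060 ∷ 0x5024360 ∷ 0x4513060 ∷ 0x254161 ∷ 0x4325101 ∷ 0x31245063 ∷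
     0x15240300 ∷ 0x40325101 ∷ 0x45021363 ∷ 0x15204300 ∷ 0x23450162 ∷ 0x23054162 ∷ []) ∷
   split 1
    (0x3105261 ∷ 0x2315060 ∷ 0x3405261 ∷ 0x5104261 ∷ 0x5042161 ∷ 0x2345060 ∷ 0x34512063 ∷ 0x35014201 ∷ 0x41205300 ∷
     0x45103262 ∷ 0x31542063 ∷ 0x35041201 ∷ 0x14205300 ∷ 0x23045162 ∷ []) ∷
   split 2
    (0x2315060 ∷ 0x325105c ∷ 0x3105261 ∷ 0x5234161 ∷ 0x5432161 ∷ 0x4315060 ∷ 0x5324101 ∷ 0x5342101 ∷ 0x42135000 ∷
     0x45230162 ∷ 0x24135000 ∷ 0x25430162 ∷ 0x31254063 ∷ 0x31452063 ∷ []) ∷ [])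

pathHints : List ℕ
pathHints =
  (0x436215c ∷ 0x546325c ∷ 0x326105c ∷ 0x21630404 ∷ 0x3462156 ∷ 0x62314006 ∷ 0x62135000 ∷ 0x63142002 ∷ 0x24516352 ∷
   0x16205354 ∷ 0x63140257 ∷ 0x61302402 ∷ 0x16025304 ∷ 0x4321603 ∷ 0x62130406 ∷ 0x63420500 ∷ 0x23614004 ∷
   0x23164054 ∷ 0x26135054 ∷ 0x26315004 ∷ 0x41062356 ∷ 0x40123603 ∷ 0x13406252 ∷ 0x34265154 ∷ 0x34625104 ∷
   0x3426105a ∷ [])

pathSplits : List Split
pathSplits =
  (split 2
    (0x62137000 ∷ 0x24716352 ∷ 0x26137000 ∷ 0x71643252 ∷ 0x20736152 ∷ 0x63274004 ∷ 0x2367103 ∷ 0x23674004 ∷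
     0x6327103 ∷ 0x60732152 ∷ []) ∷
   split 0
    (0x16027304 ∷ 0x16207354 ∷ 0x10627304 ∷ 0x10267354 ∷ []) ∷
   split 1
    (0x61027306 ∷ 0x16027306 ∷ 0x61207300 ∷ 0x26317454 ∷ 0x16207300 ∷ 0x21367454 ∷ []) ∷
   split 3
    (0x26317004 ∷ 0x26137054 ∷ 0x23617004 ∷ 0x23167054 ∷ 0x26137002 ∷ 0x31746252 ∷ 0x23167002 ∷ 0x61743252 ∷ []) ∷
   split 4
    (0x36427104 ∷ 0x36247154 ∷ 0x34627104 ∷ 0x34267154 ∷ []) ∷
   split 5
    (0x46537204 ∷ 0x45637204 ∷ 0x46357254 ∷ 0x45367254 ∷ []) ∷ [])

chainHints : List ℕ
chainHints =
  (0x1326061 ∷ 0x1526061 ∷ 0x4236561 ∷ 0x6523061 ∷ 0x634260 ∷ 0x6325061 ∷ 0x263105c ∷ 0x2016361 ∷ 0x136260 ∷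
   0x156260 ∷ 0x3206160 ∷ 0x3604160 ∷ 0x356460 ∷ 0x5406160 ∷ 0x42106501 ∷ 0x63024100 ∷ 0x56024100 ∷ 0x6531400 ∷ [])

-- Paths, half graphs and the order of exclusion

path : ℕ → Shape
path k = shape k λ i j → j ≡ᵇ suc i

even : ℕ → Bool
even zero    = true
even (suc i) = not (even i)

-- The half graph on a₀ b₀ a₁ b₁ …, in this order, where aᵢ and bⱼ are adjacent iff i ≤ j.
half : ℕ → Shape
half k = shape (k + k) λ i j → even i ∧ not (even j)

-- The hints refer to shapes by their positions in these lists, which record the order of exclusion:
-- small tabulated shapes, P₆, P₅, and the half graph on six vertices.
known₁ known₂ known₃ : List Shape
known₁ = base ++ map (table ∘ rows) nodes₁
known₂ = (known₁ ++ path 6 ∷ []) ++ map (table ∘ rows) nodes₂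
known₃ = known₂ ++ half 3 ∷ []

-- The neighbourhoods in an induced P₆ of an outer vertex: only end vertices, or everything.
endCases : List Clause
endCases = map (λ i → vv i , false) (1 ∷ 2 ∷ 3 ∷ 4 ∷ []) ∷ map (λ i → vv i , true) (0 ∷ 1 ∷ 2 ∷ 3 ∷ 4 ∷ 5 ∷ []) ∷ []

-- The neighbourhoods in a₀ b₀ a₁ b₁ a₂ b₂ of a vertex that is a twin of one of these vertices, isolated from
-- them, or adjacent to all of them.
twinMasks : List ℕ
twinMasks = 0 ∷ 1 ∷ 5 ∷ 21 ∷ 3 ∷ 13 ∷ 32 ∷ 48 ∷ 53 ∷ 40 ∷ 44 ∷ 42 ∷ 43 ∷ 63 ∷ []

fromMask : ℕ → Clause
fromMask m = map (λ i → vv i , bit m i) (0 ∷ 1 ∷ 2 ∷ 3 ∷ 4 ∷ 5 ∷ [])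

nodes₁-ok : nodesOK base nodes₁ ≡ true
nodes₁-ok = refl

path-splits-ok : allOf (splitOK known₁ (path 6) pathHints) pathSplits ≡ true
path-splits-ok = refl

path-types-ok : typesOK known₁ (path 6) pathHints pathSplits endCases ≡ true
path-types-ok = refl

nodes₂-ok : nodesOK (known₁ ++ path 6 ∷ []) nodes₂ ≡ true
nodes₂-ok = refl

chain-types-ok : typesOK known₂ (half 3) chainHints [] (map fromMask twinMasks) ≡ true
chain-types-ok = refl

node₃-ok : nodeOK known₃ node₃ ≡ true
node₃-ok = refl

-- Induced paths

true≢false : ∀ {b} → b ≡ true → b ≢ false
true≢false refl ()

≡ᵇ-refl : ∀ i → (i ≡ᵇ i) ≡ true
≡ᵇ-refl zero    = refl
≡ᵇ-refl (suc i) = ≡ᵇ-refl i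

>⇒≡ᵇ-false : ∀ {i j} → j < i → (i ≡ᵇ j) ≡ false
>⇒≡ᵇ-false {suc i} {zero}  _         = refl
>⇒≡ᵇ-false {suc i} {suc j} (s≤s j<i) = >⇒≡ᵇ-false j<i

shift-≡ᵇ : ∀ m i j → (m + j ≡ᵇ suc (m + i)) ≡ (j ≡ᵇ suc i)
shift-≡ᵇ zero    i j = refl
shift-≡ᵇ (suc m) i j = shift-≡ᵇ m i j

reverse-≡ᵇ : ∀ {l i j} → i < j → j ≤ l → (l ∸ i ≡ᵇ suc (l ∸ j)) ≡ (j ≡ᵇ suc i)
reverse-≡ᵇ {suc l} {zero}  {suc zero}    _ _ = ≡ᵇ-refl l
reverse-≡ᵇ {suc l} {zero}  {suc (suc j)} _ (s≤s j<l) = >⇒≡ᵇ-false (∸-monoʳ-< {l} {suc j} {0} (s≤s z≤n) j<l)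
reverse-≡ᵇ {suc l} {suc i} {suc j} (s≤s i<j) (s≤s j≤l) = reverse-≡ᵇ i<j j≤l

injective-on-<⇒≤ : ∀ {n k} (e : ℕ → Fin n) → (∀ {i j} → i < k → j < k → e i ≡ e j → i ≡ j) → k ≤ n
injective-on-<⇒≤ e inj = Fin.injective⇒≤ {f = e ∘ toℕ} λ eq → Fin.toℕ-injective (inj (Fin.toℕ<n _) (Fin.toℕ<n _) eq)

module Path {n} (bs : All (Bad base n) known₁) {A : Adjacency n} (g : Good base A) where

  module _ {k} (6≤k : 6 ≤ k) {e : ℕ → Fin n} (r : Realises A (path k) e) where

    -- Two vertices are told apart by a third: by the predecessor of `i`, or for `i = 0` by vertex 2
    -- if `j = 1`, by 3 if `j = 2`, and by 1 otherwise.
    path-apart : ∀ {i j} → i < j → j < k → e i ≢ e j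
    path-apart {suc i} {j} i<j j<k eq = true≢false
      (trans (cong (A (e i)) (sym eq)) (trans (r (n<1+n i) (<-trans i<j j<k)) (≡ᵇ-refl i)))
      (trans (r (<-trans (n<1+n i) i<j) j<k) (>⇒≡ᵇ-false i<j))
    path-apart {zero} {suc zero} _ _ eq = true≢false
      (trans (cong (λ x → A x (e 2)) eq) (r (s≤s (s≤s z≤n)) (≤-trans (s≤s (s≤s (s≤s z≤n))) 6≤k)))
      (r {0} {2} (s≤s z≤n) (≤-trans (s≤s (s≤s (s≤s z≤n))) 6≤k))
    path-apart {zero} {suc (suc zero)} _ _ eq = true≢false
      (trans (cong (λ x → A x (e 3)) eq) (r (s≤s (s≤s (s≤s z≤n))) (≤-trans (s≤s (s≤s (s≤s (s≤s z≤n)))) 6≤k)))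
      (r {0} {3} (s≤s z≤n) (≤-trans (s≤s (s≤s (s≤s (s≤s z≤n)))) 6≤k))
    path-apart {zero} {suc (suc (suc j))} _ j<k eq = true≢false
      (trans (cong (A (e 1)) (sym eq)) (trans (symmetric g _ _) (r {0} {1} (s≤s z≤n) (≤-trans (s≤s (s≤s z≤n)) 6≤k))))
      (r (s≤s (s≤s z≤n)) j<k)

    path-injective : ∀ {i j} → i < k → j < k → e i ≡ e j → i ≡ j
    path-injective {i} {j} i<k j<k eq with <-cmp i j
    ... | tri< i<j _ _ = contradiction eq (path-apart i<j j<k)
    ... | tri≈ _ i≡j _ = i≡j
    ... | tri> _ _ j<i = contradiction (sym eq) (path-apart j<i i<k)

    module _ {v} (v∉ : ∀ {i} → i < k → v ≢ e i) where

      Ones Zeros : ℕ → Set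
      Ones  m = ∀ {i} → i < 6 → A v (e (m + i)) ≡ true
      Zeros m = ∀ {i} → 0 < i → i < 5 → A v (e (m + i)) ≡ false

      window : ∀ m → m + 6 ≤ k → Zeros m ⊎ Ones m
      window m m+6≤k with Context.outer-types-sound g (path 6) (e ∘ (m +_))
        (λ {i} {j} i<j j<6 → trans (r (+-monoʳ-< m i<j) (<-≤-trans (+-monoʳ-< m j<6) m+6≤k)) (shift-≡ᵇ m i j))
        bs pathHints pathSplits endCases path-splits-ok path-types-ok v
            (λ i<6 → v∉ (<-≤-trans (+-monoʳ-< m i<6) m+6≤k))
      ... | here (z₁ ∷ z₂ ∷ z₃ ∷ z₄ ∷ []) = inj₁ λ
        { {1} _ _ → z₁
        ; {2} _ _ → z₂
        ; {3} _ _ → z₃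
        ; {4} _ _ → z₄
        ; {suc (suc (suc (suc (suc _))))} _ (s≤s (s≤s (s≤s (s≤s (s≤s ()))))) }
      ... | there (here (o₀ ∷ o₁ ∷ o₂ ∷ o₃ ∷ o₄ ∷ o₅ ∷ [])) = inj₂ λ
        { {0} _ → o₀
        ; {1} _ → o₁
        ; {2} _ → o₂
        ; {3} _ → o₃
        ; {4} _ → o₄
        ; {5} _ → o₅
        ; {suc (suc (suc (suc (suc (suc _)))))} (s≤s (s≤s (s≤s (s≤s (s≤s (s≤s ())))))) }

      -- Windows one step apart share inner vertices, on which the two alternatives contradict each
      -- other; so the alternative of the first window propagates.
      windows : (∀ m → m + 6 ≤ k → Zeros m) ⊎ (∀ m → m + 6 ≤ k → Ones m)
      windows with window 0 6≤k
      ... | inj₁ z₀ = inj₁ zeros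
        where
        zeros : ∀ m → m + 6 ≤ k → Zeros m
        zeros zero    _ = z₀
        zeros (suc m) m+6<k with window (suc m) m+6<k
        ... | inj₁ z = z
        ... | inj₂ o = contradiction (zeros m (<⇒≤ m+6<k) {1} (s≤s z≤n) (s≤s (s≤s z≤n)))
          (true≢false (subst (λ x → A v (e x) ≡ true) (sym (+-suc m 0)) (o {0} (s≤s z≤n))))
      ... | inj₂ o₀ = inj₂ ones
        where
        ones : ∀ m → m + 6 ≤ k → Ones m
        ones zero    _ = o₀
        ones (suc m) m+6<k with window (suc m) m+6<k
        ... | inj₂ o = o
        ... | inj₁ z = contradiction (z {1} (s≤s z≤n) (s≤s (s≤s z≤n)))
          (true≢false (subst (λ x → A v (e x) ≡ true) (+-suc m 1) (ones m (<⇒≤ m+6<k) {2} (s≤s (s≤s (s≤s z≤n))))))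

      outer-type : (∀ {i} → 0 < i → suc i < k → A v (e i) ≡ false) ⊎ (∀ {i} → i < k → A v (e i) ≡ true)
      outer-type with windows
      ... | inj₁ zeros = inj₁ interior
        where
        interior : ∀ {i} → 0 < i → suc i < k → A v (e i) ≡ false
        interior {i} 0<i i+1<k with <-cmp i 4
        ... | tri< i<4 _ _ = zeros 0 6≤k 0<i (m<n⇒m<1+n i<4)
        ... | tri≈ _ refl _ = zeros 0 6≤k 0<i ≤-refl
        -- `i` is the last inner vertex of the window that begins at `i ∸ 4`.
        ... | tri> _ _ 4<i = subst (λ x → A v (e x) ≡ false) (m∸n+n≡m (<⇒≤ 4<i))
          (zeros (i ∸ 4) (subst (_≤ k) (trans (cong (2 +_) (sym (m∸n+n≡m (<⇒≤ 4<i)))) (trans (+-comm 2 _) (+-assoc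
              (i ∸ 4) 4 2))) i+1<k)
            {4} (s≤s z≤n) ≤-refl)
      ... | inj₂ ones = inj₂ every
        where
        every : ∀ {i} → i < k → A v (e i) ≡ true
        every {i} i<k with <-cmp i 5
        ... | tri< i<5 _ _ = ones 0 6≤k (m<n⇒m<1+n i<5)
        ... | tri≈ _ refl _ = ones 0 6≤k ≤-refl
        ... | tri> _ _ 5<i = subst (λ x → A v (e x) ≡ true) (m∸n+n≡m (<⇒≤ 5<i))
          (ones (i ∸ 5) (subst (_≤ k) (trans (cong (1 +_) (sym (m∸n+n≡m (<⇒≤ 5<i)))) (trans (+-comm 1 _) (+-assoc
              (i ∸ 5) 5 1))) i<k)
            {5} ≤-refl)

    prepend : ∀ {v} → A v (e 0) ≡ true → (∀ {i} → 0 < i → i < k → A v (e i) ≡ false) →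
              Realises A (path (suc k)) λ { zero → v ; (suc i) → e i }
    prepend v0 vi {zero}  {suc zero}    _         _         = v0
    prepend v0 vi {zero}  {suc (suc j)} _         (s≤s j<k) = vi (s≤s z≤n) j<k
    prepend v0 vi {suc i} {suc j}       (s≤s i<j) (s≤s j<k) = r i<j j<k

  reversal : ∀ {l e} → Realises A (path (suc l)) e → Realises A (path (suc l)) (e ∘ (l ∸_))
  reversal {l} r {i} {j} i<j (s≤s j≤l) = trans (symmetric g _ _)
    (trans (r (∸-monoʳ-< i<j j≤l) (s≤s (m∸n≤m l i))) (reverse-≡ᵇ i<j j≤l))

-- Downward induction on `k`: once the fuel is used up, the path has more than `n` vertices. An
-- outer vertex adjacent to exactly one end and to no inner vertex would lengthen the path. One
-- adjacent to both ends closes a cycle, which the reflection respects.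
path-bad : ∀ {n} → All (Bad base n) known₁ → ∀ fuel {k} → 6 ≤ k → n < k + fuel → Bad base n (path k)
path-bad bs zero {k} 6≤k n<k A g e r =
  <-irrefl refl (<-≤-trans n<k (subst (_≤ _) (sym (+-identityʳ k)) (injective-on-<⇒≤ e
      (Path.path-injective bs g 6≤k r))))
path-bad {n} bs (suc fuel) {suc l} 6≤k n<k A g e r = contradiction
  (rigid-extension g (suc l) e (l ∸_) (path-injective 6≤k r) (λ {i} _ → s≤s (m∸n≤m l i))
    (λ { (s≤s i≤l) → m∸[m∸n]≡n i≤l })
    (λ i<k j<k i≢j → trans (realises′ (symmetric g) (reversal r) i<k j<k i≢j)
        (sym (realises′ (symmetric g) r i<k j<k i≢j)))
    outer (s≤s z≤n))
  -- Rigidity at vertex 0 says that the two ends coincide, `l ∸ 0 ≡ 0`.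
  λ { refl → case 6≤k of λ { (s≤s ()) } }
  where
  open Path bs g
  longer : ∀ {e} → ¬ Realises A (path (suc (suc l))) e
  longer {e} = path-bad bs fuel (m≤n⇒m≤1+n 6≤k) (subst (n <_) (+-suc (suc l) fuel) n<k) A g e
  outer : ∀ v → (∀ {i} → i < suc l → v ≢ e i) → ∀ {i} → i < suc l → A v (e (l ∸ i)) ≡ A v (e i)
  outer v v∉ {i} (s≤s i≤l) with outer-type 6≤k r v∉
  ... | inj₂ ones = trans (ones (s≤s (m∸n≤m l i))) (sym (ones (s≤s i≤l)))
  ... | inj₁ zeros = by-ends (A v (e 0)) (A v (e l)) refl refl
    where
    ends : ∀ {b} → A v (e 0) ≡ b → A v (e l) ≡ b → A v (e (l ∸ i)) ≡ A v (e i)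
    ends v0 vl with m≤n⇒m<n∨m≡n i≤l | m≤n⇒m<n∨m≡n (z≤n {i})
    ... | inj₂ refl | _         = trans (cong (A v ∘ e) (n∸n≡0 l)) (trans v0 (sym vl))
    ... | inj₁ _    | inj₂ refl = trans vl (sym v0)
    ... | inj₁ i<l  | inj₁ 0<i  = trans (zeros (m<n⇒0<n∸m i<l) (s≤s (∸-monoʳ-< 0<i i≤l))) (sym (zeros 0<i (s≤s i<l)))
    by-ends : ∀ b c → A v (e 0) ≡ b → A v (e l) ≡ c → A v (e (l ∸ i)) ≡ A v (e i)
    by-ends true  true  v0 vl = ends v0 vl
    by-ends false false v0 vl = ends v0 vl
    by-ends true  false v0 vl = ⊥-elim (longer (prepend 6≤k r v0 rest))
      where
      rest : ∀ {i} → 0 < i → i < suc l → A v (e i) ≡ false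
      rest 0<i (s≤s i≤l) with m≤n⇒m<n∨m≡n i≤l
      ... | inj₁ i<l  = zeros 0<i (s≤s i<l)
      ... | inj₂ refl = vl
    by-ends false true  v0 vl = ⊥-elim (longer (prepend 6≤k (reversal r) vl rest))
      where
      rest : ∀ {i} → 0 < i → i < suc l → A v (e (l ∸ i)) ≡ false
      rest {i} 0<i (s≤s i≤l) with m≤n⇒m<n∨m≡n i≤l
      ... | inj₁ i<l  = zeros (m<n⇒0<n∸m i<l) (s≤s (∸-monoʳ-< 0<i i≤l))
      ... | inj₂ refl = trans (cong (A v ∘ e) (n∸n≡0 l)) v0

-- Half graphs

even-double : ∀ s → even (s + s) ≡ true
even-double zero    = refl
even-double (suc s) = trans (cong (not ∘ even) (+-suc s s)) (trans (not-involutive _) (even-double s))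

double-< : ∀ {s t} → s < t → suc (s + s) < t + t
double-< {s} s<t = ≤-trans (s≤s (≤-reflexive (sym (+-suc s s)))) (+-mono-≤ s<t s<t)

data Parity : ℕ → Set where
  ev : ∀ s → Parity (s + s)
  od : ∀ s → Parity (suc (s + s))

parity : ∀ j → Parity j
parity zero    = ev 0
parity (suc j) with parity j
... | ev s = od s
... | od s = subst Parity (cong suc (+-suc s s)) (ev (suc s))

half-< : ∀ {s k} → s + s < k + k → s < k
half-< {s} {k} lt with <-cmp s k
... | tri< s<k _ _ = s<k
... | tri≈ _ refl _ = contradiction lt (<-irrefl refl)
... | tri> _ _ k<s = contradiction lt (<-asym (+-mono-< k<s k<s))

third : ∀ {k} → 3 ≤ k → ∀ i j → ∃ λ s → s < k × s ≢ i × s ≢ j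
third (s≤s (s≤s (s≤s _))) i j with 0 ≟ i | 0 ≟ j
... | no 0≢i | no 0≢j = 0 , s≤s z≤n , 0≢i , 0≢j
... | yes refl | _ with 1 ≟ j
...   | no 1≢j   = 1 , s≤s (s≤s z≤n) , (λ ()) , 1≢j
...   | yes refl = 2 , s≤s (s≤s (s≤s z≤n)) , (λ ()) , (λ ())
third (s≤s (s≤s (s≤s _))) i j | no _ | yes refl with 1 ≟ i
...   | no 1≢i   = 1 , s≤s (s≤s z≤n) , 1≢i , (λ ())
...   | yes refl = 2 , s≤s (s≤s (s≤s z≤n)) , (λ ()) , (λ ())

-- The value `α t` in `twinA` and `β t` in `twinB` is left open, being the adjacency to the vertex
-- whose twin is described.
data Form (k : ℕ) (α β : ℕ → Bool) : Set where
  const : ∀ c → (∀ {s} → s < k → α s ≡ c) → (∀ {s} → s < k → β s ≡ c) → Form k α β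
  twinA : ∀ {t} → t < k → (∀ {s} → s < k → s ≢ t → α s ≡ false) →
          (∀ {s} → s < t → β s ≡ false) → (∀ {s} → s < k → t ≤ s → β s ≡ true) → Form k α β
  twinB : ∀ {t} → t < k → (∀ {s} → s < k → s ≢ t → β s ≡ false) →
          (∀ {s} → s ≤ t → α s ≡ true) → (∀ {s} → s < k → t < s → α s ≡ false) → Form k α β

-- The letter of a vertex at i consists of its adjacencies α and β to aᵢ and bᵢ. Two consecutive letters that differ
-- determine all others: just true means that the vertex is a twin of some bᵢ, just false of some aᵢ.
step : Bool → Bool → Bool → Bool → Maybe Bool
step true  _     false false = just true
step true  false true  true  = just true
step false false _     true  = just false
step true  true  false true  = just false
step _     _     _     _     = nothing

-- The condition that the letters a b and c d at consecutive indices impose on a letter α β further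
-- left or further right. Where `step` is `nothing`, it only asks that the two letters agree; this
-- rejects the remaining pairs of distinct letters.
before after : Bool → Bool → Bool → Bool → Bool → Bool → Bool
before a b c d α β with step a b c d
... | just true  = α ∧ not β
... | just false = not α ∧ not β
... | nothing    = (a == c) ∧ (b == d)
after a b c d α β with step a b c d
... | just true  = not α ∧ not β
... | just false = not α ∧ β
... | nothing    = (a == c) ∧ (b == d)

before-ok after-ok : ℕ → Bool
before-ok m = before (bit m 2) (bit m 3) (bit m 4) (bit m 5) (bit m 0) (bit m 1)
after-ok  m = after (bit m 0) (bit m 1) (bit m 2) (bit m 3) (bit m 4) (bit m 5)

all-before-ok : All (λ m → before-ok m ≡ true) twinMasks
all-before-ok = allOf-sound {p = before-ok} twinMasks refl

all-after-ok : All (λ m → after-ok m ≡ true) twinMasks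
all-after-ok = allOf-sound {p = after-ok} twinMasks refl

∧-split : ∀ {a b} → a ∧ b ≡ true → a ≡ true × b ≡ true
∧-split {true} {true} _ = refl , refl

not-true : ∀ {a} → not a ≡ true → a ≡ false
not-true {false} _ = refl

scan : ∀ (α β : ℕ → Bool) k → (∀ {s} → s < k → α s ≡ α 0 × β s ≡ β 0)
       ⊎ ∃ λ i → suc i < k × ¬ (α i ≡ α (suc i) × β i ≡ β (suc i))
scan α β zero = inj₁ λ ()
scan α β (suc zero) = inj₁ λ { (s≤s z≤n) → refl , refl }
scan α β (suc (suc k)) with scan α β (suc k)
... | inj₂ (i , i<k , ne) = inj₂ (i , m<n⇒m<1+n i<k , ne)
... | inj₁ all with α k ≟ᵇ α (suc k) | β k ≟ᵇ β (suc k)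
...   | no ne | _     = inj₂ (k , ≤-refl , ne ∘ proj₁)
...   | yes _ | no ne = inj₂ (k , ≤-refl , ne ∘ proj₂)
...   | yes eq | yes eq′ = inj₁ λ { (s≤s s≤k) → case m≤n⇒m<n∨m≡n s≤k of λ where
          (inj₁ s<k)  → all s<k
          (inj₂ refl) → trans (sym eq) (proj₁ (all ≤-refl)) , trans (sym eq′) (proj₂ (all ≤-refl)) }

-- If all letters agree, the vertex is constant, a twin of the first a, or a twin of the last b.
-- Otherwise two consecutive letters differ. As `k` is at least 3, there is another index, and its
-- window forces `step` to be `just` something, which in turn determines the letters at all other
-- indices.
form-from-windows : ∀ {k} → 3 ≤ k → ∀ (α β : ℕ → Bool) →
  (∀ {s i} → s < i → suc i < k → before (α i) (β i) (α (suc i)) (β (suc i)) (α s) (β s) ≡ true) →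
  (∀ {i s} → suc i < s → s < k → after (α i) (β i) (α (suc i)) (β (suc i)) (α s) (β s) ≡ true) →
  Form k α β
form-from-windows {k@(suc l)} 3≤k α β bef aft with scan α β k
... | inj₁ all = by-letter (α 0) (β 0) refl refl
  where
  by-letter : ∀ a b → α 0 ≡ a → β 0 ≡ b → Form k α β
  by-letter true  true  a b = const true (λ s<k → trans (proj₁ (all s<k)) a) (λ s<k → trans (proj₂ (all s<k)) b)
  by-letter false false a b = const false (λ s<k → trans (proj₁ (all s<k)) a) (λ s<k → trans (proj₂ (all s<k)) b)
  by-letter false true  a b = twinA {t = 0} (<-≤-trans (s≤s z≤n) 3≤k) (λ s<k _ → trans (proj₁ (all s<k)) a) (λ ())
                                    (λ s<k _ → trans (proj₂ (all s<k)) b)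
  by-letter true  false a b = twinB {t = l} ≤-refl (λ s<k _ → trans (proj₂ (all s<k)) b)
      (λ s≤l → trans (proj₁ (all (s≤s s≤l))) a)
                          (λ { (s≤s s≤l) l<s → contradiction l<s (≤⇒≯ s≤l) })
... | inj₂ (i , i+1<k , ne) = by-letters (α i) (β i) (α (suc i)) (β (suc i)) refl refl refl refl
  where
  by-letters : ∀ a b c d → α i ≡ a → β i ≡ b → α (suc i) ≡ c → β (suc i) ≡ d → Form k α β
  by-letters a b c d refl refl refl refl = result (step a b c d) refl
    where
    B-below : step a b c d ≡ just true → ∀ {s} → s < i → α s ≡ true × β s ≡ false
    B-below eq s<i with bef s<i i+1<k
    ... | p rewrite eq = proj₁ (∧-split p) , not-true (proj₂ (∧-split p))
    A-below : step a b c d ≡ just false → ∀ {s} → s < i → α s ≡ false × β s ≡ false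
    A-below eq s<i with bef s<i i+1<k
    ... | p rewrite eq = not-true (proj₁ (∧-split p)) , not-true (proj₂ (∧-split p))
    B-above : step a b c d ≡ just true → ∀ {s} → suc i < s → s < k → α s ≡ false × β s ≡ false
    B-above eq i<s s<k with aft i<s s<k
    ... | p rewrite eq = not-true (proj₁ (∧-split p)) , not-true (proj₂ (∧-split p))
    A-above : step a b c d ≡ just false → ∀ {s} → suc i < s → s < k → α s ≡ false × β s ≡ true
    A-above eq i<s s<k with aft i<s s<k
    ... | p rewrite eq = not-true (proj₁ (∧-split p)) , proj₂ (∧-split p)
    same : step a b c d ≡ nothing → ⊥
    same eq with third 3≤k i (suc i)
    ... | s , s<k , s≢i , s≢i+1 with <-cmp s i
    ...   | tri≈ _ s≡i _ = s≢i s≡i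
    ...   | tri< s<i _ _ with bef s<i i+1<k
    ...     | p rewrite eq = ne (==-sound _ _ (proj₁ (∧-split p)) , ==-sound _ _ (proj₂ (∧-split p)))
    same eq | s , s<k , s≢i , s≢i+1 | tri> _ _ i<s with aft (≤∧≢⇒< i<s (≢-sym s≢i+1)) s<k
    ...     | p rewrite eq = ne (==-sound _ _ (proj₁ (∧-split p)) , ==-sound _ _ (proj₂ (∧-split p)))
    position : ∀ s → s < i ⊎ s ≡ i ⊎ s ≡ suc i ⊎ suc i < s
    position s with <-cmp s i
    ... | tri< s<i _ _ = inj₁ s<i
    ... | tri≈ _ s≡i _ = inj₂ (inj₁ s≡i)
    ... | tri> _ _ i<s with m≤n⇒m<n∨m≡n i<s
    ...   | inj₁ i+1<s = inj₂ (inj₂ (inj₂ i+1<s))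
    ...   | inj₂ i+1≡s = inj₂ (inj₂ (inj₁ (sym i+1≡s)))
    split-B : step a b c d ≡ just true → (a ≡ true × c ≡ false × d ≡ false) ⊎ (a ≡ true × b ≡ false × c ≡ true)
    split-B = go a b c d
      where
      go : ∀ a b c d → step a b c d ≡ just true → (a ≡ true × c ≡ false × d ≡ false) ⊎
          (a ≡ true × b ≡ false × c ≡ true)
      go true  _     false false _ = inj₁ (refl , refl , refl)
      go true  false true  true  _ = inj₂ (refl , refl , refl)
      go true  true  false true ()
      go true  true  true  true ()
      go true  true  true  false ()
      go true  false true  false ()
      go true  false false true ()
      go false false true  true ()
      go false false false true ()
    split-A : step a b c d ≡ just false → (b ≡ true × c ≡ false × d ≡ true) ⊎ (a ≡ false × b ≡ false × d ≡ true)
    split-A = go a b c d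
      where
      go : ∀ a b c d → step a b c d ≡ just false → (b ≡ true × c ≡ false × d ≡ true) ⊎
          (a ≡ false × b ≡ false × d ≡ true)
      go false false _     true  _ = inj₂ (refl , refl , refl)
      go true  true  false true  _ = inj₁ (refl , refl , refl)
      go true  false false false ()
      go true  true  false false ()
      go true  false true  true ()
    result : ∀ m → step a b c d ≡ m → Form k α β
    result nothing eq = ⊥-elim (same eq)
    result (just true) eq with split-B eq
    ... | inj₁ (a≡ , c≡ , d≡) = twinB {t = i} (<-trans (n<1+n i) i+1<k)
      (λ {s} s<k s≢i → case position s of λ where
        (inj₁ s<i) → proj₂ (B-below eq s<i)
        (inj₂ (inj₁ s≡i)) → contradiction s≡i s≢i
        (inj₂ (inj₂ (inj₁ refl))) → d≡
        (inj₂ (inj₂ (inj₂ i<s))) → proj₂ (B-above eq i<s s<k))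
      (λ {s} s≤i → case m≤n⇒m<n∨m≡n s≤i of λ where
        (inj₁ s<i) → proj₁ (B-below eq s<i)
        (inj₂ refl) → a≡)
      (λ {s} s<k i<s → case m≤n⇒m<n∨m≡n i<s of λ where
        (inj₁ i+1<s) → proj₁ (B-above eq i+1<s s<k)
        (inj₂ refl) → c≡)
    ... | inj₂ (a≡ , b≡ , c≡) = twinB {t = suc i} i+1<k
      (λ {s} s<k s≢i+1 → case position s of λ where
        (inj₁ s<i) → proj₂ (B-below eq s<i)
        (inj₂ (inj₁ refl)) → b≡
        (inj₂ (inj₂ (inj₁ s≡i+1))) → contradiction s≡i+1 s≢i+1
        (inj₂ (inj₂ (inj₂ i<s))) → proj₂ (B-above eq i<s s<k))
      (λ {s} s≤i+1 → case position s of λ where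
        (inj₁ s<i) → proj₁ (B-below eq s<i)
        (inj₂ (inj₁ refl)) → a≡
        (inj₂ (inj₂ (inj₁ refl))) → c≡
        (inj₂ (inj₂ (inj₂ i<s))) → contradiction i<s (≤⇒≯ s≤i+1))
      (λ s<k i+1<s → proj₁ (B-above eq i+1<s s<k))
    result (just false) eq with split-A eq
    ... | inj₁ (b≡ , c≡ , d≡) = twinA {t = i} (<-trans (n<1+n i) i+1<k)
      (λ {s} s<k s≢i → case position s of λ where
        (inj₁ s<i) → proj₁ (A-below eq s<i)
        (inj₂ (inj₁ s≡i)) → contradiction s≡i s≢i
        (inj₂ (inj₂ (inj₁ refl))) → c≡
        (inj₂ (inj₂ (inj₂ i<s))) → proj₁ (A-above eq i<s s<k))
      (λ s<i → proj₂ (A-below eq s<i))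
      (λ {s} s<k i≤s → case position s of λ where
        (inj₁ s<i) → contradiction s<i (≤⇒≯ i≤s)
        (inj₂ (inj₁ refl)) → b≡
        (inj₂ (inj₂ (inj₁ refl))) → d≡
        (inj₂ (inj₂ (inj₂ i<s))) → proj₂ (A-above eq i<s s<k))
    ... | inj₂ (a≡ , b≡ , d≡) = twinA {t = suc i} i+1<k
      (λ {s} s<k s≢i+1 → case position s of λ where
        (inj₁ s<i) → proj₁ (A-below eq s<i)
        (inj₂ (inj₁ refl)) → a≡
        (inj₂ (inj₂ (inj₁ s≡i+1))) → contradiction s≡i+1 s≢i+1
        (inj₂ (inj₂ (inj₂ i<s))) → proj₁ (A-above eq i<s s<k))
      (λ {s} s<i+1 → case m≤n⇒m<n∨m≡n s<i+1 of λ where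
        (inj₁ (s≤s s<i)) → proj₂ (A-below eq s<i)
        (inj₂ refl) → b≡)
      (λ {s} s<k i<s → case m≤n⇒m<n∨m≡n i<s of λ where
        (inj₁ i+1<s) → proj₂ (A-above eq i+1<s s<k)
        (inj₂ refl) → d≡)

update : ∀ {X : Set} → ℕ → X → (ℕ → X) → ℕ → X
update p x c j with j ≟ p
... | yes _ = x
... | no _  = c j

update-at : ∀ {X : Set} p (x : X) c → update p x c p ≡ x
update-at p x c with p ≟ p
... | yes _ = refl
... | no p≢p = contradiction refl p≢p

update-off : ∀ {X : Set} {p} {x : X} {c j} → j ≢ p → update p x c j ≡ c j
update-off {p = p} {j = j} j≢p with j ≟ p
... | yes j≡p = contradiction j≡p j≢p
... | no _    = refl

Twin : ∀ {n} → Adjacency n → Shape → (ℕ → Fin n) → ℕ → Fin n → Set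
Twin A Q c p x = ∀ {j} → j < order Q → j ≢ p → A x (c j) ≡ edge′ Q p j

realises-update : ∀ {Qs n} {A : Adjacency n} {Q c p x} → Good Qs A → Realises A Q c → p < order Q →
                  Twin A Q c p x → Realises A Q (update p x c)
realises-update {A = A} {Q} {c} {p} {x} g r p<k tw {i} {j} i<j j<k with i ≟ p | j ≟ p
... | yes refl | yes refl = contradiction i<j (<-irrefl refl)
... | yes refl | no j≢p   = trans (tw j<k j≢p) (edge′-< Q i<j)
... | no i≢p   | yes refl = trans (symmetric g _ _) (trans (tw (<-trans i<j j<k) i≢p) (edge′-> Q i<j))
... | no _     | no _     = r i<j j<k

shorter : ∀ {m k t} → suc m < t → t < suc k + suc k → t ∸ 2 < k + k
shorter {k = k} {suc (suc t)} (s≤s _) (s≤s t<k) = ≤-pred (subst (suc (suc t) ≤_) (+-suc k k) t<k)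
shorter {t = suc zero} (s≤s ())

-- After position `p` the second sequence resumes two places back, so that the result is longer by
-- two.
insert : ∀ {X : Set} → ℕ → X → (ℕ → X) → (ℕ → X) → ℕ → X
insert p z f g j with <-cmp j p
... | tri< _ _ _ = f j
... | tri≈ _ _ _ = z
... | tri> _ _ _ = g (j ∸ 2)

even-∸2 : ∀ {j} → 2 ≤ j → even (j ∸ 2) ≡ even j
even-∸2 (s≤s (s≤s _)) = sym (not-involutive _)

edge′-AA : ∀ k s t → edge′ (half k) (s + s) (t + t) ≡ false
edge′-AA k s t with (s + s) <ᵇ (t + t)
... | true  rewrite even-double s | even-double t = refl
... | false rewrite even-double s | even-double t = refl

edge′-BB : ∀ k s t → edge′ (half k) (suc (s + s)) (suc (t + t)) ≡ false
edge′-BB k s t with suc (s + s) <ᵇ suc (t + t)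
... | true  rewrite even-double s = refl
... | false rewrite even-double t = refl

edge′-AB : ∀ k {s t} → s ≤ t → edge′ (half k) (s + s) (suc (t + t)) ≡ true
edge′-AB k {s} {t} s≤t rewrite <ᵇ-true (s≤s (+-mono-≤ s≤t s≤t)) | even-double s | even-double t = refl

edge′-AB> : ∀ k {s t} → t < s → edge′ (half k) (s + s) (suc (t + t)) ≡ false
edge′-AB> k {s} {t} t<s rewrite <ᵇ-false {s + s} {suc (t + t)}
    (<⇒≤ (double-< t<s)) | even-double s | even-double t = refl

edge′-sym : ∀ Q {i j} → i ≢ j → edge′ Q i j ≡ edge′ Q j i
edge′-sym Q {i} {j} i≢j with <-cmp i j
... | tri< i<j _ _ = trans (edge′-< Q i<j) (sym (edge′-> Q i<j))
... | tri≈ _ i≡j _ = contradiction i≡j i≢j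
... | tri> _ _ j<i = trans (edge′-> Q j<i) (sym (edge′-< Q j<i))

A≢B : ∀ s t → s + s ≢ suc (t + t)
A≢B s t eq = true≢false (even-double s) (trans (cong even eq) (cong not (even-double t)))

A-injective : ∀ {s t} → s + s ≡ t + t → s ≡ t
A-injective {s} {t} eq with <-cmp s t
... | tri< s<t _ _ = contradiction eq (<⇒≢ (+-mono-< s<t s<t))
... | tri≈ _ s≡t _ = s≡t
... | tri> _ _ t<s = contradiction (sym eq) (<⇒≢ (+-mono-< t<s t<s))

A< : ∀ {s k} → s < k → s + s < k + k
A< s<k = +-mono-< s<k s<k

B< : ∀ {s k} → s < k → suc (s + s) < k + k
B< = double-<

module Half {n} (bs : All (Bad base n) known₂) {A : Adjacency n} (g : Good base A) {k} (3≤k : 3 ≤ k) where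

  H : Shape
  H = half k

  αs βs : (ℕ → Fin n) → Fin n → ℕ → Bool
  αs c v s = A v (c (s + s))
  βs c v s = A v (c (suc (s + s)))

  module _ {c : ℕ → Fin n} (r : Realises A H c) where

    -- The vertices aₜ and bₜ for three values of t induce the half graph on six vertices. Its check
    -- uses no splits, so `v` is arbitrary and may belong to the half graph.
    window : ∀ {t₀ t₁ t₂} → t₀ < t₁ → t₁ < t₂ → t₂ < k → ∀ v →
             ∃ λ m → m ∈ twinMasks × (αs c v t₀ ≡ bit m 0 × βs c v t₀ ≡ bit m 1) ×
                     (αs c v t₁ ≡ bit m 2 × βs c v t₁ ≡ bit m 3) × (αs c v t₂ ≡ bit m 4 × βs c v t₂ ≡ bit m 5)
    window {t₀} {t₁} {t₂} t₀<t₁ t₁<t₂ t₂<k v =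
      let m , m∈ , sat = find (Any.map⁻ {f = fromMask} {xs = twinMasks} (Context.types-sound g (half 3) e re bs chainHints [] (map fromMask twinMasks) refl chain-types-ok v [])) in
      case sat of λ { (a ∷ b ∷ c ∷ d ∷ e ∷ f ∷ []) → m , m∈ , (a , b) , (c , d) , (e , f) }
      where
      s : ℕ → ℕ
      s 0 = t₀ + t₀
      s 1 = suc (t₀ + t₀)
      s 2 = t₁ + t₁
      s 3 = suc (t₁ + t₁)
      s 4 = t₂ + t₂
      s _ = suc (t₂ + t₂)
      e : ℕ → Fin n
      e = c ∘ s
      s-even : ∀ {i} → i < 6 → even (s i) ≡ even i
      s-even {0} _ = even-double t₀
      s-even {1} _ = cong not (even-double t₀)
      s-even {2} _ = even-double t₁
      s-even {3} _ = cong not (even-double t₁)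
      s-even {4} _ = even-double t₂
      s-even {5} _ = cong not (even-double t₂)
      s-even {suc (suc (suc (suc (suc (suc _)))))} (s≤s (s≤s (s≤s (s≤s (s≤s (s≤s ()))))))
      s-step : ∀ {i} → i < 5 → s i < s (suc i)
      s-step {0} _ = ≤-refl
      s-step {1} _ = double-< t₀<t₁
      s-step {2} _ = ≤-refl
      s-step {3} _ = double-< t₁<t₂
      s-step {4} _ = ≤-refl
      s-step {suc (suc (suc (suc (suc _))))} (s≤s (s≤s (s≤s (s≤s (s≤s ())))))
      s-mono : ∀ {i j} → i < j → j < 6 → s i < s j
      s-mono {i} {suc j} (s≤s i≤j) (s≤s j<5) with m≤n⇒m<n∨m≡n i≤j
      ... | inj₁ i<j  = <-trans (s-mono i<j (m<n⇒m<1+n j<5)) (s-step j<5)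
      ... | inj₂ refl = s-step j<5
      s< : ∀ {j} → j < 6 → s j < k + k
      s< {j} (s≤s j≤5) with m≤n⇒m<n∨m≡n j≤5
      ... | inj₁ j<5  = <-trans (s-mono j<5 ≤-refl) (double-< t₂<k)
      ... | inj₂ refl = double-< t₂<k
      re : Realises A (half 3) e
      re i<j j<6 = trans (r (s-mono i<j j<6) (s< j<6)) (cong₂ (λ a b → a ∧ not b) (s-even (<-trans i<j j<6))
          (s-even j<6))

    form : ∀ v → Form k (αs c v) (βs c v)
    form v = form-from-windows 3≤k (αs c v) (βs c v)
      (λ s<i i+1<k → let m , m∈ , (a , b) , (a′ , b′) , (a″ , b″) = window s<i ≤-refl i+1<k v in
        trans (cong-before a′ b′ a″ b″ a b) (All.lookup all-before-ok m∈))
      (λ {i} {s} i<s s<k → let m , m∈ , (a , b) , (a′ , b′) , (a″ , b″) = window {i} ≤-refl i<s s<k v in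
        trans (cong-after a b a′ b′ a″ b″) (All.lookup all-after-ok m∈))
      where
      cong-before : ∀ {a b c d e f a′ b′ c′ d′ e′ f′} → a ≡ a′ → b ≡ b′ → c ≡ c′ → d ≡ d′ → e ≡ e′ → f ≡ f′ →
                    before a b c d e f ≡ before a′ b′ c′ d′ e′ f′
      cong-before refl refl refl refl refl refl = refl
      cong-after : ∀ {a b c d e f a′ b′ c′ d′ e′ f′} → a ≡ a′ → b ≡ b′ → c ≡ c′ → d ≡ d′ → e ≡ e′ → f ≡ f′ →
                   after a b c d e f ≡ after a′ b′ c′ d′ e′ f′
      cong-after refl refl refl refl refl refl = refl

record IsTwinA (k i : ℕ) (α β : ℕ → Bool) : Set where
  field
    β-below : ∀ {s} → s < i → β s ≡ false
    β-above : ∀ {s} → s < k → i ≤ s → β s ≡ true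
    α-off   : ∀ {s} → s < k → s ≢ i → α s ≡ false
open IsTwinA

allBelow-complete : ∀ k {p : ℕ → Bool} → (∀ {i} → i < k → p i ≡ true) → allBelow k p ≡ true
allBelow-complete zero    ps = refl
allBelow-complete (suc k) ps rewrite ps (n<1+n k) = allBelow-complete k λ i<k → ps (m<n⇒m<1+n i<k)

-- The pattern is tested by a Boolean because primality speaks of sets given by characteristic
-- functions.
twinAᵇ : ℕ → ℕ → (ℕ → Bool) → (ℕ → Bool) → Bool
twinAᵇ k i α β = allBelow k λ s →
  (if s <ᵇ i then not (β s) else β s) ∧ (if s ≡ᵇ i then true else not (α s))

twinAᵇ-sound : ∀ {k i α β} → i < k → twinAᵇ k i α β ≡ true → IsTwinA k i α β
twinAᵇ-sound {k} {i} {α} {β} i<k eq = record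
  { β-below = λ {s} s<i → below s<i (∧-conicalˡ _ _ (at (<-trans s<i i<k)))
  ; β-above = λ {s} s<k i≤s → above i≤s (∧-conicalˡ _ _ (at s<k))
  ; α-off   = λ {s} s<k s≢i → off s≢i (∧-conicalʳ (if s <ᵇ i then not (β s) else β s) _ (at s<k)) }
  where
  at : ∀ {s} → s < k → ((if s <ᵇ i then not (β s) else β s) ∧ (if s ≡ᵇ i then true else not (α s))) ≡ true
  at = allBelow-sound k eq
  below : ∀ {s} → s < i → (if s <ᵇ i then not (β s) else β s) ≡ true → β s ≡ false
  below s<i p rewrite <ᵇ-true s<i = not-true p
  above : ∀ {s} → i ≤ s → (if s <ᵇ i then not (β s) else β s) ≡ true → β s ≡ true
  above {s} i≤s p rewrite <ᵇ-false {s} {i} i≤s = p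
  off : ∀ {s} → s ≢ i → (if s ≡ᵇ i then true else not (α s)) ≡ true → α s ≡ false
  off {s} s≢i p with s ≡ᵇ i in eq
  ... | true  = contradiction (≡ᵇ-sound s i eq) s≢i
  ... | false = not-true p

twinAᵇ-complete : ∀ {k i α β} → IsTwinA k i α β → twinAᵇ k i α β ≡ true
twinAᵇ-complete {k} {i} {α} {β} tw = allBelow-complete k λ {s} s<k → cong₂ _∧_ (first s<k) (second s<k)
  where
  first : ∀ {s} → s < k → (if s <ᵇ i then not (β s) else β s) ≡ true
  first {s} s<k with s <ᵇ i in eq
  ... | true  = cong not (β-below tw (<ᵇ-sound s i eq))
  ... | false = β-above tw s<k (≮⇒≥ λ s<i → true≢false (<ᵇ-true s<i) eq)
  second : ∀ {s} → s < k → (if s ≡ᵇ i then true else not (α s)) ≡ true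
  second {s} s<k with s ≡ᵇ i in eq
  ... | true  = refl
  ... | false = cong not (α-off tw s<k λ { refl → true≢false (≡ᵇ-refl s) eq })

Form-cong : ∀ {k α β β′} → (∀ s → β s ≡ β′ s) → Form k α β → Form k α β′
Form-cong eq (const c a b)     = const c a (λ s<k → trans (sym (eq _)) (b s<k))
Form-cong eq (twinA t<k a b c) = twinA t<k a (λ s<t → trans (sym (eq _)) (b s<t))
    (λ s<k t≤s → trans (sym (eq _)) (c s<k t≤s))
Form-cong eq (twinB t<k b a c) = twinB t<k (λ s<k s≢t → trans (sym (eq _)) (b s<k s≢t)) a c

-- Apart from the adjacency to aᵢ, this is the pattern of an additional b placed directly after aᵢ.
record Separates (k i : ℕ) (α β : ℕ → Bool) : Set where
  field
    α-below : ∀ {s} → s < i → α s ≡ true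
    α-above : ∀ {s} → s < k → i < s → α s ≡ false
    β-none  : ∀ {s} → s < k → β s ≡ false
open Separates

-- a b is the pattern of a vertex z separating two twins x and y of aᵢ, ax and ay are its patterns after
-- replacing aᵢ by x and by y.
separator-form : ∀ {k i} → 3 ≤ k → i < k → ∀ {a ax ay b : ℕ → Bool} →
  (∀ {s} → s ≢ i → ax s ≡ a s) → (∀ {s} → s ≢ i → ay s ≡ a s) → ax i ≡ true → ay i ≡ false →
  ¬ IsTwinA k i a b → Form k ax b → Form k ay b →
  Separates k i a b
separator-form {k} {i} 3≤k i<k {a} {ax} {ay} {b} x≡ y≡ xi yi ¬twin = go
  where
  0<k = <-≤-trans (s≤s z≤n) 3≤k
  clash : ∀ {s} → s ≢ i → ax s ≡ true → ay s ≢ false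
  clash s≢i p q = true≢false p (trans (x≡ s≢i) (trans (sym (y≡ s≢i)) q))
  go : Form k ax b → Form k ay b → Separates k i a b
  go (const false ax≡ _) _ = contradiction (ax≡ i<k) (true≢false xi)
  go (const true ax≡ b≡) (const true ay≡ _) = contradiction yi (true≢false (ay≡ i<k))
  go (const true ax≡ b≡) (const false _ b≡′) = contradiction (b≡′ 0<k) (true≢false (b≡ 0<k))
  go (const true ax≡ b≡) (twinA {t} _ ay≡ _ _) =
    let s , s<k , s≢i , s≢t = third 3≤k i t in contradiction (ay≡ s<k s≢t) (clash s≢i (ax≡ s<k))
  go (const true ax≡ b≡) (twinB {t} _ b≡′ _ _) =
    let s , s<k , s≢i , s≢t = third 3≤k i t in contradiction (b≡′ s<k s≢t) (true≢false (b≡ s<k))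
  go (twinA {t} _ ax≡ b< b≥) _ with i ≟ t
  ... | no i≢t   = contradiction (ax≡ i<k i≢t) (true≢false xi)
  ... | yes refl = ⊥-elim (¬twin record
    { β-below = b< ; β-above = b≥ ; α-off = λ s<k s≢i → trans (sym (x≡ s≢i)) (ax≡ s<k s≢i) })
  go (twinB _ _ _ _) (const true ay≡ _) = contradiction yi (true≢false (ay≡ i<k))
  -- Any `s < i` would clash, so this happens only for `i = 0`.
  go (twinB {t} t<k b≡ ax≤ ax>) (const false ay≡ b≡′) =
    record
    { α-below = λ {s} s<i → contradiction (ay≡ (<-trans s<i i<k)) (clash (<⇒≢ s<i) (ax≤ (≤-trans (<⇒≤ s<i) i≤t)))
    ; α-above = λ s<k i<s → trans (sym (y≡ (≢-sym (<⇒≢ i<s)))) (ay≡ s<k)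
    ; β-none  = b≡′ }
    where
    i≤t : i ≤ t
    i≤t = ≮⇒≥ λ t<i → true≢false xi (ax> i<k t<i)
  go (twinB {t} t<k b≡ ax≤ ax>) (twinA {u} u<k ay≡ b< b≥) =
    let s , s<k , s≢i , s≢t = third 3≤k i t in
    ⊥-elim (case <-cmp s t of λ where
      (tri< s<t _ _) → clash s≢i (ax≤ (<⇒≤ s<t)) (ay≡ s<k λ { refl → true≢false (b≥ s<k ≤-refl) (b≡ s<k s≢t) })
      (tri≈ _ s≡t _) → s≢t s≡t
      (tri> _ _ t<s) → case u ≤? s of λ where
        (yes u≤s) → true≢false (b≥ s<k u≤s) (b≡ s<k s≢t)
        (no u≰s)  → true≢false (b≥ u<k ≤-refl) (b≡ u<k λ { refl → u≰s (<⇒≤ t<s) }))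
  -- The value at `i` forces `u < i ≤ t`. For `t ≢ i` the two patterns would differ at `t`, although
  -- they may differ only at `i`.
  go (twinB {t} t<k b≡ ax≤ ax>) (twinB {u} u<k b≡′ ay≤ ay>) =
    record
    { α-below = λ s<i → trans (sym (x≡ (<⇒≢ s<i))) (ax≤ (≤-trans (<⇒≤ s<i) (≤-reflexive (sym t≡i))))
    ; α-above = λ s<k i<s → trans (sym (x≡ (≢-sym (<⇒≢ i<s)))) (ax> s<k (subst (_< _) (sym t≡i) i<s))
    ; β-none  = b-false }
    where
    i≤t : i ≤ t
    i≤t = ≮⇒≥ λ t<i → true≢false xi (ax> i<k t<i)
    u<i : u < i
    u<i = ≰⇒> λ i≤u → true≢false (ay≤ i≤u) yi
    t≡i : t ≡ i
    t≡i with t ≟ i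
    ... | yes eq = eq
    ... | no t≢i = contradiction (ay> t<k (<-≤-trans u<i i≤t)) (clash t≢i (ax≤ ≤-refl))
    b-false : ∀ {s} → s < k → b s ≡ false
    b-false {s} s<k with s ≟ t
    ... | no s≢t   = b≡ s<k s≢t
    ... | yes refl = b≡′ s<k (≢-sym (<⇒≢ (<-≤-trans u<i i≤t)))

-- Here bᵢ has been replaced by the separator z of the twins x and y of aᵢ, and aᵢ by x.
twins-apart : ∀ {k i} → 3 ≤ k → i < k → ∀ {a b : ℕ → Bool} →
  (∀ {s} → s < k → s ≢ i → a s ≡ false) → (∀ {s} → s < k → i < s → b s ≡ true) → b i ≡ false →
  Form k a b → a i ≡ false
twins-apart {k} {i} 3≤k i<k {a} {b} a≡ b> bi f = ¬-not λ ai → go ai f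
  where
  go : a i ≡ true → ¬ Form k a b
  go ai (const false a≡′ _) = true≢false ai (a≡′ i<k)
  go ai (const true _ b≡) = true≢false (b≡ i<k) bi
  go ai (twinA {t} t<k a≡′ _ b≥) with i ≟ t
  ... | no i≢t   = true≢false ai (a≡′ i<k i≢t)
  ... | yes refl = true≢false (b≥ i<k ≤-refl) bi
  -- A twin of bₜ is impossible: for `t ≢ i` the edge to aₜ is missing, for `t = i > 0` the edge to
  -- a₀ is missing, and for `t = i = 0` there is an edge to b₁.
  go ai (twinB {t} t<k b≡ a≤ a>) with i ≟ t
  ... | no i≢t = true≢false (a≤ ≤-refl) (a≡ t<k (≢-sym i≢t))
  ... | yes refl with 0 ≟ i
  ...   | no 0≢i  = true≢false (a≤ {0} z≤n) (a≡ (<-≤-trans (s≤s z≤n) 3≤k) 0≢i)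
  ...   | yes 0≡i = true≢false (b> {1} 1<k (subst (_< 1) 0≡i (s≤s z≤n)))
                               (b≡ 1<k λ 1≡i → case trans 0≡i (sym 1≡i) of λ ())
    where
    1<k = <-≤-trans (s≤s (s≤s z≤n)) 3≤k

even-+ : ∀ m j → even (m + j) ≡ (even m == even j)
even-+ zero    j = refl
even-+ (suc m) j = trans (cong not (even-+ m j)) (not-== (even m) (even j))
  where
  not-== : ∀ a b → not (a == b) ≡ (not a == b)
  not-== true  b = refl
  not-== false b = not-involutive b

even-∸ : ∀ {l j} → even l ≡ false → j ≤ l → even (l ∸ j) ≡ not (even j)
even-∸ {l} {j} odd j≤l = differ (even (l ∸ j)) (even j)
  (trans (sym (even-+ (l ∸ j) j)) (trans (cong even (m∸n+n≡m j≤l)) odd))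
  where
  differ : ∀ a b → (a == b) ≡ false → a ≡ not b
  differ true  false _ = refl
  differ false true  _ = refl

-- In a largest half graph no outer vertex is a twin of some aᵢ, since a vertex separating two such
-- twins leads to a larger one. Twins of the b's are reached by reversing the sequence, which
-- exchanges the a's and the b's.
module HalfGrowth {n} (bs : All (Bad base n) known₂) {A : Adjacency n} (g : Good base A) {k} (3≤k : 3 ≤ k)
                  (longer : ∀ c → ¬ Realises A (half (suc k)) c) where

  open Half bs g 3≤k

  module _ {c : ℕ → Fin n} (r : Realises A H c) where

    twinA-position : ∀ {i x} → IsTwinA k i (αs c x) (βs c x) → Twin A H c (i + i) x
    twinA-position {i} tw {j} j<k j≢ with parity j
    ... | ev s = trans (α-off tw (half-< {s} j<k) λ { refl → j≢ refl }) (sym (edge′-AA k i s))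
    ... | od s with <-cmp s i
    ...   | tri< s<i _ _  = trans (β-below tw s<i) (sym (edge′-AB> k s<i))
    ...   | tri≈ _ refl _ = trans (β-above tw (half-< {s} (<-trans (n<1+n _) j<k)) ≤-refl)
        (sym (edge′-AB k {s} ≤-refl))
    ...   | tri> _ _ i<s  = trans (β-above tw (half-< {s} (<-trans (n<1+n _) j<k)) (<⇒≤ i<s))
        (sym (edge′-AB k (<⇒≤ i<s)))

    twinA-self : ∀ {i} → i < k → IsTwinA k i (αs c (c (i + i))) (βs c (c (i + i)))
    twinA-self {i} i<k = record
      { β-below = λ {s} s<i → trans (realises′ (symmetric g) r (A< i<k) (B< (<-trans s<i i<k)) (A≢B i s)) (edge′-AB> k s<i)
      ; β-above = λ {s} s<k i≤s → trans (realises′ (symmetric g) r (A< i<k) (B< s<k) (A≢B i s)) (edge′-AB k i≤s)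
      ; α-off   = λ {s} s<k s≢i → trans (realises′ (symmetric g) r (A< i<k) (A< s<k) (λ eq → s≢i (sym (A-injective eq)))) (edge′-AA k i s) }

    module _ {i} (i<k : i < k) {v} (v≢ : v ≢ c (i + i)) (tw : IsTwinA k i (αs c v) (βs c v)) where

      M : Fin n → Bool
      M x = twinAᵇ k i (αs c x) (βs c x)

      outsider : ∃ λ o → M o ≡ false
      outsider with third 3≤k i i
      ... | s , s<k , s≢i , _ = c (s + s) , ¬-not λ Ms → absurd (twinAᵇ-sound i<k Ms)
        where
        absurd : ¬ IsTwinA k i (αs c (c (s + s))) (βs c (c (s + s)))
        absurd tw′ with <-cmp s i
        ... | tri< s<i _ _ = true≢false (β-above (twinA-self s<k) s<k ≤-refl) (β-below tw′ s<i)
        ... | tri≈ _ s≡i _ = s≢i s≡i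
        ... | tri> _ _ i<s = true≢false (β-above tw′ i<k ≤-refl) (β-below (twinA-self s<k) i<s)

      module Grow {x y z} (Mx : M x ≡ true) (My : M y ≡ true) (Mz : M z ≡ false)
                  (zx : A z x ≡ true) (zy : A z y ≡ false) where

        p : ℕ
        p = i + i
        cx cy : ℕ → Fin n
        cx = update p x c
        cy = update p y c
        twx = twinAᵇ-sound i<k Mx
        twy = twinAᵇ-sound i<k My
        rx : Realises A H cx
        rx = realises-update g r (A< i<k) (twinA-position twx)
        ry : Realises A H cy
        ry = realises-update g r (A< i<k) (twinA-position twy)

        off-A : ∀ {w s} → s ≢ i → update p w c (s + s) ≡ c (s + s)
        off-A s≢i = update-off λ eq → s≢i (A-injective eq)
        off-B : ∀ {w} s → update p w c (suc (s + s)) ≡ c (suc (s + s))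
        off-B s = update-off λ eq → A≢B i s (sym eq)

        separates : Separates k i (αs c z) (βs c z)
        separates = separator-form 3≤k i<k
          (λ s≢i → cong (A z) (off-A s≢i)) (λ s≢i → cong (A z) (off-A s≢i))
          (trans (cong (A z) (update-at p x c)) zx) (trans (cong (A z) (update-at p y c)) zy)
          (λ tw-z → true≢false (twinAᵇ-complete tw-z) Mz)
          (Form-cong (λ s → cong (A z) (off-B s)) (form rx z)) (Form-cong (λ s → cong (A z) (off-B s)) (form ry z))

        z-left : ∀ {j} → j ≤ p → A (cx j) z ≡ even j
        z-left {j} j≤p with parity j
        ... | ev s = trans (trans (symmetric g _ _) ev-case) (sym (even-double s))
          where
          ev-case : A z (cx (s + s)) ≡ true
          ev-case with s ≟ i
          ... | yes refl = trans (cong (A z) (update-at p x c)) zx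
          ... | no s≢i   = trans (cong (A z) (off-A s≢i))
            (α-below separates (≤∧≢⇒< (≮⇒≥ λ i<s → <⇒≱ (+-mono-< i<s i<s) j≤p) s≢i))
        ... | od s = trans (trans (symmetric g _ _) (trans (cong (A z) (off-B s))
            (β-none separates (<-trans (half-< {s} {i} j≤p) i<k)))) (sym (cong not (even-double s)))

        z-right : ∀ {j} → p ≤ j → j < k + k → A z (cy j) ≡ false
        z-right {j} p≤j j<k with parity j
        ... | od s = trans (cong (A z) (off-B s)) (β-none separates (half-< {s} (<-trans (n<1+n _) j<k)))
        ... | ev s with s ≟ i
        ...   | yes refl = trans (cong (A z) (update-at p y c)) zy
        ...   | no s≢i   = trans (cong (A z) (off-A s≢i))
          (α-above separates (half-< {s} j<k) (≤∧≢⇒< (≮⇒≥ λ s<i → <⇒≱ (+-mono-< s<i s<i) p≤j) (≢-sym s≢i)))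

        z-position : Twin A H cx (suc p) z
        z-position {j} j<k j≢ with <-cmp j (suc p)
        ... | tri< (s≤s j≤p) _ _ = trans (symmetric g _ _) (trans (z-left j≤p)
          (sym (trans (edge′-> H {suc p} (s≤s j≤p)) (trans (cong (even j ∧_) (trans (not-involutive _)
              (even-double i))) (∧-identityʳ _)))))
        ... | tri≈ _ j≡ _ = contradiction j≡ j≢
        ... | tri> _ _ p<j = trans (cong (A z) (trans (update-off j≢p) (sym (update-off j≢p))))
          (trans (z-right (≤-trans (n≤1+n p) (<⇒≤ p<j)) j<k)
            (sym (trans (edge′-< H {suc p} p<j) (cong (λ b → not b ∧ not (even j)) (even-double i)))))
          where
          j≢p : j ≢ p
          j≢p = ≢-sym (<⇒≢ (<-trans (n<1+n p) p<j))

        -- `z` can replace bᵢ once `x` stands for aᵢ. With respect to that half graph `y` sees every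
        -- later b but not `z`, and of the other a's none; no form allows this together with an edge
        -- from `y` to `x`.
        apart : A x y ≡ false
        apart = trans (symmetric g x y) (trans (sym (cong (A y) at-x)) (twins-apart 3≤k i<k
          (λ {s} s<k s≢i → trans (cong (A y) (trans (update-off (A≢B s i)) (off-A s≢i))) (α-off twy s<k s≢i))
          (λ {s} s<k i<s → trans (cong (A y) (trans (update-off λ eq → <⇒≢ (+-mono-< i<s i<s) (sym (suc-injective eq))) (off-B s)))
                                 (β-above twy s<k (<⇒≤ i<s)))
          (trans (cong (A y) (update-at (suc p) z cx)) (trans (symmetric g y z) zy))
          (form (realises-update g rx (B< i<k) z-position) y)))
          where
          at-x : update (suc p) z cx p ≡ x
          at-x = trans (update-off (<⇒≢ (n<1+n p))) (update-at p x c)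

        cross : ∀ {s t} → s ≤ p → p ≤ t → s < k + k → t < k + k → A (cx s) (cy t) ≡ even s ∧ not (even t)
        cross {s} {t} s≤p p≤t s<k t<k with m≤n⇒m<n∨m≡n s≤p
        ... | inj₁ s<p = trans (cong (λ u → A u (cy t)) (trans (update-off (<⇒≢ s<p)) (sym (update-off (<⇒≢ s<p)))))
                               (ry (<-≤-trans s<p p≤t) t<k)
        ... | inj₂ refl with m≤n⇒m<n∨m≡n p≤t
        ...   | inj₁ p<t  = trans (cong (A (cx p)) (trans (update-off (≢-sym (<⇒≢ p<t))) (sym (update-off (≢-sym
            (<⇒≢ p<t))))))
                                  (rx p<t t<k)
        ...   | inj₂ refl = trans (cong₂ A (update-at p x c) (update-at p y c)) (trans apart (sym at-p))
          where
          at-p : (even p ∧ not (even p)) ≡ false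
          at-p rewrite even-double i = refl

        -- In the longer sequence aᵢ is replaced by x, z, y: `x` is the new aᵢ, `z` the new bᵢ, `y`
        -- the new aᵢ₊₁, and the old bᵢ becomes bᵢ₊₁.
        grown : Realises A (half (suc k)) (insert (suc p) z cx cy)
        grown {s} {t} s<t t<k with <-cmp s (suc p) | <-cmp t (suc p)
        ... | tri< _ _ _          | tri< (s≤s t≤p) _ _ = rx s<t (≤-<-trans t≤p (A< i<k))
        ... | tri< (s≤s s≤p) _ _  | tri≈ _ refl _ = trans (z-left s≤p)
          (sym (trans (cong (even s ∧_) (trans (not-involutive _) (even-double i))) (∧-identityʳ _)))
        ... | tri< (s≤s s≤p) _ _  | tri> _ _ p<t = trans
          (cross s≤p (∸-monoˡ-≤ 2 p<t) (≤-<-trans s≤p (A< i<k)) (shorter p<t t<k))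
          (cong (λ b → even s ∧ not b) (even-∸2 (≤-trans (s≤s (s≤s z≤n)) p<t)))
        ... | tri≈ _ refl _       | tri> _ _ p<t = trans (z-right (∸-monoˡ-≤ 2 p<t) (shorter p<t t<k))
          (sym (cong (λ b → not b ∧ not (even t)) (even-double i)))
        ... | tri> _ _ p<s        | tri> _ _ p<t = trans
          (ry (∸-monoˡ-< s<t (≤-trans (s≤s (s≤s z≤n)) p<s)) (shorter p<t t<k))
          (cong₂ (λ a b → a ∧ not b) (even-∸2 (≤-trans (s≤s (s≤s z≤n)) p<s)) (even-∸2 (≤-trans (s≤s (s≤s z≤n)) p<t)))
        ... | tri≈ _ refl _       | tri< t<p _ _  = contradiction s<t (<-asym t<p)
        ... | tri≈ _ refl _       | tri≈ _ refl _ = contradiction s<t (<-irrefl refl)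
        ... | tri> _ _ p<s        | tri< t<p _ _  = contradiction s<t (<-asym (<-trans t<p p<s))
        ... | tri> _ _ p<s        | tri≈ _ refl _ = contradiction s<t (<-asym p<s)

      no-twinA : ⊥
      no-twinA with prime g M v≢ (twinAᵇ-complete tw) (twinAᵇ-complete (twinA-self i<k)) (proj₂ outsider)
      ... | x , y , z , Mx , My , Mz , zx , zy = longer _ (Grow.grown Mx My Mz zx zy)

half-apart : ∀ {Qs n k} {A : Adjacency n} {c} → 3 ≤ k → Good Qs A → Realises A (half k) c →
             ∀ {i j} → i < j → j < k + k → c i ≢ c j
half-apart {k = k} {A} {c} 3≤k g r {i} {j} i<j j<k = apart (parity i) (parity j) i<j j<k
  where
  r′ : ∀ {i j} → i < k + k → j < k + k → i ≢ j → A (c i) (c j) ≡ edge′ (half k) i j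
  r′ = realises′ (symmetric g) r
  differ : ∀ {i j w} → i < k + k → j < k + k → w < k + k → i ≢ w → j ≢ w →
           edge′ (half k) i w ≡ true → edge′ (half k) j w ≡ false → c i ≢ c j
  differ {w = w} i<k j<k w<k i≢w j≢w e f eq =
    true≢false (trans (cong (λ x → A x (c w)) (sym eq)) (trans (r′ i<k w<k i≢w) e)) (trans (r′ j<k w<k j≢w) f)
  odd-< : ∀ {s} → suc (s + s) < k + k → s < k
  odd-< {s} lt = half-< {s} (<-trans (n<1+n _) lt)
  mixed : ∀ s t → s + s < k + k → suc (t + t) < k + k → c (s + s) ≢ c (suc (t + t))
  mixed s t s<k t<k with third 3≤k t t | 0 ≟ s
  ... | u , u<k , u≢t , _ | yes refl = differ s<k t<k (B< u<k) (A≢B 0 u)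
      (λ eq → u≢t (sym (A-injective {t} {u} (suc-injective eq))))
    (edge′-AB k {0} {u} z≤n) (edge′-BB k t u)
  ... | _ | no 0≢s = ≢-sym (differ t<k s<k 0<k+k (λ ()) (λ eq → 0≢s (sym (A-injective {s} {0} eq)))
    (trans (edge′-sym (half k) {suc (t + t)} {0} λ ()) (edge′-AB k {0} {t} z≤n)) (edge′-AA k s 0))
    where
    0<k+k : 0 < k + k
    0<k+k = ≤-<-trans z≤n s<k
  apart : ∀ {i j} → Parity i → Parity j → i < j → j < k + k → c i ≢ c j
  apart (ev s) (ev t) i<j j<k = differ {w = suc (s + s)} (<-trans i<j j<k) j<k
      (B< {s} {k} (half-< {s} (<-trans i<j j<k))) (A≢B s s) (A≢B t s)
    (edge′-AB k {s} ≤-refl) (edge′-AB> k {t} {s} (half-< i<j))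
  apart (od s) (od t) i<j j<k = ≢-sym (differ {w = t + t} j<k (<-trans i<j j<k) (A< t<k) (≢-sym (A≢B t t)) (≢-sym
      (A≢B t s))
    (trans (edge′-sym (half k) (≢-sym (A≢B t t))) (edge′-AB k {t} ≤-refl))
    (trans (edge′-sym (half k) (≢-sym (A≢B t s))) (edge′-AB> k {t} {s} (half-< (≤-pred i<j)))))
    where
    t<k = odd-< {t} j<k
  apart (ev s) (od t) i<j j<k = mixed s t (<-trans i<j j<k) j<k
  apart (od s) (ev t) i<j j<k = ≢-sym (mixed t s j<k (<-trans i<j j<k))

half-injective : ∀ {Qs n k} {A : Adjacency n} {c} → 3 ≤ k → Good Qs A → Realises A (half k) c →
                 ∀ {i j} → i < k + k → j < k + k → c i ≡ c j → i ≡ j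
half-injective 3≤k g r {i} {j} i<k j<k eq with <-cmp i j
... | tri< i<j _ _ = contradiction eq (half-apart 3≤k g r i<j j<k)
... | tri≈ _ i≡j _ = i≡j
... | tri> _ _ j<i = contradiction (sym eq) (half-apart 3≤k g r j<i i<k)

-- The last position is odd, so the reversal exchanges even and odd positions, that is, the a's and
-- the b's.
half-reversal : ∀ {Qs n k} {A : Adjacency n} {c} → Good Qs A →
                Realises A (half (suc k)) c → Realises A (half (suc k)) (c ∘ ((k + suc k) ∸_))
half-reversal {k = k} g r {i} {j} i<j (s≤s j≤l) = trans (symmetric g _ _)
  (trans (r (∸-monoʳ-< i<j j≤l) (s≤s (m∸n≤m (k + suc k) i)))
    (trans (cong₂ (λ a b → a ∧ not b) (even-∸ odd j≤l) (even-∸ odd (≤-trans (<⇒≤ i<j) j≤l)))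
      (trans (cong (not (even j) ∧_) (not-involutive (even i))) (∧-comm (not (even j)) (even i)))))
  where
  odd : even (k + suc k) ≡ false
  odd = trans (cong even (+-suc k k)) (cong not (even-double k))

-- Downward induction as for paths. The forms of an outer vertex with respect to the sequence and to
-- its reversal are compared: a twin of an a in either yields a larger half graph, a constant form
-- in either gives the claim, and a twin of a b in both is contradictory.
half-bad : ∀ {n} → All (Bad base n) known₂ → ∀ fuel {k} → 3 ≤ k → n < k + fuel → Bad base n (half k)
half-bad bs zero {k} 3≤k n<k A g c r = <-irrefl refl (<-≤-trans n<k
  (subst (_≤ _) (sym (+-identityʳ k)) (≤-trans (m≤m+n k k) (injective-on-<⇒≤ c (half-injective 3≤k g r)))))
half-bad {n} bs (suc fuel) {suc k} 3≤k n<k A g c r = contradiction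
  (rigid-extension g (suc k + suc k) c (l ∸_) (half-injective 3≤k g r) (λ {i} _ → s≤s (m∸n≤m l i))
    (λ { (s≤s i≤l) → m∸[m∸n]≡n i≤l })
    (λ i<k j<k i≢j → trans (realises′ (symmetric g) r⁻ i<k j<k i≢j) (sym (realises′ (symmetric g) r i<k j<k i≢j)))
    outer {0} (s≤s z≤n))
  λ eq → 1+n≢0 (trans (sym (+-suc k k)) eq)
  where
  l = k + suc k
  r⁻ = half-reversal {k = k} g r
  longer : ∀ c → ¬ Realises A (half (suc (suc k))) c
  longer = half-bad bs fuel (m≤n⇒m≤1+n 3≤k) (subst (n <_) (+-suc (suc k) fuel) n<k) A g
  open HalfGrowth bs g 3≤k longer
  open Half bs g 3≤k
  l≡ : l ≡ suc (k + k)
  l≡ = +-suc k k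
  outer : ∀ v → (∀ {i} → i < suc l → v ≢ c i) → ∀ {i} → i < suc l → A v (c (l ∸ i)) ≡ A v (c i)
  outer v v∉ = from-forms (form r v) (form r⁻ v)
    where
    from-forms : Form (suc k) (αs c v) (βs c v) → Form (suc k) (αs (c ∘ (l ∸_)) v) (βs (c ∘ (l ∸_)) v) →
                 ∀ {i} → i < suc l → A v (c (l ∸ i)) ≡ A v (c i)
    from-forms (const b α≡ β≡) _ {i} i<l = trans (all (s≤s (m∸n≤m l i))) (sym (all i<l))
      where
      all : ∀ {j} → j < suc l → A v (c j) ≡ b
      all {j} j<l with parity j
      ... | ev s = α≡ (half-< {s} j<l)
      ... | od s = β≡ (half-< {s} (<-trans (n<1+n _) j<l))
    from-forms (twinA t<k α≡ β< β≥) _ = ⊥-elim (no-twinA r t<k (v∉ (A< t<k)) record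
        { β-below = β< ; β-above = β≥ ; α-off = α≡ })
    from-forms (twinB _ _ _ _) (twinA {t} t<k α≡ β< β≥) = ⊥-elim
      (no-twinA r⁻ t<k (v∉ (s≤s (m∸n≤m l (t + t)))) record { β-below = β< ; β-above = β≥ ; α-off = α≡ })
    from-forms (twinB _ _ _ _) (const b α≡ β≡) {i} i<l = trans (all i<l)
        (sym (trans (cong (A v ∘ c) (sym (m∸[m∸n]≡n (≤-pred i<l)))) (all (s≤s (m∸n≤m l i)))))
      where
      all : ∀ {j} → j < suc l → A v (c (l ∸ j)) ≡ b
      all {j} j<l with parity j
      ... | ev s = α≡ (half-< {s} j<l)
      ... | od s = β≡ (half-< {s} (<-trans (n<1+n _) j<l))
    -- The last b is the first a of the reversal, so `v` sees it and `t ≡ k`; likewise `u ≡ k`. Then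
    -- `v` sees `c 1`, the last a of the reversal, although `c 1` is b₀ and `t` is not 0.
    from-forms (twinB {t} _ β≡ α≤ _) (twinB {u} _ β≡⁻ α≤⁻ _) = ⊥-elim (true≢false
      (trans (cong (A v ∘ c) (sym (trans (cong (_∸ (k + k)) l≡) (m+n∸n≡m 1 (k + k)))))
          (α≤⁻ {k} (≤-reflexive (sym u≡k))))
      (β≡ {0} (s≤s z≤n) λ 0≡t → 1+n≢0 {k ∸ 1} (trans (m+[n∸m]≡n {1} {k} (≤-trans (s≤s z≤n) (≤-pred 3≤k))) (trans
          (sym t≡k) (sym 0≡t)))))
      where
      t≡k : t ≡ k
      t≡k with t ≟ k
      ... | yes eq = eq
      ... | no t≢k = contradiction (β≡ {k} ≤-refl (≢-sym t≢k))
          (true≢false (trans (cong (A v ∘ c) (sym l≡)) (α≤⁻ {0} z≤n)))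
      u≡k : u ≡ k
      u≡k with u ≟ k
      ... | yes eq = eq
      ... | no u≢k = contradiction (β≡⁻ {k} ≤-refl (≢-sym u≢k))
        (true≢false (trans (cong (A v ∘ c) (trans (cong (l ∸_) (sym l≡)) (n∸n≡0 l))) (α≤ {0} z≤n)))

-- P₄-free graphs

onℕ : ∀ {k} {X : Set} → X → (Fin k → X) → ℕ → X
onℕ {k} x f i with i <? k
... | yes i<k = f (fromℕ< i<k)
... | no _    = x

onℕ-toℕ : ∀ {k} {X : Set} (x : X) (f : Fin k → X) i → onℕ x f (toℕ i) ≡ f i
onℕ-toℕ {k} x f i with toℕ i <? k
... | yes i<k = cong f (Fin.fromℕ<-toℕ i i<k)
... | no i≮k  = contradiction (Fin.toℕ<n i) i≮k

-- With `colour` false the graph is disconnected, with `colour` true its complement is. That one of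
-- the two holds for P₄-free graphs is a theorem of Seinsche.
record Cut {n} (A : Adjacency n) (v : ℕ → Fin n) (m : ℕ) : Set where
  field
    side     : ℕ → Bool
    colour   : Bool
    {i j}    : ℕ
    i<m      : i < m
    j<m      : j < m
    side-i   : side i ≡ true
    side-j   : side j ≡ false
    coloured : ∀ {s t} → s < m → t < m → side s ≡ true → side t ≡ false → A (v s) (v t) ≡ colour

four : {X : Set} → X → X → X → X → ℕ → X
four a b c d 0 = a
four a b c d 1 = b
four a b c d 2 = c
four a b c d _ = d

module _ {n} {A : Adjacency n} (A-sym : ∀ x y → A x y ≡ A y x) (no-P₄ : ∀ e → ¬ Realises A (path 4) e) where

  no-path : ∀ {a b c d} → A a b ≡ true → A b c ≡ true → A c d ≡ true →
            A a c ≡ false → A a d ≡ false → A b d ≡ false → ⊥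
  no-path {a} {b} {c} {d} ab bc cd ac ad bd = no-P₄ (four a b c d) λ
    { {0} {1} _ _ → ab
    ; {0} {2} _ _ → ac
    ; {0} {3} _ _ → ad
    ; {1} {2} _ _ → bc
    ; {1} {3} _ _ → bd
    ; {2} {3} _ _ → cd
    ; {_} {suc (suc (suc (suc _)))} _ (s≤s (s≤s (s≤s (s≤s ()))))
    ; {suc _} {suc zero} (s≤s ()) _
    ; {suc (suc _)} {suc (suc zero)} (s≤s (s≤s ())) _
    ; {suc (suc (suc _))} {suc (suc (suc zero))} (s≤s (s≤s (s≤s ()))) _ }

  -- P₄ is self-complementary.
  no-coloured-path : ∀ c {q p x b} → A q p ≡ not c → A p x ≡ not c → A x b ≡ not c →
                     A q x ≡ c → A q b ≡ c → A p b ≡ c → ⊥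
  no-coloured-path false qp px xb qx qb pb = no-path qp px xb qx qb pb
  no-coloured-path true  qp px xb qx qb pb =
    no-path (trans (A-sym _ _) qx) qb (trans (A-sym _ _) pb) xb (trans (A-sym _ _) px) qp

  flip : ∀ {v m} → Cut A v m → Cut A v m
  flip cut = record
    { side = not ∘ side ; colour = colour ; i<m = j<m ; j<m = i<m
    ; side-i = cong not side-j ; side-j = cong not side-i
    ; coloured = λ s<m t<m ps pt → trans (A-sym _ _)
        (coloured t<m s<m (trans (sym (not-involutive _)) (cong not pt))
            (trans (sym (not-involutive _)) (cong not ps))) }
    where open Cut cut

  cut : ∀ (v : ℕ → Fin n) m → Cut A v (suc (suc m))
  cut v zero = record
    { side = λ { zero → true ; (suc _) → false } ; colour = A (v 0) (v 1)
    ; i<m = s≤s z≤n ; j<m = s≤s (s≤s z≤n) ; side-i = refl ; side-j = refl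
    ; coloured = λ { {zero} {suc zero} _ _ _ _ → refl
                   ; {zero} {suc (suc _)} _ (s≤s (s≤s ())) _ _ ; {suc _} _ _ () _ ; {zero} {zero} _ _ _ () } }
  cut v (suc m) = add (cut v m)
    where
    k = suc (suc m)
    x = v k
    below : ∀ {s} → s < suc k → s ≢ k → s < k
    below (s≤s s≤k) s≢k = ≤∧≢⇒< s≤k s≢k
    set : Bool → (ℕ → Bool) → ℕ → Bool
    set b = update k b

    attach : (C : Cut A v k) → (∀ {s} → s < k → Cut.side C s ≡ true → A x (v s) ≡ Cut.colour C) → Cut A v (suc k)
    attach C all = record
      { side = set false side ; colour = colour ; i<m = m<n⇒m<1+n i<m ; j<m = m<n⇒m<1+n j<m
      ; side-i = trans (update-off (<⇒≢ i<m)) side-i ; side-j = trans (update-off (<⇒≢ j<m)) side-j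
      ; coloured = coloured′ }
      where
      open Cut C
      coloured′ : ∀ {s t} → s < suc k → t < suc k → set false side s ≡ true → set false side t ≡ false → A (v s)
          (v t) ≡ colour
      coloured′ {s} {t} s<k t<k ps pt with s ≟ k | t ≟ k
      ... | no s≢k | yes refl = trans (A-sym _ _) (all (below s<k s≢k) ps)
      ... | no s≢k | no t≢k   = coloured (below s<k s≢k) (below t<k t≢k) ps pt

    isolate : ∀ c → (∀ {s} → s < k → A x (v s) ≡ c) → Cut A v (suc k)
    isolate c all = record
      { side = set true (λ _ → false) ; colour = c ; i<m = n<1+n k ; j<m = s≤s z≤n
      ; side-i = update-at k true _ ; side-j = update-off {p = k} {true} {λ _ → false} {0} (λ ())
      ; coloured = coloured′ }
      where
      coloured′ : ∀ {s t} → s < suc k → t < suc k → set true (λ _ → false) s ≡ true → set true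
          (λ _ → false) t ≡ false → A (v s) (v t) ≡ c
      coloured′ {s} {t} s<k t<k ps pt with s ≟ k | t ≟ k
      ... | yes refl | no t≢k = all (below t<k t≢k)

    module _ (C : Cut A v k) where
      open Cut C

      Neighbour : Bool → Bool → ℕ → Set
      Neighbour b c s = side s ≡ b × A x (v s) ≡ c

      neighbour? : ∀ b c → Dec (∃ λ s → s < k × Neighbour b c s)
      neighbour? b c = anyUpTo? (λ s → (side s ≟ᵇ b) ×-dec (A x (v s) ≟ᵇ c)) k

      -- The new side keeps those vertices of the old side that have the colour of the cut towards
      -- `x`. If such a vertex t and a vertex s of the rest of the old side had the opposite colour
      -- between them, then t, s, x, b would form an induced P₄ in the opposite colour.
      separate : ∀ {q b} → q < k → Neighbour true colour q → b < k → Neighbour false (not colour) b → Cut A v (suc k)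
      separate {q} {b} q<k (side-q , xq) b<k (side-b , xb) with
        anyUpTo? (λ s → anyUpTo? (λ t → ((side s ≟ᵇ true) ×-dec (A x (v s) ≟ᵇ not colour))
          ×-dec ((side t ≟ᵇ true) ×-dec (A x (v t) ≟ᵇ colour)) ×-dec (A (v s) (v t) ≟ᵇ not colour)) k) k
      ... | yes (s , s<k , t , t<k , (side-s , xs) , (side-t , xt) , st) = ⊥-elim (no-coloured-path colour
        (trans (A-sym _ _) st) (trans (A-sym _ _) xs) xb (trans (A-sym _ _) xt)
        (coloured t<k b<k side-t side-b) (coloured s<k b<k side-s side-b))
      ... | no ∄ = record
        { side = set false side′ ; colour = colour ; i<m = m<n⇒m<1+n q<k ; j<m = n<1+n k
        ; side-i = trans (update-off (<⇒≢ q<k)) (cong₂ _∧_ side-q (subst (λ c → (c == colour) ≡ true) (sym xq)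
            (==-refl colour)))
        ; side-j = update-at k false side′ ; coloured = coloured′ }
        where
        side′ : ℕ → Bool
        side′ s = side s ∧ (A x (v s) == colour)
        inner : ∀ s → side′ s ≡ true → side s ≡ true × A x (v s) ≡ colour
        inner s eq = proj₁ (∧-split eq) , ==-sound _ _ (proj₂ (∧-split eq))
        coloured′ : ∀ {s t} → s < suc k → t < suc k → set false side′ s ≡ true → set false side′ t ≡ false → A
            (v s) (v t) ≡ colour
        coloured′ {s} {t} s<k t<k ps pt with s ≟ k | t ≟ k
        ... | no s≢k | yes refl = trans (A-sym _ _) (proj₂ (inner s ps))
        ... | no s≢k | no t≢k with side t in side-t
        ...   | false = coloured (below s<k s≢k) (below t<k t≢k) (proj₁ (inner s ps)) side-t
        ...   | true with A (v s) (v t) ≟ᵇ colour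
        ...     | yes eq = eq
        ...     | no ne  = ⊥-elim (∄ (t , below t<k t≢k , s , below s<k s≢k ,
          (side-t , ¬-not λ eq → not-¬ (trans (sym (trans (cong (_== colour) eq) (==-refl colour))) pt) refl) ,
          inner s ps , trans (A-sym _ _) (¬-not ne)))

    -- If `x` has the colour of the cut towards a whole side, it joins the other side; if it has the
    -- opposite colour towards all vertices, it is a side by itself. Otherwise one side sees both
    -- colours at `x` while the other contains a vertex of the opposite colour, and that first side
    -- can be split.
    add : Cut A v k → Cut A v (suc k)
    add C with neighbour? C true (not (Cut.colour C)) | neighbour? C false (not (Cut.colour C))
    ... | no ∄ | _ = attach C λ {s} s<k ps → trans (¬-not λ eq → ∄ (s , s<k , ps , eq)) (not-involutive _)
    ... | yes _ | no ∄ = attach (flip C) λ {s} s<k ps →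
      trans (¬-not λ eq → ∄ (s , s<k , trans (sym (not-involutive _)) (cong not ps) , eq)) (not-involutive _)
    ... | yes (a , a<k , na) | yes (b , b<k , nb) with neighbour? C true (Cut.colour C) | neighbour? C false (Cut.colour C)
    ...   | yes (q , q<k , nq) | _ = separate C q<k nq b<k nb
    ...   | no _ | yes (q , q<k , (side-q , xq)) =
      separate (flip C) q<k (cong not side-q , xq) a<k (cong not (proj₁ na) , proj₂ na)
    ...   | no ∄₁ | no ∄₂ = isolate (not (Cut.colour C)) λ {s} s<k → all s s<k
      where
      all : ∀ s → s < k → A x (v s) ≡ not (Cut.colour C)
      all s s<k with Cut.side C s in ps
      ... | true  = ¬-not λ eq → ∄₁ (s , s<k , ps , eq)
      ... | false = ¬-not λ eq → ∄₂ (s , s<k , ps , eq)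

-- Exclusion of all good graphs

base-bad : ∀ {n} → All (Bad base n) base
base-bad = All.tabulate λ Q∈ A g e → proj₁ (excluded g Q∈ e)

known₁-bad : ∀ {n} → All (Bad base n) known₁
known₁-bad = nodes-sound base-bad nodes₁ nodes₁-ok

known₂-bad : ∀ {n} → All (Bad base n) known₂
known₂-bad {n} = nodes-sound
  (All.++⁺ known₁-bad (path-bad known₁-bad n ≤-refl (m<n+m n {6} (s≤s z≤n)) ∷ []))
  nodes₂ nodes₂-ok

known₃-bad : ∀ {n} → All (Bad base n) known₃
known₃-bad {n} = All.++⁺ known₂-bad (half-bad known₂-bad n ≤-refl (m<n+m n {3} (s≤s z≤n)) ∷ [])

P₄-bad : ∀ {n} → Bad base n (path 4)
P₄-bad A g e r = node-sound known₃-bad node₃ node₃-ok A g e λ i<j j<4 → trans (r i<j j<4) (same-edges i<j j<4)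
  where
  same-edges : ∀ {i j} → i < j → j < 4 → edge (path 4) i j ≡ edge (table (rows node₃)) i j
  same-edges {i} {j} i<j j<4 = ==-sound _ _ (allBelow-sound j
    (allBelow-sound 4 {λ j → allBelow j λ i → edge (path 4) i j == edge (table (rows node₃)) i j} refl j<4) i<j)

no-good : ∀ {n} (A : Adjacency n) → 2 ≤ n → ¬ Good base A
no-good {suc zero} A (s≤s ()) g
-- All modules of a graph on two vertices are trivial; here the exchange of the vertices contradicts
-- rigidity.
no-good {suc (suc zero)} A _ g = case rigid g swap₂ involutive aut zero of λ ()
  where
  swap₂ : Fin 2 → Fin 2
  swap₂ zero       = suc zero
  swap₂ (suc zero) = zero
  involutive : ∀ x → swap₂ (swap₂ x) ≡ x
  involutive zero       = refl
  involutive (suc zero) = refl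
  aut : ∀ x y → A (swap₂ x) (swap₂ y) ≡ A x y
  aut zero       zero       = diagonal g _ _
  aut zero       (suc zero) = symmetric g _ _
  aut (suc zero) zero       = symmetric g _ _
  aut (suc zero) (suc zero) = diagonal g _ _
no-good {suc (suc (suc n))} A _ g = by-cut (cut (symmetric g) (P₄-bad A g) v (suc n))
  where
  m = suc (suc (suc n))
  v : ℕ → Fin m
  v = onℕ zero id
  pick : ∀ {i} → i < m → ∃ λ x → toℕ {m} x ≡ i
  pick i<m = fromℕ< i<m , Fin.toℕ-fromℕ< i<m
  uniform : ∀ (M : ℕ → Bool) {c} → (∀ {x y} → M (toℕ x) ≡ true → M (toℕ y) ≡ false → A (v (toℕ x)) (v (toℕ y)) ≡ c) →
            ∀ {i s j} → (∃ λ x → toℕ {m} x ≡ i) → (∃ λ x → toℕ {m} x ≡ s) → (∃ λ x → toℕ {m} x ≡ j) →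
            s ≢ i → M i ≡ true → M s ≡ true → M j ≡ false → ⊥
  uniform M {c} col (x , refl) (y , refl) (o , refl) s≢i Mx My Mo
    with prime g (M ∘ toℕ) {x} {y} {o} (λ { refl → s≢i refl }) Mx My Mo
  ... | p , q , z , Mp , Mq , Mz , zp , zq = true≢false zp
    (trans (symmetric g z p) (trans (edge-colour p z Mp Mz) (trans (sym (edge-colour q z Mq Mz)) (trans
        (symmetric g q z) zq))))
    where
    edge-colour : ∀ p z → M (toℕ p) ≡ true → M (toℕ z) ≡ false → A p z ≡ c
    edge-colour p z Mp Mz = trans (cong₂ A (sym (onℕ-toℕ zero id p)) (sym (onℕ-toℕ zero id z))) (col Mp Mz)

  by-cut : ¬ Cut A v m
  -- A third vertex besides the witnesses of the two sides gives one side a second element; this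
  -- side is then a nontrivial module.
  by-cut C with third {m} (s≤s (s≤s (s≤s z≤n))) (Cut.i C) (Cut.j C)
  ... | s , s<m , s≢i , s≢j with Cut.side C s in ps
  ...   | true  = uniform side (λ {x} {y} Mx My → coloured (Fin.toℕ<n x) (Fin.toℕ<n y) Mx My)
                          (pick i<m) (pick s<m) (pick j<m) s≢i side-i ps side-j
    where open Cut C
  ...   | false = uniform (not ∘ side)
    (λ {x} {y} Mx My → trans (symmetric g _ _) (coloured (Fin.toℕ<n y) (Fin.toℕ<n x)
       (trans (sym (not-involutive _)) (cong not My)) (trans (sym (not-involutive _)) (cong not Mx))))
    (pick j<m) (pick s<m) (pick i<m) s≢j (cong not side-j) (cong not ps) (cong not side-i)
    where open Cut C

-- Minimal graphs

-- Unlike `edge′` this is false on the diagonal, as a `Graph` requires.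
graphEdge : Shape → ℕ → ℕ → Bool
graphEdge Q i j = if i <ᵇ j then edge Q i j else if j <ᵇ i then edge Q j i else false

graphEdge-sym : ∀ Q i j → graphEdge Q i j ≡ graphEdge Q j i
graphEdge-sym Q i j with <-cmp i j
... | tri< i<j _ _ rewrite <ᵇ-true i<j | <ᵇ-false {j} {i} (<⇒≤ i<j) = refl
... | tri≈ _ refl _ = refl
... | tri> _ _ j<i rewrite <ᵇ-true j<i | <ᵇ-false {i} {j} (<⇒≤ j<i) = refl

graphEdge-irrefl : ∀ Q i → graphEdge Q i i ≡ false
graphEdge-irrefl Q i rewrite <ᵇ-false {i} {i} ≤-refl = refl

graphEdge-< : ∀ Q {i j} → i < j → graphEdge Q i j ≡ edge Q i j
graphEdge-< Q i<j rewrite <ᵇ-true i<j = refl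

toGraph : ∀ Q → Graph (order Q)
toGraph Q = record
  { adj   = λ i j → graphEdge Q (toℕ i) (toℕ j)
  ; sym   = λ i j → graphEdge-sym Q (toℕ i) (toℕ j)
  ; irref = λ i → graphEdge-irrefl Q (toℕ i) }

Embedding : ∀ {k n} → Graph k → Graph n → (Fin k → Fin n) → Set
Embedding X G f = ∀ i j → adj G (f i) (f j) ≡ adj X i j

fits : Shape → Shape → ℕ → ℕ → List ℕ → Bool
fits T Q y j []      = true
fits T Q y j (x ∷ φ) = (graphEdge T x y == edge Q (length φ) j) ∧ fits T Q y j φ

-- φ lists the images of an initial part of Q from the last to the first.
everyEmbedding : Shape → Shape → (List ℕ → Bool) → ℕ → List ℕ → Bool
everyEmbedding T Q p zero    φ = p φ
everyEmbedding T Q p (suc r) φ = allBelow (order T) λ y →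
  if fits T Q y (length φ) φ then everyEmbedding T Q p r (y ∷ φ) else true

values : (ℕ → ℕ) → ℕ → List ℕ
values f zero    = []
values f (suc j) = f j ∷ values f j

length-values : ∀ f j → length (values f j) ≡ j
length-values f zero    = refl
length-values f (suc j) = cong suc (length-values f j)

module _ {T Q : Shape} {f : ℕ → ℕ} (f< : ∀ {i} → i < order Q → f i < order T)
         (hom : ∀ {i j} → i < j → j < order Q → graphEdge T (f i) (f j) ≡ edge Q i j) where

  fits-complete : ∀ {j} i → i ≤ j → j < order Q → fits T Q (f j) j (values f i) ≡ true
  fits-complete zero    _   _   = refl
  fits-complete {j} (suc i) i<j j<k rewrite length-values f i | hom i<j j<k =
    cong₂ _∧_ (==-refl (edge Q i j)) (fits-complete i (<⇒≤ i<j) j<k)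

  everyEmbedding-sound : ∀ {p} r {j} → r + j ≡ order Q → everyEmbedding T Q p r (values f j) ≡ true →
                         p (values f (order Q)) ≡ true
  everyEmbedding-sound zero    refl eq = eq
  everyEmbedding-sound {p} (suc r) {j} r+j eq = everyEmbedding-sound r (trans (+-suc r j) r+j)
    (if-true (subst (λ l → fits T Q (f j) l (values f j) ≡ true) (sym (length-values f j))
        (fits-complete j ≤-refl j<k))
      (allBelow-sound (order T) {λ y → if fits T Q y (length (values f j))
          (values f j) then everyEmbedding T Q p r (y ∷ values f j) else true} eq (f< j<k)))
    where
    j<k : j < order Q
    j<k = subst (j <_) r+j (s≤s (m≤n+m j r))

-- Since images are listed from the last to the first, this recognises the identity.
isIota : List ℕ → Bool
isIota []      = true
isIota (x ∷ φ) = (x ≡ᵇ length φ) ∧ isIota φ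

isIota-sound : ∀ f k → isIota (values f k) ≡ true → ∀ {i} → i < k → f i ≡ i
isIota-sound f (suc k) eq (s≤s i≤k) with m≤n⇒m<n∨m≡n i≤k
... | inj₁ i<k  = isIota-sound f k (∧-conicalʳ (f k ≡ᵇ length (values f k)) _ eq) i<k
... | inj₂ refl = trans (≡ᵇ-sound (f k) _ (∧-conicalˡ _ _ eq)) (length-values f k)

onℕ-< : ∀ {k m} (f : Fin k → Fin m) {i} → i < k → onℕ 0 (toℕ ∘ f) i < m
onℕ-< {k} f {i} i<k with i <? k
... | yes _ = Fin.toℕ<n _
... | no i≮k = contradiction i<k i≮k

every-embedding : ∀ {T Q p} → everyEmbedding T Q p (order Q) [] ≡ true →
                  ∀ h → Embedding (toGraph Q) (toGraph T) h → p (values (onℕ 0 (toℕ ∘ h)) (order Q)) ≡ true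
every-embedding {T} {Q} {p} eq h emb = everyEmbedding-sound {T} {Q} {onℕ 0 (toℕ ∘ h)} (onℕ-< h) hom {p} (order Q)
    (+-identityʳ _) eq
  where
  hom : ∀ {i j} → i < j → j < order Q → graphEdge T (onℕ 0 (toℕ ∘ h) i) (onℕ 0 (toℕ ∘ h) j) ≡ edge Q i j
  hom {i} {j} i<j j<k with i <? order Q | j <? order Q
  ... | yes i<k | yes j<k′ = trans (emb _ _) (trans (cong₂ (graphEdge Q) (Fin.toℕ-fromℕ< i<k)
      (Fin.toℕ-fromℕ< j<k′)) (graphEdge-< Q i<j))
  ... | no i≮k  | _        = contradiction (<-trans i<j j<k) i≮k
  ... | yes _   | no j≮k   = contradiction j<k j≮k

everyFin : ∀ n → (Fin n → Bool) → Bool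
everyFin zero    p = true
everyFin (suc n) p = p zero ∧ everyFin n (p ∘ suc)

everyFin-sound : ∀ n {p} → everyFin n p ≡ true → ∀ i → p i ≡ true
everyFin-sound (suc n) {p} eq zero    = ∧-conicalˡ (p zero) _ eq
everyFin-sound (suc n) {p} eq (suc i) = everyFin-sound n (∧-conicalʳ (p zero) _ eq) i

Embeds : ∀ {k n} → Graph k → Graph n → Set
Embeds X G = ∃ λ f → Injective _≡_ _≡_ f × Embedding X G f

Embeds-trans : ∀ {k m n} {X : Graph k} {H : Graph m} {G : Graph n} → Embeds X H → Embeds H G → Embeds X G
Embeds-trans (f , f-inj , f-emb) (h , h-inj , h-emb) =
  h ∘ f , (λ eq → f-inj (h-inj eq)) , λ i j → trans (h-emb (f i) (f j)) (f-emb i j)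

induced-embeds : ∀ {k n} (G : Graph n) (f : Fin k → Fin n) → Injective _≡_ _≡_ f → Embeds (induced G f) G
induced-embeds G f inj = f , inj , λ _ _ → refl

anyVec? : ∀ {n} k {P : Vec (Fin n) k → Set} → (∀ vs → Dec (P vs)) → Dec (∃ P)
anyVec? zero    P? = map′ ([] ,_) (λ { ([] , p) → p }) (P? [])
anyVec? (suc k) P? = map′ (λ { (x , xs , p) → x ∷ xs , p }) (λ { (x ∷ xs , p) → x , xs , p })
  (Fin.any? λ x → anyVec? k λ xs → P? (x ∷ xs))

realises⇒embedding : ∀ {n} {G : Graph n} {Q e} → Realises (adj G) Q e → Embedding (toGraph Q) G (e ∘ toℕ)
realises⇒embedding {G = G} {Q} {e} r i j with <-cmp (toℕ i) (toℕ j)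
... | tri< i<j _ _ = trans (r i<j (Fin.toℕ<n j)) (sym (graphEdge-< Q i<j))
... | tri≈ _ i≡j _ = trans (trans (cong (adj G _ ∘ e) (sym i≡j)) (irref G _))
                           (sym (trans (cong (graphEdge Q (toℕ i)) (sym i≡j)) (graphEdge-irrefl Q (toℕ i))))
... | tri> _ _ j<i = trans (adj-sym G _ _) (trans (r j<i (Fin.toℕ<n i)) (trans (sym (graphEdge-< Q j<i))
    (graphEdge-sym Q (toℕ j) (toℕ i))))

embedding⇒realises : ∀ {n} {G : Graph n} {Q} x {f} → Embedding (toGraph Q) G f → Realises (adj G) Q (onℕ x f)
embedding⇒realises {Q = Q} x {f} emb {i} {j} i<j j<k with i <? order Q | j <? order Q
... | yes i<k | yes j<k′ = trans (emb _ _) (trans (cong₂ (graphEdge Q) (Fin.toℕ-fromℕ< i<k) (Fin.toℕ-fromℕ< j<k′))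
    (graphEdge-< Q i<j))
... | no i≮k  | _        = contradiction (<-trans i<j j<k) i≮k
... | yes _   | no j≮k   = contradiction j<k j≮k

asymmetric⇒involutionFree : ∀ {n} {G : Graph n} → Asymmetric G → InvolutionFree G
asymmetric⇒involutionFree asym σ aut (≢id , _) = ≢id (asym σ aut)

lookup-unique : ∀ {A : Set} {xs : List A} → Unique xs → ∀ {i j} → List.lookup xs i ≡ List.lookup xs j → i ≡ j
lookup-unique (x∉ ∷ u) {zero}  {zero}  _  = refl
lookup-unique (x∉ ∷ u) {zero}  {suc j} eq = contradiction eq (All.lookup x∉ (∈-lookup j))
lookup-unique (x∉ ∷ u) {suc i} {zero}  eq = contradiction (sym eq) (All.lookup x∉ (∈-lookup i))
lookup-unique (x∉ ∷ u) {suc i} {suc j} eq = cong suc (lookup-unique u eq)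

two-elements : ∀ {m} {i j : Fin m} → i ≢ j → 2 ≤ m
two-elements {suc zero}    {zero} {zero} i≢j = contradiction refl i≢j
two-elements {suc (suc m)} _ = s≤s (s≤s z≤n)

module _ {n} (G : Graph n) where

  involutionFree⇒rigid : InvolutionFree G → ∀ (τ : Fin n → Fin n) → (∀ x → τ (τ x) ≡ x) →
                         (∀ x y → adj G (τ x) (τ y) ≡ adj G x y) → ∀ x → τ x ≡ x
  involutionFree⇒rigid free τ inv aut x with τ x Fin.≟ x
  ... | yes eq = eq
  ... | no ne  = ⊥-elim (free (permutation τ τ inv inv) aut ((λ fix → ne (fix x)) , inv))

  module-involutionFree : InvolutionFree G → ∀ {k} (f : Fin k → Fin n) → Injective _≡_ _≡_ f →
    (∀ v → (∀ i → v ≢ f i) → ∀ i j → adj G v (f i) ≡ adj G v (f j)) → InvolutionFree (induced G f)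
  -- With no vertex there is no default value for `onℕ`, and every permutation is the identity.
  module-involutionFree free {zero}  f inj mod σ aut (≢id , _) = ≢id λ ()
  module-involutionFree free {suc k} f inj mod σ aut (≢id , inv) = ≢id λ x →
    Fin.toℕ-injective (trans (sym (π-toℕ x)) (fixed
        (involutionFree⇒rigid free extend extend-involutive extend-aut) (Fin.toℕ<n x)))
    where
    e : ℕ → Fin n
    e = onℕ (f zero) f
    π : ℕ → ℕ
    π = onℕ 0 (toℕ ∘ (σ ⟨$⟩ʳ_))
    e-toℕ : ∀ i → e (toℕ i) ≡ f i
    e-toℕ = onℕ-toℕ (f zero) f
    π-toℕ : ∀ i → π (toℕ i) ≡ toℕ (σ ⟨$⟩ʳ i)
    π-toℕ = onℕ-toℕ 0 (toℕ ∘ (σ ⟨$⟩ʳ_))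
    eπ-toℕ : ∀ i → e (π (toℕ i)) ≡ f (σ ⟨$⟩ʳ i)
    eπ-toℕ i = trans (cong e (π-toℕ i)) (e-toℕ _)
    onFin : ∀ {P : ℕ → Set} → (∀ (i : Fin (suc k)) → P (toℕ i)) → ∀ {i} → i < suc k → P i
    onFin {P} p i<k = subst P (Fin.toℕ-fromℕ< i<k) (p (fromℕ< i<k))
    e-inj : ∀ {i j} → i < suc k → j < suc k → e i ≡ e j → i ≡ j
    e-inj {j = j} i<k = onFin {λ i → j < suc k → e i ≡ e j → i ≡ j} (λ x j<k →
      onFin {λ j → e (toℕ x) ≡ e j → toℕ x ≡ j} (λ y eq → cong toℕ (inj (trans (sym (e-toℕ x)) (trans eq
          (e-toℕ y))))) j<k) i<k
    π< : ∀ {i} → i < suc k → π i < suc k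
    π< = onFin λ x → subst (_< suc k) (sym (π-toℕ x)) (Fin.toℕ<n _)
    ππ : ∀ {i} → i < suc k → π (π i) ≡ i
    ππ = onFin λ x → trans (cong π (π-toℕ x)) (trans (π-toℕ _) (cong toℕ (inv x)))
    e-aut : ∀ {i j} → i < suc k → j < suc k → adj G (e (π i)) (e (π j)) ≡ adj G (e i) (e j)
    e-aut {j = j} i<k j<k = onFin {λ i → adj G (e (π i)) (e (π j)) ≡ adj G (e i) (e j)} (λ x →
      onFin {λ j → adj G (e (π (toℕ x))) (e (π j)) ≡ adj G (e (toℕ x)) (e j)} (λ y →
        trans (cong₂ (adj G) (eπ-toℕ x) (eπ-toℕ y)) (trans (aut x y) (sym (cong₂ (adj G) (e-toℕ x)
            (e-toℕ y))))) j<k) i<k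
    outer : ∀ v → (∀ {i} → i < suc k → v ≢ e i) → ∀ {i} → i < suc k → adj G v (e (π i)) ≡ adj G v (e i)
    outer v v∉ = onFin λ x → trans (cong (adj G v) (eπ-toℕ x))
      (trans (mod v (λ i v≡ → v∉ (Fin.toℕ<n i) (trans v≡ (sym (e-toℕ i)))) _ x) (cong (adj G v) (sym (e-toℕ x))))
    open Extension (adj-sym G) (suc k) e π e-inj π< ππ e-aut outer

  minimal-prime : MinimalInvolutionFree G → ∀ (M : Fin n → Bool) {x y o} → x ≢ y → M x ≡ true → M y ≡ true
      → M o ≡ false →
    ∃₂ λ p q → ∃ λ z → M p ≡ true × M q ≡ true × M z ≡ false × adj G z p ≡ true × adj G z q ≡ false
  minimal-prime (_ , free , minimal) M {x} {y} {o} x≢y Mx My Mo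
    with Fin.any? (λ p → Fin.any? λ q → Fin.any? λ z →
      (M p ≟ᵇ true) ×-dec (M q ≟ᵇ true) ×-dec (M z ≟ᵇ false)
      ×-dec (adj G z p ≟ᵇ true) ×-dec (adj G z q ≟ᵇ false))
  ... | yes splitter = splitter
  ... | no ∄ = ⊥-elim (minimal (length xs) 2≤ <n (List.lookup xs) inj
      (module-involutionFree free (List.lookup xs) inj uniform))
    where
    xs = filter (λ v → M v ≟ᵇ true) (allFin n)
    inj : Injective _≡_ _≡_ (List.lookup xs)
    inj = lookup-unique (filter⁺ (λ v → M v ≟ᵇ true) (allFin⁺ n))
    member : ∀ {v} → M v ≡ true → v ∈ xs
    member Mv = ∈-filter⁺ (λ v → M v ≟ᵇ true) (∈-allFin _) Mv
    M-lookup : ∀ i → M (List.lookup xs i) ≡ true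
    M-lookup i = proj₂ (∈-filter⁻ (λ v → M v ≟ᵇ true) {xs = allFin n} (∈-lookup i))
    <n : length xs < n
    <n = subst (length xs <_) (List.length-tabulate id)
      (List.filter-notAll (λ v → M v ≟ᵇ true) (allFin n)
        (Any.map (λ o≡v Mv → true≢false (trans (cong M o≡v) Mv) Mo) (∈-allFin o)))
    2≤ : 2 ≤ length xs
    2≤ = two-elements {i = index (member Mx)} {index (member My)} λ eq → x≢y
      (trans (Any.lookup-index (member Mx)) (trans (cong (List.lookup xs) eq) (sym (Any.lookup-index (member My)))))
    uniform : ∀ v → (∀ i → v ≢ List.lookup xs i) → ∀ i j → adj G v (List.lookup xs i) ≡ adj G v (List.lookup xs j)
    uniform v v∉ i j with adj G v (List.lookup xs i) in vi | adj G v (List.lookup xs j) in vj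
    ... | true  | true  = refl
    ... | false | false = refl
    ... | true  | false = ⊥-elim (∄ (_ , _ , v , M-lookup i , M-lookup j , Mv , vi , vj))
      where
      Mv : M v ≡ false
      Mv = ¬-not λ Mv → v∉ (index (member Mv)) (Any.lookup-index (member Mv))
    ... | false | true  = ⊥-elim (∄ (_ , _ , v , M-lookup j , M-lookup i , Mv , vj , vi))
      where
      Mv : M v ≡ false
      Mv = ¬-not λ Mv → v∉ (index (member Mv)) (Any.lookup-index (member Mv))

-- A value `y` that is not attained could be removed by `punchOut`, leaving an injection into a
-- smaller set.
injective⇒surjective : ∀ {n} {f : Fin n → Fin n} → Injective _≡_ _≡_ f → ∀ y → ∃ λ x → f x ≡ y
injective⇒surjective {suc n} {f} inj y with Fin.any? (λ x → f x Fin.≟ y)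
... | yes found = found
... | no ∄ = contradiction (Fin.injective⇒≤ {f = λ x → punchOut (y≢ x)} λ {a} {b} eq → inj (Fin.punchOut-injective (y≢ a) (y≢ b) eq))
                           (<⇒≱ (n<1+n n))
  where
  y≢ : ∀ x → y ≢ f x
  y≢ x eq = ∄ (x , sym eq)

spanning-iso : ∀ {k n} {Y : Graph k} {G : Graph n} → k ≡ n → Embeds Y G → G ≅ Y
spanning-iso {Y = Y} {G} refl (f , inj , emb) = permutation from f from-f f-from , λ x y →
  trans (sym (emb _ _)) (cong₂ (adj G) (f-from x) (f-from y))
  where
  from : _ → _
  from y = proj₁ (injective⇒surjective inj y)
  f-from : ∀ y → f (from y) ≡ y
  f-from y = proj₂ (injective⇒surjective inj y)
  from-f : ∀ x → from (f x) ≡ x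
  from-f x = inj (f-from (f x))

iso-embeds : ∀ {k n} {Y : Graph k} {G : Graph n} → G ≅ Y → Embeds G Y
iso-embeds (σ , iso) = σ ⟨$⟩ʳ_ , (λ eq → trans (sym (inverseˡ σ)) (trans (cong (σ ⟨$⟩ˡ_) eq) (inverseˡ σ))) , iso

-- Classification from a complete list of graphs

module Classification {m} (Xs : Vec Shape m)
  (complete : ∀ {Q} → Q ∈ base → (∃ λ i → lookup Xs i ≡ Q) × (∃ λ i → lookup Xs i ≡ co Q))
  (large : ∀ i → 2 ≤ order (lookup Xs i))
  (X-twinFree : ∀ i → twinFree (lookup Xs i) ≡ true)
  (asymmetric : ∀ i → Asymmetric (toGraph (lookup Xs i)))
  (incomparable : ∀ {i j} → i ≢ j → ∀ h → Injective _≡_ _≡_ h →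
                  ¬ Embedding (toGraph (lookup Xs j)) (toGraph (lookup Xs i)) h)
  where

  X : Fin m → Shape
  X = lookup Xs

  embedding-injective : ∀ {n} {G : Graph n} i {f} → Embedding (toGraph (X i)) G f → Injective _≡_ _≡_ f
  embedding-injective {G = G} i {f} emb {x} {y} eq = Fin.toℕ-injective
    (twinFree-injective {e = onℕ (f x) f} (adj-sym G) (embedding⇒realises {G = G} {X i} (f x) {f} emb)
        (X-twinFree i) (Fin.toℕ<n x) (Fin.toℕ<n y)
      (trans (onℕ-toℕ (f x) f x) (trans eq (sym (onℕ-toℕ (f x) f y)))))

  Contains : ∀ {n} → Graph n → Set
  Contains G = ∃ λ i → Embeds (toGraph (X i)) G

  contains? : ∀ {n} (G : Graph n) → Dec (Contains G)
  contains? G = map′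
    (λ (i , vs , emb) → i , lookup vs , embedding-injective {G = G} i emb , emb)
    (λ (i , f , _ , emb) → i , Vec.tabulate f , λ x y →
      trans (cong₂ (adj G) (Vec.lookup∘tabulate f x) (Vec.lookup∘tabulate f y)) (emb x y))
    (Fin.any? λ i → anyVec? (order (X i)) λ vs → Fin.all? λ x → Fin.all? λ y →
      adj G (lookup vs x) (lookup vs y) ≟ᵇ adj (toGraph (X i)) x y)

  embedded-asymmetric : ∀ {n} {G : Graph n} i {f} → Embedding (toGraph (X i)) G f → Asymmetric (induced G f)
  embedded-asymmetric i emb σ aut = asymmetric i σ λ x y → trans (sym (emb _ _)) (trans (aut x y) (emb x y))

  minimal-contains : ∀ {n} (G : Graph n) → MinimalInvolutionFree G → Contains G
  minimal-contains G min with contains? G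
  ... | yes c = c
  ... | no ∄  = ⊥-elim (no-good (adj G) (proj₁ min) record
    { symmetric = adj-sym G
    ; diagonal  = λ x y → trans (irref G x) (sym (irref G y))
    ; excluded  = λ Q∈ e → avoid (proj₁ (complete Q∈)) , avoid (proj₂ (complete Q∈))
    ; prime     = minimal-prime G min
    ; rigid     = involutionFree⇒rigid G (proj₁ (proj₂ min)) })
    where
    avoid : ∀ {Q e} → (∃ λ i → X i ≡ Q) → ¬ Realises (adj G) Q e
    avoid (i , refl) r = ∄ (i , _ , embedding-injective {G = G} i emb , emb)
      where
      emb = realises⇒embedding {G = G} {X i} r

  -- Strong induction: an involution-free proper induced subgraph contains a listed graph already,
  -- and if there is none then `G` is minimal. Deciding containment beforehand supplies the
  -- contradiction that minimality, a negative statement, asks for.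
  involutionFree-contains : ∀ {n} (G : Graph n) → 2 ≤ n → InvolutionFree G → Contains G
  involutionFree-contains {n} = <-rec (λ n → (G : Graph n) → 2 ≤ n → InvolutionFree G → Contains G) step′ n
    where
    step′ : ∀ n → (∀ {m} → m < n → (G : Graph m) → 2 ≤ m → InvolutionFree G → Contains G) →
           (G : Graph n) → 2 ≤ n → InvolutionFree G → Contains G
    step′ n rec G 2≤n free with contains? G
    ... | yes c = c
    ... | no ∄  = minimal-contains G (2≤n , free , λ k 2≤k k<n f inj free′ →
      let i , emb = rec k<n (induced G f) 2≤k free′ in
      ∄ (i , Embeds-trans {X = toGraph (X i)} {induced G f} {G} emb (induced-embeds G f inj)))

  -- The listed graph contained in `G` is asymmetric, hence involution-free, so by minimality it has
  -- as many vertices as `G`.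
  minimal-iso : ∀ {n} (G : Graph n) → MinimalInvolutionFree G → ∃ λ i → G ≅ toGraph (X i)
  minimal-iso {n} G (2≤n , free , minimal) with involutionFree-contains G 2≤n free
  ... | i , f , inj , emb with m≤n⇒m<n∨m≡n (Fin.injective⇒≤ inj)
  ...   | inj₁ k<n = ⊥-elim (minimal _ (large i) k<n f inj (asymmetric⇒involutionFree {G = induced G f}
      (embedded-asymmetric {G = G} i emb)))
  ...   | inj₂ k≡n = i , spanning-iso {Y = toGraph (X i)} {G} k≡n (f , inj , emb)

  iso-asymmetric : ∀ {n} {G : Graph n} i → G ≅ toGraph (X i) → Asymmetric G
  iso-asymmetric {G = G} i (π , iso) σ aut x =
    trans (sym (inverseˡ π)) (trans (cong (π ⟨$⟩ˡ_) (trans (cong (λ u → π ⟨$⟩ʳ (σ ⟨$⟩ʳ u)) (sym (inverseˡ π)))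
      (asymmetric i (inverse π ∘ₚ σ ∘ₚ π) conj (π ⟨$⟩ʳ x)))) (inverseˡ π))
    where
    conj : IsAut (toGraph (X i)) (inverse π ∘ₚ σ ∘ₚ π)
    conj u w = trans (iso _ _) (trans (aut _ _) (trans (sym (iso _ _)) (cong₂ (adj (toGraph (X i))) (inverseʳ π)
        (inverseʳ π))))

  -- An involution-free proper induced subgraph would contain a listed graph, which then embeds in
  -- the different listed graph isomorphic to `G`.
  iso-minimal : ∀ {n} (G : Graph n) i → G ≅ toGraph (X i) → MinimalInvolutionFree G
  iso-minimal {n} G i G≅X =
    subst (2 ≤_) (sym (↔⇒≡ (proj₁ G≅X))) (large i) ,
    asymmetric⇒involutionFree {G = G} (iso-asymmetric {G = G} i G≅X) ,
    λ k 2≤k k<n f inj free → smaller k<n f inj (involutionFree-contains (induced G f) 2≤k free)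
    where
    smaller : ∀ {k} → k < n → (f : Fin k → Fin n) → Injective _≡_ _≡_ f → ¬ Contains (induced G f)
    smaller k<n f inj (j , h , h-inj , h-emb) with
      Embeds-trans {X = toGraph (X j)} {G} {toGraph (X i)} (f ∘ h , (λ eq → h-inj (inj eq)) , h-emb)
          (iso-embeds {Y = toGraph (X i)} {G} G≅X)
    ... | h′ , h′-inj , h′-emb = incomparable i≢j h′ h′-inj h′-emb
      where
      i≢j : i ≢ j
      i≢j refl = <⇒≱ k<n (subst (_≤ _) (sym (↔⇒≡ (proj₁ G≅X))) (Fin.injective⇒≤ h-inj))

  -- Asymmetric graphs are involution-free but not conversely, so minimality does not transfer by
  -- itself. What bridges the gap is that an involution-free induced subgraph contains a listed
  -- graph, which is asymmetric.
  equivalence : ∀ n (G : Graph n) → MinimalInvolutionFree G ⇔ MinimalAsymmetric G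
  equivalence n G = mk⇔
    (λ min@(2≤n , free , minimal) → let i , G≅X = minimal-iso G min in
      2≤n , iso-asymmetric {G = G} i G≅X , λ k 2≤k k<n f inj asym → minimal k 2≤k k<n f inj
          (asymmetric⇒involutionFree {G = induced G f} asym))
    (λ (2≤n , asym , minimal) → 2≤n , asymmetric⇒involutionFree {G = G} asym , λ k 2≤k k<n f inj free →
      let i , h , h-inj , h-emb = involutionFree-contains (induced G f) 2≤k free in
      minimal (order (X i)) (large i) (≤-<-trans (Fin.injective⇒≤ h-inj) k<n) (f ∘ h) (λ eq → h-inj (inj eq))
        (embedded-asymmetric {G = G} i h-emb))

  toAnyGraph : Shape → AnyGraph
  toAnyGraph Q = order Q , toGraph Q

  graphs : Vec AnyGraph m
  graphs = Vec.map toAnyGraph Xs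

  lookup-graphs : ∀ i → lookup graphs i ≡ toAnyGraph (X i)
  lookup-graphs i = Vec.lookup-map i toAnyGraph Xs

  non-isomorphic : ∀ i j → i ≢ j → ¬ (proj₂ (lookup graphs i) ≅ proj₂ (lookup graphs j))
  non-isomorphic i j i≢j iso rewrite lookup-graphs i | lookup-graphs j =
    let h , h-inj , h-emb = iso-embeds {Y = toGraph (X j)} {toGraph (X i)} iso in
    incomparable (≢-sym i≢j) h h-inj h-emb

  classification : ∀ n (G : Graph n) → MinimalInvolutionFree G ⇔ (∃ λ i → G ≅ proj₂ (lookup graphs i))
  classification n G = mk⇔
    (λ min → let i , iso = minimal-iso G min in i , subst (λ Y → G ≅ proj₂ Y) (sym (lookup-graphs i)) iso)
    (λ (i , iso) → iso-minimal G i (subst (λ Y → G ≅ proj₂ Y) (lookup-graphs i) iso))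

-- The 18 graphs

shapes : Vec Shape 18
shapes = Vec.fromList (base ++ map co base)

shape-index : ∀ {Q} {Qs : List Shape} → Q ∈ Qs → ∃ λ i → lookup (Vec.fromList Qs) i ≡ Q
shape-index (here refl) = zero , refl
shape-index (there Q∈)  = let i , eq = shape-index Q∈ in suc i , eq

X-large : ∀ i → 2 ≤ order (lookup shapes i)
X-large i = <ᵇ-sound 1 _ (everyFin-sound 18 {λ i → 1 <ᵇ order (lookup shapes i)} refl i)

X-twinFree : ∀ i → twinFree (lookup shapes i) ≡ true
X-twinFree = everyFin-sound 18 {twinFree ∘ lookup shapes} refl

rigidᵇ : Shape → Bool
rigidᵇ Q = everyEmbedding Q Q isIota (order Q) []

X-rigid : ∀ i → rigidᵇ (lookup shapes i) ≡ true
X-rigid = everyFin-sound 18 {rigidᵇ ∘ lookup shapes} refl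

-- With the constantly false predicate the search succeeds only if no partial embedding can be
-- completed. A target of smaller order is settled by counting vertices.
incomparableᵇ : Shape → Shape → Bool
incomparableᵇ T Q = if order T <ᵇ order Q then true else everyEmbedding T Q (λ _ → false) (order Q) []

X-incomparableᵇ : ∀ i j → (if toℕ i ≡ᵇ toℕ j then true else incomparableᵇ (lookup shapes i) (lookup shapes j)) ≡ true
X-incomparableᵇ i = everyFin-sound 18 (everyFin-sound 18
  {λ i → everyFin 18 λ j → if toℕ i ≡ᵇ toℕ j then true else incomparableᵇ (lookup shapes i) (lookup shapes j)} refl i)

X-incomparable : ∀ {i j} → i ≢ j → ∀ h → Injective _≡_ _≡_ h → ¬ Embedding (toGraph (lookup shapes j))
    (toGraph (lookup shapes i)) h
X-incomparable {i} {j} i≢j h inj emb with toℕ i ≡ᵇ toℕ j in eq | X-incomparableᵇ i j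
... | true  | _ = i≢j (Fin.toℕ-injective (≡ᵇ-sound _ _ eq))
... | false | inc with order (lookup shapes i) <ᵇ order (lookup shapes j) in lt
...   | true  = <⇒≱ (<ᵇ-sound _ _ lt) (Fin.injective⇒≤ inj)
...   | false = case every-embedding {lookup shapes i} {lookup shapes j} {λ _ → false} inc h emb of λ ()

X-asymmetric : ∀ i → Asymmetric (toGraph (lookup shapes i))
X-asymmetric i σ aut x = Fin.toℕ-injective (trans (sym (onℕ-toℕ 0 (toℕ ∘ (σ ⟨$⟩ʳ_)) x))
  (isIota-sound (onℕ 0 (toℕ ∘ (σ ⟨$⟩ʳ_))) (order (lookup shapes i))
      (every-embedding {lookup shapes i} {lookup shapes i} {isIota} (X-rigid i) (σ ⟨$⟩ʳ_) aut) (Fin.toℕ<n x)))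

X-complete : ∀ {Q} → Q ∈ base → (∃ λ i → lookup shapes i ≡ Q) × (∃ λ i → lookup shapes i ≡ co Q)
X-complete Q∈ = shape-index (∈-++⁺ˡ Q∈) , shape-index (∈-++⁺ʳ base (∈-map⁺ co Q∈))

open Classification shapes X-complete X-large X-twinFree X-asymmetric X-incomparable

theorem2 : (∀ (n : ℕ) (G : Graph n) → MinimalInvolutionFree G ⇔ MinimalAsymmetric G)
    × Σ (Vec AnyGraph 18) (λ Gs →
    (∀ (i j : Fin 18) → i ≢ j →
    ¬ (proj₂ (lookup Gs i) ≅ proj₂ (lookup Gs j)))
    × (∀ (n : ℕ) (G : Graph n) →
    MinimalInvolutionFree G ⇔ (∃ λ (i : Fin 18) → G ≅ proj₂ (lookup Gs i))))
theorem2 = equivalence , graphs , non-isomorphic , classification
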